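{- The following hold. (1) For every integer $m\ge 3$, $R_3(x-y=(m-2)z)=m^3-m^2-m-1$. (2) For every integer $a\ge 3$, $R_3(a(x-y)=(a-1)z)=a^3+(a-1)^2$. (3) For all integers $a,b$ with $b\ge 1$, $a\ge b+2$ and $\gcd(a,b)=1$, $R_3(a(x-y)=bz)=a^3$.
   Context: For a linear equation $\mathcal{E}$ in variables $x_1,\dots,x_m$ and a positive integer $k$, the $k$-color Rado number $R_k(\mathcal{E})$ is the smallest positive integer $n$ such that every coloring of $[n]=\{1,\dots,n\}$ with $k$ colors admits a monochromatic solution to $\mathcal{E}$ (i.e. positive integers $x_1,\dots,x_m\in[n]$, all of the same color, satisfying $\mathcal{E}$); if no such $n$ exists (equivalently, some $k$-coloring of $\mathbb{N}$ has no monochromatic solution), $R_k(\mathcal{E})=\infty$. -}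

module Defs where

open import Data.Nat using (ℕ; _≤_; _<_)
open import Data.Integer as ℤ using (ℤ; +_)
open import Data.Fin using (Fin)
open import Data.Product using (Σ; _×_)
open import Relation.Binary.PropositionalEquality using (_≡_)
open import Relation.Nullary using (¬_)

Equation3 : Set₁
Equation3 = ℤ → ℤ → ℤ → Set

-- k-coloring of the positive integers; only values on [n] = {1..n} matter
-- (every coloring of [n] extends to such a function).
Coloring : ℕ → Set
Coloring k = ℕ → Fin k

InRange : ℕ → ℕ → Set
InRange n x = (1 ≤ x) × (x ≤ n)

MonoSol : ∀ {k} → Equation3 → ℕ → Coloring k → Set
MonoSol E n c =
  Σ ℕ λ x → Σ ℕ λ y → Σ ℕ λ z →
    InRange n x × InRange n y × InRange n z ×
    (c x ≡ c y) × (c y ≡ c z) × E (+ x) (+ y) (+ z)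

RadoProp : Equation3 → ℕ → ℕ → Set
RadoProp E k n = (c : Coloring k) → MonoSol E n c

IsRadoNumber : Equation3 → ℕ → ℕ → Set
IsRadoNumber E k n = (1 ≤ n) × RadoProp E k n × (∀ m → 1 ≤ m → m < n → ¬ RadoProp E k m)

eqA : ℤ → Equation3
eqA c x y z = x ℤ.- y ≡ c ℤ.* z

eqB : ℤ → ℤ → Equation3
eqB a b x y z = a ℤ.* (x ℤ.- y) ≡ b ℤ.* z

module Submission where

-- Upper bounds.  Substituting m = t + 3 in (1), a = t + 3 in (2) and b = b′ + 1, a = b′ + t + 3
-- in (3), the integers that matter are polynomials p in the parameters with natural coefficients.
-- Both 1 ≤ p ≤ N and the equation for a triple of such p hold coefficientwise, so a single finite
-- decision tree, whose leaves are monochromatic solutions, treats all parameter values at once.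
-- The trees were found by computer search and are verified by evaluating a Boolean checker that is
-- proved sound.  Homogeneous cubics in a and b would not suffice for (3): if d = a − b divides a,
-- dividing them by d³ would refute the bound a³ for the pair a/d, a/d − 1, contradicting (2).
--
-- Lower bounds.  In (3) one colours by the exponent of a in x.  In (2) this colouring only fails at
-- a³; it is repaired by recolouring a³ and splitting the non-multiples of a into three intervals.
-- In (1) one colours by blocks, as for Schur numbers.

open import Defs
open import Data.Bool using (Bool; true; false; T; _∧_; _∨_)
open import Data.Bool.ListAction using (all)
open import Data.Bool.Properties using (T-∧; T-∨; T-≡)
open import Data.Empty using (⊥)
open import Data.Fin using (Fin) renaming (_≟_ to _≟ᶠ_)
open import Data.Fin.Patterns using (0F; 1F; 2F)
open import Data.Fin.Properties using (all?; any?)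
open import Data.Integer as ℤ using (+_)
import Data.Integer.Properties as ℤ
open import Data.List using (List; []; _∷_; map)
open import Data.List.Relation.Unary.All as All using (All; []; _∷_)
open import Data.List.Relation.Unary.All.Properties using (all⁺)
open import Data.Nat
open import Data.Nat.Coprimality using (Coprime; coprime-divisor; gcd≡1⇒coprime)
open import Data.Nat.Divisibility
open import Data.Nat.DivMod using (_/_; _%_)
open import Data.Nat.GCD using (gcd)
open import Data.Nat.Properties
open import Data.Nat.Tactic.RingSolver using (solve-∀)
open import Data.Product using (∃; ∃-syntax; _×_; _,_; proj₁; proj₂)
open import Data.Sum using (_⊎_; inj₁; inj₂)
open import Data.Vec using (Vec; []; _∷_)
open import Function using (_∘_)
open import Function.Bundles using (Equivalence)
open import Relation.Binary.PropositionalEquality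
open import Relation.Nullary using (¬_; yes; no; contradiction)
open import Relation.Nullary.Decidable using (from-yes; _×-dec_; _⊎-dec_)

-- The bounds have recognisable sources. In (1) one more colour turns a bound R into mR - 1,
-- starting from m - 1 for one colour: this gives m² - m - 1 and then m³ - m² - m - 1. For coprime a
-- and b, a solution in which a^k divides x and y has z divisible by a^(k+1), so each colour takes
-- care of one exponent of a and the third is exhausted at a³. For b = a - 1 one can go further: z =
-- q a² forces x - y = q ab, and [1 , a³ + b²) splits into intervals of lengths ab, a²b and ab that
-- avoid the relevant differences. For the upper bounds the obstacle is uniformity. A leaf may only
-- use a solution that is an identity in the parameters, and its points must be visibly in range.
-- The substitutions put the least admissible parameters at the origin, where a - b, for instance,
-- becomes t + 2. Coefficientwise comparison is sufficient for an inequality at all parameter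
-- values, but not necessary, so the points have to be chosen to pass it.

-- Polynomials with natural coefficients, the constant coefficient first

Poly : ℕ → Set
Poly zero    = ℕ
Poly (suc n) = List (Poly n)

⟦_⟧ : ∀ {n} → Poly n → Vec ℕ n → ℕ
⟦_⟧ {zero}  c        _       = c
⟦_⟧ {suc n} []       _       = 0
⟦_⟧ {suc n} (p ∷ ps) (x ∷ ρ) = ⟦ p ⟧ ρ + x * ⟦ ps ⟧ (x ∷ ρ)

constant : ∀ {n} → ℕ → Poly n
constant {zero}  c = c
constant {suc n} c = constant c ∷ []

infixl 6 _⊕_
infixl 7 _⊗_
infix 4 _≤ᵖ_ _≡ᵖ_

_⊕_ : ∀ {n} → Poly n → Poly n → Poly n
_⊕_ {zero}  c        d        = c + d
_⊕_ {suc n} []       qs       = qs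
_⊕_ {suc n} (p ∷ ps) []       = p ∷ ps
_⊕_ {suc n} (p ∷ ps) (q ∷ qs) = p ⊕ q ∷ ps ⊕ qs

_⊗_ : ∀ {n} → Poly n → Poly n → Poly n
_⊗_ {zero}  c        d  = c * d
_⊗_ {suc n} []       qs = []
_⊗_ {suc n} (p ∷ ps) qs = map (p ⊗_) qs ⊕ (constant 0 ∷ ps ⊗ qs)

-- A missing coefficient counts as zero, so polynomials need not be normalised: `cubic` pads with
-- zeros, and `_⊗_` may leave trailing ones.
_≤ᵖ_ : ∀ {n} → Poly n → Poly n → Bool
_≤ᵖ_ {zero}  c        d        = c ≤ᵇ d
_≤ᵖ_ {suc n} []       qs       = true
_≤ᵖ_ {suc n} (p ∷ ps) []       = (p ≤ᵖ constant 0) ∧ (ps ≤ᵖ [])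
_≤ᵖ_ {suc n} (p ∷ ps) (q ∷ qs) = (p ≤ᵖ q) ∧ (ps ≤ᵖ qs)

⟦constant⟧ : ∀ {n} c (ρ : Vec ℕ n) → ⟦ constant c ⟧ ρ ≡ c
⟦constant⟧ c []      = refl
⟦constant⟧ c (x ∷ ρ) = trans (cong₂ _+_ (⟦constant⟧ c ρ) (*-zeroʳ x)) (+-identityʳ c)

⟦⊕⟧ : ∀ {n} (p q : Poly n) ρ → ⟦ p ⊕ q ⟧ ρ ≡ ⟦ p ⟧ ρ + ⟦ q ⟧ ρ
⟦⊕⟧ {zero}  p        q        ρ       = refl
⟦⊕⟧ {suc n} []       q        ρ       = refl
⟦⊕⟧ {suc n} (p ∷ ps) []       ρ       = sym (+-identityʳ _)
⟦⊕⟧ {suc n} (p ∷ ps) (q ∷ qs) (x ∷ ρ)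
  rewrite ⟦⊕⟧ p q ρ | ⟦⊕⟧ ps qs (x ∷ ρ) =
  interchange (⟦ p ⟧ ρ) (⟦ q ⟧ ρ) x (⟦ ps ⟧ (x ∷ ρ)) (⟦ qs ⟧ (x ∷ ρ))
  where
  interchange : ∀ p q x r s → p + q + x * (r + s) ≡ p + x * r + (q + x * s)
  interchange = solve-∀

⟦⊗⟧ : ∀ {n} (p q : Poly n) ρ → ⟦ p ⊗ q ⟧ ρ ≡ ⟦ p ⟧ ρ * ⟦ q ⟧ ρ
-- The coefficients multiplied by `p` are polynomials in one variable fewer, so this lemma and `⟦⊗⟧`
-- call each other while the number of variables decreases.
⟦scale⟧ : ∀ {n} (p : Poly n) (q : Poly (suc n)) x ρ →
          ⟦ map (p ⊗_) q ⟧ (x ∷ ρ) ≡ ⟦ p ⟧ ρ * ⟦ q ⟧ (x ∷ ρ)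

⟦⊗⟧ {zero}  p        q ρ = refl
⟦⊗⟧ {suc n} []       q ρ = refl
⟦⊗⟧ {suc n} (p ∷ ps) q (x ∷ ρ)
  rewrite ⟦⊕⟧ (map (p ⊗_) q) (constant 0 ∷ ps ⊗ q) (x ∷ ρ)
        | ⟦scale⟧ p q x ρ | ⟦constant⟧ 0 ρ | ⟦⊗⟧ ps q (x ∷ ρ) =
  distrib (⟦ p ⟧ ρ) x (⟦ ps ⟧ (x ∷ ρ)) (⟦ q ⟧ (x ∷ ρ))
  where
  distrib : ∀ p x r q → p * q + x * (r * q) ≡ (p + x * r) * q
  distrib = solve-∀

⟦scale⟧ p []       x ρ = sym (*-zeroʳ (⟦ p ⟧ ρ))
⟦scale⟧ p (q ∷ qs) x ρ
  rewrite ⟦⊗⟧ p q ρ | ⟦scale⟧ p qs x ρ =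
  distrib (⟦ p ⟧ ρ) (⟦ q ⟧ ρ) x (⟦ qs ⟧ (x ∷ ρ))
  where
  distrib : ∀ p q x r → p * q + x * (p * r) ≡ p * (q + x * r)
  distrib = solve-∀

-- Arguments are natural numbers, hence every monomial is nonnegative and the value is monotone in
-- each coefficient. The converse fails, as x ≤ x² shows.
≤ᵖ⇒≤ : ∀ {n} (p q : Poly n) ρ → T (p ≤ᵖ q) → ⟦ p ⟧ ρ ≤ ⟦ q ⟧ ρ
≤ᵖ⇒≤ {zero}  p        q        ρ       h = ≤ᵇ⇒≤ p q h
≤ᵖ⇒≤ {suc n} []       q        ρ       h = z≤n
≤ᵖ⇒≤ {suc n} (p ∷ ps) []       (x ∷ ρ) h with Equivalence.to T-∧ h
... | hp , hps = ≤-trans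
  (+-mono-≤ (≤-trans (≤ᵖ⇒≤ p (constant 0) ρ hp) (≤-reflexive (⟦constant⟧ 0 ρ)))
            (*-monoʳ-≤ x (≤ᵖ⇒≤ ps [] (x ∷ ρ) hps)))
  (≤-reflexive (*-zeroʳ x))
≤ᵖ⇒≤ {suc n} (p ∷ ps) (q ∷ qs) (x ∷ ρ) h with Equivalence.to T-∧ h
... | hp , hps = +-mono-≤ (≤ᵖ⇒≤ p q ρ hp) (*-monoʳ-≤ x (≤ᵖ⇒≤ ps qs (x ∷ ρ) hps))

-- Decision trees and certificates

-- `split p` branches on the colour of point number `p`, with one subtree per colour; `leaf s` names
-- the solution that has become monochromatic. All numbers are indices into tables of polynomials,
-- so that one tree serves all parameter values.
data Tree : Set where
  leaf  : ℕ → Tree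
  split : ℕ → Tree → Tree → Tree → Tree

_∈ᵇ_ : ℕ → List ℕ → Bool
i ∈ᵇ []       = false
i ∈ᵇ (j ∷ js) = (i ≡ᵇ j) ∨ (i ∈ᵇ js)

∈ᵇ-All : ∀ {P : ℕ → Set} i {is} → T (i ∈ᵇ is) → All P is → P i
∈ᵇ-All {P} i {j ∷ js} h (p ∷ ps) with Equivalence.to (T-∨ {i ≡ᵇ j}) h
... | inj₁ e = subst P (sym (≡ᵇ⇒≡ i j e)) p
... | inj₂ m = ∈ᵇ-All i m ps

-- Two comparisons instead of syntactic equality, because sums and products may carry trailing
-- zeros.
_≡ᵖ_ : ∀ {n} → Poly n → Poly n → Bool
p ≡ᵖ q = (p ≤ᵖ q) ∧ (q ≤ᵖ p)

lookupOr : {A : Set} → A → List A → ℕ → A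
lookupOr d []       i       = d
lookupOr d (x ∷ xs) zero    = x
lookupOr d (x ∷ xs) (suc i) = lookupOr d xs i

-- An index out of range returns the default, which has the property as well; this spares every test
-- of a tree index against the length of a table.
lookupOr-All : {A : Set} {P : A → Set} {d : A} {xs : List A} →
               P d → All P xs → ∀ i → P (lookupOr d xs i)
lookupOr-All pd []       i       = pd
lookupOr-All pd (p ∷ ps) zero    = p
lookupOr-All pd (p ∷ ps) (suc i) = lookupOr-All pd ps i

-- The table of solutions is divided into rows because a lookup is linear in the length of a list.
rowLength : ℕ
rowLength = 16

-- Up to renaming the colours, point p₀ has the first colour and p₁ the first or the second one;
-- s₀ refutes the former case and the tree the latter.
record Certificate (n : ℕ) : Set where
  field
    α β N     : Poly n
    points    : List (Poly n)
    solutions : List (List (ℕ × ℕ × ℕ))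
    p₀ p₁     : ℕ
    s₀        : ℕ × ℕ × ℕ
    tree      : Tree

-- This is the renaming of colours: if `j` differs from `i`, take `j` as the second colour and the
-- remaining one as the third; if they agree, any enumeration starting with `i` will do. The nine
-- pairs are settled by evaluation.
three-colours : ∀ (i j : Fin 3) → ∃[ g ] ∃[ b ]
  (∀ k → k ≡ i ⊎ k ≡ g ⊎ k ≡ b) × (j ≡ i ⊎ j ≡ g)
three-colours = from-yes (all? {n = 3} λ i → all? {n = 3} λ j → any? {n = 3} λ g → any? {n = 3} λ b →
  all? {n = 3} (λ k → (k ≟ᶠ i) ⊎-dec (k ≟ᶠ g) ⊎-dec (k ≟ᶠ b)) ×-dec ((j ≟ᶠ i) ⊎-dec (j ≟ᶠ g)))

-- The equation is written without subtraction, so that both of its sides are polynomials with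
-- natural coefficients. With a = 1 it also covers (1).
LinearSol : ℕ → ℕ → ℕ → Coloring 3 → Set
LinearSol a b n c = ∃[ x ] ∃[ y ] ∃[ z ]
  InRange n x × InRange n y × InRange n z × c x ≡ c y × c y ≡ c z × a * x ≡ a * y + b * z

-- The checker and its soundness

module _ {n : ℕ} (C : Certificate n) where
  open Certificate C

  point : ℕ → Poly n
  point = lookupOr (constant 1) points

  inRangeᵇ : Poly n → Bool
  inRangeᵇ p = (constant 1 ≤ᵖ p) ∧ (p ≤ᵖ N)

  solvesᵇ : ℕ × ℕ × ℕ → Bool
  solvesᵇ (i , j , k) = α ⊗ point i ≡ᵖ α ⊗ point j ⊕ β ⊗ point k

  solution : ℕ → ℕ × ℕ × ℕ
  solution s = lookupOr s₀ (lookupOr [] solutions (s / rowLength)) (s % rowLength)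

  containsᵇ : ℕ × ℕ × ℕ → List ℕ → Bool
  containsᵇ (i , j , k) is = (i ∈ᵇ is) ∧ (j ∈ᵇ is) ∧ (k ∈ᵇ is)

  -- The accumulators hold the points on the current branch, sorted by colour. A leaf tests
  -- membership only: equations and ranges are checked once per table entry by `validᵇ`, not again
  -- at every leaf.
  refutesᵇ : Tree → (R G B : List ℕ) → Bool
  refutesᵇ (leaf s)        R G B =
    containsᵇ (solution s) R ∨ containsᵇ (solution s) G ∨ containsᵇ (solution s) B
  refutesᵇ (split p t u v) R G B =
    refutesᵇ t (p ∷ R) G B ∧ refutesᵇ u R (p ∷ G) B ∧ refutesᵇ v R G (p ∷ B)

  validᵇ : Bool
  -- The defaults `constant 1` and `s₀` are checked along with the tables, because `point` and
  -- `solution` return them for indices out of range.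
  validᵇ = all inRangeᵇ (constant 1 ∷ points) ∧ all (all solvesᵇ) ((s₀ ∷ []) ∷ solutions)
         ∧ containsᵇ s₀ (p₁ ∷ p₀ ∷ []) ∧ refutesᵇ tree (p₀ ∷ []) (p₁ ∷ []) []

  module _ (ρ : Vec ℕ n) (c : Coloring 3) where

    Sol : Set
    Sol = LinearSol (⟦ α ⟧ ρ) (⟦ β ⟧ ρ) (⟦ N ⟧ ρ) c

    value : ℕ → ℕ
    value i = ⟦ point i ⟧ ρ

    Coloured : Fin 3 → List ℕ → Set
    Coloured k = All (λ i → c (value i) ≡ k)

    inRange-sound : ∀ {p} → T (inRangeᵇ p) → InRange (⟦ N ⟧ ρ) (⟦ p ⟧ ρ)
    inRange-sound {p} h with Equivalence.to T-∧ h
    ... | l , u = ≤-trans (≤-reflexive (sym (⟦constant⟧ 1 ρ))) (≤ᵖ⇒≤ (constant 1) p ρ l)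
                , ≤ᵖ⇒≤ p N ρ u

    solves-sound : ∀ {i j k} → T (solvesᵇ (i , j , k)) →
                   ⟦ α ⟧ ρ * value i ≡ ⟦ α ⟧ ρ * value j + ⟦ β ⟧ ρ * value k
    solves-sound {i} {j} {k} h with Equivalence.to T-∧ h
    ... | le , ge =
      trans (sym (⟦⊗⟧ α (point i) ρ))
            (trans (≤-antisym (≤ᵖ⇒≤ l r ρ le) (≤ᵖ⇒≤ r l ρ ge))
                   (trans (⟦⊕⟧ (α ⊗ point j) (β ⊗ point k) ρ)
                          (cong₂ _+_ (⟦⊗⟧ α (point j) ρ) (⟦⊗⟧ β (point k) ρ))))
      where
      l r : Poly n
      l = α ⊗ point i
      r = α ⊗ point j ⊕ β ⊗ point k

    module _ (inRange : ∀ i → InRange (⟦ N ⟧ ρ) (value i)) where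

      contains-sound : ∀ {s l is} → T (solvesᵇ s) → T (containsᵇ s is) → Coloured l is → Sol
      contains-sound {i , j , k} {is = is} valid h col with Equivalence.to T-∧ h
      ... | mi , h₁ with Equivalence.to (T-∧ {j ∈ᵇ is}) h₁
      ... | mj , mk = value i , value j , value k , inRange i , inRange j , inRange k ,
        trans (∈ᵇ-All i mi col) (sym (∈ᵇ-All j mj col)) ,
        trans (∈ᵇ-All j mj col) (sym (∈ᵇ-All k mk col)) , solves-sound {i} {j} {k} valid

      -- The colouring `c` selects a path through the tree: at each split `cover` tells which
      -- subtree to enter, and the queried point joins the list of its colour. At the leaf reached,
      -- the named solution lies inside one list.
      refutes-sound : (∀ s → T (solvesᵇ (solution s))) → ∀ {r g b} →
                      (∀ k → k ≡ r ⊎ k ≡ g ⊎ k ≡ b) → ∀ t {R G B} → T (refutesᵇ t R G B) →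
                      Coloured r R → Coloured g G → Coloured b B → Sol
      refutes-sound valid cover (leaf s) {R} {G} {B} h cr cg cb
        with Equivalence.to (T-∨ {containsᵇ (solution s) R}) h
      ... | inj₁ hr = contains-sound (valid s) hr cr
      ... | inj₂ h′ with Equivalence.to (T-∨ {containsᵇ (solution s) G}) h′
      ...   | inj₁ hg = contains-sound (valid s) hg cg
      ...   | inj₂ hb = contains-sound (valid s) hb cb
      refutes-sound valid cover (split p t u v) {R} {G} {B} h cr cg cb
        with Equivalence.to (T-∧ {refutesᵇ t (p ∷ R) G B}) h
      ... | ht , h′ with Equivalence.to (T-∧ {refutesᵇ u R (p ∷ G) B}) h′ | cover (c (value p))
      ... | hu , hv | inj₁ e        = refutes-sound valid cover t ht (e ∷ cr) cg cb
      ... | hu , hv | inj₂ (inj₁ e) = refutes-sound valid cover u hu cr (e ∷ cg) cb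
      ... | hu , hv | inj₂ (inj₂ e) = refutes-sound valid cover v hv cr cg (e ∷ cb)

    valid⇒Sol : T validᵇ → Sol
    valid⇒Sol h with Equivalence.to (T-∧ {all inRangeᵇ (constant 1 ∷ points)}) h
    ... | ranges , h′ with Equivalence.to (T-∧ {all (all solvesᵇ) ((s₀ ∷ []) ∷ solutions)}) h′
    ... | solve , h″
      with Equivalence.to (T-∧ {containsᵇ s₀ (p₁ ∷ p₀ ∷ [])}) h″
         | three-colours (c (value p₀)) (c (value p₁))
         | all⁺ inRangeᵇ (constant 1 ∷ points) ranges
         | All.map (λ {row} → all⁺ solvesᵇ row) (all⁺ (all solvesᵇ) ((s₀ ∷ []) ∷ solutions) solve)
    ... | h₀ , h₁ | g , b , cover , p₁-colour | one ∷ ranges | (solve₀ ∷ []) ∷ solves =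
      by-colour p₁-colour
      where
      inRange : ∀ i → InRange (⟦ N ⟧ ρ) (value i)
      inRange = lookupOr-All {P = λ p → InRange (⟦ N ⟧ ρ) (⟦ p ⟧ ρ)}
                             (inRange-sound one) (All.map inRange-sound ranges)
      valid : ∀ s → T (solvesᵇ (solution s))
      -- A row number out of range gives the empty row, in which every lookup returns `s₀`.
      valid s = lookupOr-All {P = T ∘ solvesᵇ} solve₀
                  (lookupOr-All {P = All (T ∘ solvesᵇ)} [] solves (s / rowLength)) (s % rowLength)
      by-colour : c (value p₁) ≡ c (value p₀) ⊎ c (value p₁) ≡ g → Sol
      by-colour (inj₁ e) = contains-sound inRange solve₀ h₀ (e ∷ refl ∷ [])
      by-colour (inj₂ e) = refutes-sound inRange valid cover tree h₁ (refl ∷ []) (e ∷ []) []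

-- Most splits are forced moves: two of the colours complete a monochromatic solution at once. The
-- subscript is the colour that survives, and the two leaves keep the order of the colours. With
-- `none` the branch is closed.
only₀ only₁ only₂ : ℕ → ℕ → ℕ → Tree → Tree
only₀ p s s′ t = split p t (leaf s) (leaf s′)
only₁ p s s′ t = split p (leaf s) t (leaf s′)
only₂ p s s′ t = split p (leaf s) (leaf s′) t

none : ℕ → ℕ → ℕ → ℕ → Tree
none p s s′ s″ = split p (leaf s) (leaf s′) (leaf s″)

-- cᵢⱼ is the coefficient of tⁱ b′ʲ.
cubic : (c₀₀ c₀₁ c₀₂ c₀₃ c₁₀ c₁₁ c₁₂ c₂₀ c₂₁ c₃₀ : ℕ) → Poly 2
cubic c₀₀ c₀₁ c₀₂ c₀₃ c₁₀ c₁₁ c₁₂ c₂₀ c₂₁ c₃₀ =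
  (c₀₀ ∷ c₀₁ ∷ c₀₂ ∷ c₀₃ ∷ []) ∷ (c₁₀ ∷ c₁₁ ∷ c₁₂ ∷ []) ∷ (c₂₀ ∷ c₂₁ ∷ []) ∷ (c₃₀ ∷ []) ∷ []

-- Certificate for (1), polynomials in t where m − 2 = t + 1

points1 : List (Poly 1)
points1 =
  (2 ∷ 1 ∷ []) ∷ (1 ∷ []) ∷ (4 ∷ 4 ∷ 1 ∷ []) ∷ (5 ∷ 5 ∷ 1 ∷ []) ∷ (10 ∷ 15 ∷ 7 ∷ 1 ∷ []) ∷
  (3 ∷ 1 ∷ []) ∷ (6 ∷ 6 ∷ 1 ∷ []) ∷ (3 ∷ 2 ∷ []) ∷ (8 ∷ 12 ∷ 6 ∷ 1 ∷ []) ∷ (2 ∷ []) ∷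
  (11 ∷ 16 ∷ 7 ∷ 1 ∷ []) ∷ (1 ∷ 1 ∷ []) ∷ (6 ∷ 7 ∷ 2 ∷ []) ∷ (12 ∷ 18 ∷ 8 ∷ 1 ∷ []) ∷
  (7 ∷ 8 ∷ 2 ∷ []) ∷ (3 ∷ 3 ∷ 1 ∷ []) ∷ (4 ∷ 1 ∷ []) ∷ (9 ∷ 14 ∷ 7 ∷ 1 ∷ []) ∷
  (13 ∷ 19 ∷ 8 ∷ 1 ∷ []) ∷ (7 ∷ 11 ∷ 6 ∷ 1 ∷ []) ∷ (9 ∷ 13 ∷ 6 ∷ 1 ∷ []) ∷ (8 ∷ 9 ∷ 2 ∷ []) ∷
  (6 ∷ 5 ∷ 1 ∷ []) ∷ (7 ∷ 5 ∷ 1 ∷ []) ∷ (4 ∷ 3 ∷ []) ∷ (4 ∷ 2 ∷ []) ∷ (5 ∷ 6 ∷ 2 ∷ []) ∷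
  (7 ∷ 6 ∷ 1 ∷ []) ∷ (3 ∷ 4 ∷ 1 ∷ []) ∷ (8 ∷ 6 ∷ 1 ∷ []) ∷ (14 ∷ 20 ∷ 8 ∷ 1 ∷ []) ∷
  (5 ∷ 8 ∷ 5 ∷ 1 ∷ []) ∷ (2 ∷ 3 ∷ 1 ∷ []) ∷ (7 ∷ 10 ∷ 5 ∷ 1 ∷ []) ∷ (8 ∷ 13 ∷ 7 ∷ 1 ∷ []) ∷
  (11 ∷ 17 ∷ 8 ∷ 1 ∷ []) ∷ (12 ∷ 17 ∷ 7 ∷ 1 ∷ []) ∷ (8 ∷ 10 ∷ 3 ∷ []) ∷ (4 ∷ 5 ∷ 1 ∷ []) ∷
  (9 ∷ 6 ∷ 1 ∷ []) ∷ (10 ∷ 12 ∷ 3 ∷ []) ∷ (4 ∷ 5 ∷ 2 ∷ []) ∷ (5 ∷ 3 ∷ []) ∷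
  (10 ∷ 14 ∷ 6 ∷ 1 ∷ []) ∷ (5 ∷ 4 ∷ 1 ∷ []) ∷ (6 ∷ 9 ∷ 5 ∷ 1 ∷ []) ∷ (13 ∷ 18 ∷ 7 ∷ 1 ∷ []) ∷
  (6 ∷ 2 ∷ []) ∷ (7 ∷ 7 ∷ 1 ∷ []) ∷ (2 ∷ 2 ∷ 1 ∷ []) ∷ (8 ∷ 11 ∷ 4 ∷ []) ∷ (7 ∷ 9 ∷ 3 ∷ []) ∷
  (11 ∷ 15 ∷ 5 ∷ []) ∷ (3 ∷ 5 ∷ 1 ∷ []) ∷ (9 ∷ 10 ∷ 2 ∷ []) ∷ (6 ∷ 10 ∷ 6 ∷ 1 ∷ []) ∷
  (10 ∷ 6 ∷ 1 ∷ []) ∷ []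

-- A triple lists the point numbers of x, y and z. Entry j of row i is the solution called 16 i + j
-- in the leaves.
solutions1 : List (List (ℕ × ℕ × ℕ))
solutions1 =
  ((2 , 0 , 0) ∷ (3 , 0 , 5) ∷ (2 , 1 , 5) ∷ (8 , 0 , 22) ∷ (8 , 2 , 2) ∷ (10 , 3 , 22) ∷
   (4 , 3 , 3) ∷ (10 , 4 , 1) ∷ (14 , 3 , 0) ∷ (10 , 14 , 2) ∷ (19 , 0 , 3) ∷ (31 , 0 , 28) ∷
   (19 , 2 , 28) ∷ (4 , 14 , 28) ∷ (4 , 19 , 5) ∷ (31 , 1 , 2) ∷ []) ∷
  ((8 , 31 , 5) ∷ (10 , 8 , 5) ∷ (19 , 1 , 22) ∷ (4 , 2 , 22) ∷ (22 , 5 , 5) ∷ (3 , 2 , 1) ∷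
   (4 , 8 , 0) ∷ (31 , 15 , 32) ∷ (28 , 32 , 1) ∷ (19 , 31 , 0) ∷ (15 , 0 , 11) ∷ (26 , 15 , 0) ∷
   (26 , 2 , 11) ∷ (19 , 26 , 32) ∷ (32 , 11 , 11) ∷ (8 , 3 , 28) ∷ []) ∷
  ((12 , 15 , 5) ∷ (12 , 26 , 1) ∷ (12 , 3 , 11) ∷ (4 , 0 , 29) ∷ (4 , 15 , 23) ∷ (29 , 23 , 1) ∷
   (13 , 4 , 0) ∷ (13 , 2 , 29) ∷ (13 , 26 , 23) ∷ (18 , 4 , 5) ∷ (18 , 13 , 1) ∷ (6 , 7 , 5) ∷
   (4 , 7 , 27) ∷ (18 , 6 , 27) ∷ (13 , 3 , 27) ∷ (13 , 6 , 6) ∷ []) ∷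
  ((18 , 3 , 29) ∷ (4 , 12 , 2) ∷ (10 , 20 , 0) ∷ (4 , 20 , 11) ∷ (10 , 0 , 39) ∷ (4 , 1 , 39) ∷
   (30 , 10 , 5) ∷ (18 , 10 , 0) ∷ (30 , 18 , 1) ∷ (10 , 7 , 29) ∷ (23 , 16 , 5) ∷ (18 , 12 , 23) ∷
   (30 , 4 , 16) ∷ (20 , 31 , 16) ∷ (30 , 3 , 39) ∷ (12 , 7 , 7) ∷ []) ∷
  ((2 , 7 , 11) ∷ (8 , 7 , 3) ∷ (2 , 15 , 1) ∷ (26 , 0 , 7) ∷ (28 , 11 , 0) ∷ (8 , 12 , 32) ∷
   (8 , 26 , 15) ∷ (24 , 0 , 9) ∷ (24 , 7 , 1) ∷ (33 , 31 , 9) ∷ (33 , 7 , 2) ∷ (33 , 3 , 32) ∷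
   (3 , 24 , 11) ∷ (7 , 1 , 9) ∷ (3 , 15 , 9) ∷ (3 , 7 , 0) ∷ []) ∷
  ((25 , 9 , 9) ∷ (14 , 7 , 25) ∷ (21 , 0 , 47) ∷ (14 , 1 , 47) ∷ (40 , 21 , 0) ∷ (40 , 14 , 5) ∷
   (48 , 3 , 9) ∷ (40 , 48 , 7) ∷ (48 , 24 , 5) ∷ (40 , 2 , 47) ∷ (21 , 14 , 1) ∷ (21 , 24 , 25) ∷
   (12 , 0 , 25) ∷ (14 , 12 , 1) ∷ (41 , 49 , 0) ∷ (50 , 41 , 25) ∷ []) ∷
  ((4 , 50 , 49) ∷ (50 , 2 , 24) ∷ (2 , 49 , 9) ∷ (41 , 1 , 7) ∷ (12 , 41 , 9) ∷ (21 , 12 , 9) ∷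
   (37 , 12 , 0) ∷ (37 , 14 , 11) ∷ (51 , 0 , 42) ∷ (52 , 12 , 42) ∷ (52 , 51 , 25) ∷
   (52 , 37 , 7) ∷ (51 , 2 , 7) ∷ (42 , 25 , 1) ∷ (37 , 7 , 42) ∷ (37 , 2 , 25) ∷ []) ∷
  ((18 , 14 , 22) ∷ (14 , 2 , 5) ∷ (6 , 0 , 16) ∷ (3 , 1 , 16) ∷ (21 , 6 , 0) ∷ (34 , 0 , 6) ∷
   (17 , 0 , 27) ∷ (34 , 1 , 27) ∷ (17 , 6 , 53) ∷ (34 , 3 , 53) ∷ (35 , 17 , 0) ∷ (13 , 35 , 1) ∷
   (54 , 6 , 5) ∷ (54 , 21 , 1) ∷ (13 , 54 , 53) ∷ (21 , 3 , 5) ∷ []) ∷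
  ((27 , 5 , 16) ∷ (35 , 2 , 27) ∷ (17 , 34 , 1) ∷ (6 , 24 , 0) ∷ (10 , 24 , 27) ∷ (18 , 21 , 3) ∷
   (18 , 17 , 16) ∷ (55 , 0 , 38) ∷ (55 , 1 , 3) ∷ (4 , 6 , 38) ∷ (4 , 55 , 16) ∷ (13 , 21 , 38) ∷
   (34 , 2 , 38) ∷ (13 , 34 , 16) ∷ (21 , 2 , 16) ∷ (6 , 3 , 1) ∷ []) ∷
  ((43 , 8 , 9) ∷ (43 , 24 , 22) ∷ (43 , 6 , 2) ∷ (4 , 24 , 6) ∷ (8 , 15 , 44) ∷ (8 , 45 , 0) ∷
   (33 , 0 , 44) ∷ (33 , 45 , 1) ∷ (33 , 2 , 15) ∷ (45 , 15 , 15) ∷ (22 , 44 , 1) ∷ (4 , 26 , 44) ∷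
   (17 , 3 , 38) ∷ (17 , 7 , 6) ∷ (27 , 22 , 1) ∷ (6 , 2 , 9) ∷ []) ∷
  ((13 , 14 , 3) ∷ (13 , 10 , 11) ∷ (14 , 6 , 11) ∷ (17 , 12 , 28) ∷ (17 , 8 , 11) ∷
   (20 , 0 , 23) ∷ (8 , 1 , 23) ∷ (20 , 19 , 9) ∷ (46 , 20 , 16) ∷ (46 , 43 , 5) ∷ (5 , 9 , 1) ∷
   (46 , 10 , 9) ∷ (46 , 6 , 23) ∷ (10 , 2 , 23) ∷ (20 , 8 , 1) ∷ (20 , 6 , 28) ∷ []) ∷
  ((8 , 19 , 1) ∷ (17 , 19 , 0) ∷ (35 , 4 , 11) ∷ (19 , 15 , 2) ∷ (19 , 45 , 11) ∷ (35 , 26 , 22) ∷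
   (18 , 2 , 39) ∷ (4 , 17 , 1) ∷ (17 , 2 , 3) ∷ (36 , 0 , 56) ∷ (10 , 1 , 56) ∷ (36 , 20 , 5) ∷
   (30 , 36 , 0) ∷ (30 , 6 , 29) ∷ (35 , 3 , 6) ∷ (17 , 1 , 29) ∷ []) ∷
  ((29 , 16 , 16) ∷ (36 , 4 , 9) ∷ (30 , 13 , 9) ∷ (18 , 20 , 25) ∷ (13 , 8 , 25) ∷ (30 , 2 , 56) ∷
   (36 , 10 , 1) ∷ (36 , 3 , 23) ∷ (20 , 3 , 2) ∷ []) ∷
  []

-- Point 2 is (m - 1)², kept from the colour of m - 1 by (m - 1)² = (m - 1) + (m - 2)(m - 1). Point
-- 3 is m² - m - 1, the bound for two colours: if (m - 1)² has the colour of 1, then m² - m - 1 = (m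
-- - 1)² + (m - 2) · 1 cannot have it too (solution 21).
tree1 : Tree
tree1 =
  split 2
   (leaf 0)
   (split 3
     (only₂ 5 1 2 (
      split 22
       (only₂ 8 3 4 (only₁ 10 5 17 (only₀ 31 15 16 (only₂ 4 6 7 (only₂ 14 8 9 (only₁ 19 10 14 (
        none 28 11 12 13)))))))
       (only₂ 19 10 18 (none 4 6 19 14))
       (leaf 20)))
     (leaf 21)
     (split 8
       (only₁ 4 22 6 (only₂ 22 3 19 (only₀ 5 2 20 (none 10 17 7 5))))
       (leaf 4)
       (split 15
         (split 31
           (only₁ 28 11 31 (only₂ 32 23 24 (only₂ 19 25 12 (only₁ 11 26 30 (none 26 27 28 29)))))
           (leaf 15)
           (only₀ 5 2 16 (
            split 7
             (split 26
               (leaf 27)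
               (only₂ 12 32 33 (none 11 26 28 34))
               (split 4
                 (split 29
                   (leaf 35)
                   (only₂ 23 36 37 (none 13 38 39 40))
                   (only₁ 18 41 48 (only₂ 13 38 42 (only₁ 6 43 47 (none 27 44 45 46)))))
                 (only₂ 12 32 49 (only₂ 22 20 19 (only₁ 11 26 34 (only₀ 10 7 5 (only₂ 20 50 51 (
                  only₂ 39 52 53 (only₁ 30 54 62 (only₂ 18 55 56 (only₀ 16 60 61 (only₁ 29 57 48 (
                  none 23 58 37 59)))))))))))
                 (leaf 6)))
             (only₂ 12 32 63 (none 11 26 64 34))
             (leaf 65))))
         (leaf 66)
         (split 7
           (only₁ 26 67 70 (only₂ 12 63 33 (only₀ 11 28 34 (only₁ 32 30 69 (none 28 68 24 31)))))
           (only₀ 9 77 78 (only₂ 24 71 72 (only₀ 11 64 76 (only₁ 28 68 31 (only₂ 32 30 24 (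
            only₀ 33 74 75 (none 31 73 15 23)))))))
           (leaf 65)))))
   (split 3
     (split 14
       (leaf 8)
       (split 7
         (leaf 79)
         (split 9
           (only₂ 25 80 81 (only₂ 24 71 72 (only₀ 21 90 91 (only₂ 47 82 83 (only₁ 40 84 89 (
            only₂ 5 1 85 (none 48 86 87 88)))))))
           (leaf 77)
           (only₀ 25 81 80 (only₂ 12 92 93 (only₁ 4 6 49 (only₀ 21 90 101 (only₀ 41 99 100 (
            only₂ 24 91 72 (only₁ 49 94 98 (none 50 95 96 97)))))))))
         (only₀ 12 93 63 (only₁ 11 34 64 (only₂ 37 102 103 (only₁ 25 92 111 (only₀ 42 109 110 (
          only₁ 51 104 108 (none 52 105 106 107))))))))
       (only₁ 5 1 113 (
        split 22
         (only₁ 8 3 4 (none 10 5 17 9))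
         (leaf 20)
         (only₁ 4 6 19 (only₀ 10 7 9 (none 18 55 41 112))))))
     (split 6
       (only₂ 16 114 115 (only₁ 21 116 142 (
        split 34
         (leaf 117)
         (split 17
           (only₂ 27 118 119 (only₂ 53 120 121 (only₁ 35 122 129 (only₀ 5 127 128 (
            only₂ 13 47 123 (none 54 124 125 126))))))
           (leaf 130)
           (only₀ 18 133 134 (only₂ 27 45 119 (only₀ 5 127 128 (only₂ 4 41 6 (only₁ 22 20 19 (
            only₁ 7 43 44 (only₂ 10 55 5 (none 24 131 72 132)))))))))
         (only₁ 13 47 141 (only₀ 38 139 140 (only₂ 55 135 136 (none 4 137 6 138)))))))
       (leaf 143)
       (split 8
         (only₂ 4 22 6 (only₁ 22 3 19 (
          split 9
           (only₁ 24 71 147 (none 43 144 145 146))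
           (split 44
             (only₂ 15 148 78 (only₁ 45 149 153 (none 33 150 151 152)))
             (leaf 154)
             (split 7
               (only₁ 12 63 49 (none 26 67 33 155))
               (leaf 77)
               (only₀ 5 20 43 (only₀ 27 158 44 (only₁ 17 118 157 (only₂ 16 128 115 (
                only₀ 38 156 137 (none 55 135 136 138))))))))
           (leaf 159))))
         (split 28
           (split 7
             (split 4
               (only₁ 13 38 47 (only₂ 14 13 160 (only₂ 27 44 46 (only₁ 11 68 162 (only₀ 18 42 45 (
                none 10 55 161 9))))))
               (leaf 6)
               (only₁ 12 63 49 (only₂ 26 67 33 (none 11 68 34 28))))
             (leaf 65)
             (only₁ 11 68 64 (only₀ 12 34 63 (none 17 163 164 157))))
           (leaf 31)
           (only₀ 19 176 12 (only₀ 20 174 175 (only₂ 23 165 166 (only₁ 9 167 159 (only₁ 10 50 173 (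
            only₀ 43 144 146 (only₀ 46 171 172 (only₂ 16 168 115 (none 5 169 170 58))))))))))
         (leaf 4)))
     (split 8
       (only₁ 4 22 6 (only₀ 17 183 184 (
        split 22
         (leaf 3)
         (only₂ 19 177 18 (only₂ 27 118 158 (only₁ 35 122 129 (only₂ 11 164 178 (only₀ 26 181 28 (
          only₁ 45 149 180 (none 15 27 153 179)))))))
         (only₀ 10 7 5 (only₂ 39 52 53 (only₁ 5 17 20 (none 18 55 41 182)))))))
       (only₀ 20 174 200 (only₂ 23 165 166 (only₁ 10 50 173 (only₀ 36 198 199 (only₀ 4 7 6 (
        only₂ 56 185 186 (only₂ 5 187 17 (only₁ 30 188 197 (
        split 29
         (leaf 35)
         (only₀ 16 192 58 (only₀ 17 191 184 (only₂ 6 114 189 (only₁ 13 38 47 (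
          none 35 122 123 190)))))
         (only₁ 13 38 39 (only₀ 18 56 48 (only₂ 9 193 194 (none 25 195 196 80)))))))))))))
       (leaf 4)))

certificate1 : Certificate 1
certificate1 = record
  { α = 1 ∷ [] ; β = 1 ∷ 1 ∷ [] ; N = 14 ∷ 20 ∷ 8 ∷ 1 ∷ []
  ; points = points1 ; solutions = solutions1
  -- Points 0 and 1 are m - 1 and 1. They have different colours because m - 1 = 1 + (m - 2) · 1.
  ; p₀ = 0 ; p₁ = 1 ; s₀ = (0 , 1 , 1) ; tree = tree1
  }

-- Certificate for (2), polynomials in t where a = t + 3

points2 : List (Poly 1)
points2 =
  (27 ∷ 27 ∷ 9 ∷ 1 ∷ []) ∷ (9 ∷ 6 ∷ 1 ∷ []) ∷ (3 ∷ 1 ∷ []) ∷ (21 ∷ 22 ∷ 8 ∷ 1 ∷ []) ∷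
  (15 ∷ 11 ∷ 2 ∷ []) ∷ (6 ∷ 5 ∷ 1 ∷ []) ∷ (13 ∷ 10 ∷ 2 ∷ []) ∷ (15 ∷ 17 ∷ 7 ∷ 1 ∷ []) ∷
  (18 ∷ 21 ∷ 8 ∷ 1 ∷ []) ∷ (7 ∷ 5 ∷ 1 ∷ []) ∷ (18 ∷ 12 ∷ 2 ∷ []) ∷ (5 ∷ 2 ∷ []) ∷
  (24 ∷ 26 ∷ 9 ∷ 1 ∷ []) ∷ (17 ∷ 18 ∷ 7 ∷ 1 ∷ []) ∷ (11 ∷ 7 ∷ 1 ∷ []) ∷ (23 ∷ 23 ∷ 8 ∷ 1 ∷ []) ∷
  (25 ∷ 26 ∷ 9 ∷ 1 ∷ []) ∷ (1 ∷ []) ∷ (12 ∷ 16 ∷ 7 ∷ 1 ∷ []) ∷ (17 ∷ 12 ∷ 2 ∷ []) ∷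
  (19 ∷ 21 ∷ 8 ∷ 1 ∷ []) ∷ (31 ∷ 31 ∷ 10 ∷ 1 ∷ []) ∷ (9 ∷ 15 ∷ 7 ∷ 1 ∷ []) ∷
  (30 ∷ 31 ∷ 10 ∷ 1 ∷ []) ∷ (19 ∷ 15 ∷ 3 ∷ []) ∷ (21 ∷ 16 ∷ 3 ∷ []) ∷ (8 ∷ 6 ∷ 1 ∷ []) ∷
  (3 ∷ 4 ∷ 1 ∷ []) ∷ (11 ∷ 13 ∷ 6 ∷ 1 ∷ []) ∷ (12 ∷ 7 ∷ 1 ∷ []) ∷ (5 ∷ 4 ∷ 1 ∷ []) ∷ (2 ∷ 1 ∷ []) ∷
  (29 ∷ 28 ∷ 9 ∷ 1 ∷ []) ∷ (20 ∷ 22 ∷ 8 ∷ 1 ∷ []) ∷ (13 ∷ 14 ∷ 6 ∷ 1 ∷ []) ∷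
  (19 ∷ 19 ∷ 7 ∷ 1 ∷ []) ∷ (30 ∷ 28 ∷ 9 ∷ 1 ∷ []) ∷ (25 ∷ 20 ∷ 4 ∷ []) ∷ (26 ∷ 27 ∷ 9 ∷ 1 ∷ []) ∷
  (12 ∷ 10 ∷ 2 ∷ []) ∷ (9 ∷ 12 ∷ 6 ∷ 1 ∷ []) ∷ (30 ∷ 22 ∷ 4 ∷ []) ∷ (25 ∷ 24 ∷ 8 ∷ 1 ∷ []) ∷
  (6 ∷ 2 ∷ []) ∷ (31 ∷ 29 ∷ 9 ∷ 1 ∷ []) ∷ (14 ∷ 17 ∷ 7 ∷ 1 ∷ []) ∷ (14 ∷ 11 ∷ 2 ∷ []) ∷
  (10 ∷ 9 ∷ 2 ∷ []) ∷ (16 ∷ 14 ∷ 3 ∷ []) ∷ (13 ∷ 8 ∷ 1 ∷ []) ∷ (11 ∷ 9 ∷ 2 ∷ []) ∷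
  (3 ∷ 10 ∷ 6 ∷ 1 ∷ []) ∷ (17 ∷ 14 ∷ 3 ∷ []) ∷ (24 ∷ 23 ∷ 8 ∷ 1 ∷ []) ∷ (29 ∷ 24 ∷ 5 ∷ []) ∷
  (27 ∷ 18 ∷ 3 ∷ []) ∷ (23 ∷ 19 ∷ 4 ∷ []) ∷ (31 ∷ 25 ∷ 5 ∷ []) ∷ []

solutions2 : List (List (ℕ × ℕ × ℕ))
solutions2 =
  ((11 , 2 , 2) ∷ (3 , 2 , 0) ∷ (8 , 5 , 8) ∷ (3 , 1 , 8) ∷ (12 , 5 , 0) ∷ (3 , 11 , 12) ∷
   (26 , 5 , 2) ∷ (5 , 31 , 5) ∷ (26 , 31 , 1) ∷ (8 , 31 , 12) ∷ (12 , 26 , 12) ∷ (9 , 2 , 5) ∷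
   (2 , 17 , 2) ∷ (9 , 17 , 1) ∷ (6 , 2 , 4) ∷ (6 , 9 , 1) ∷ []) ∷
  ((4 , 14 , 5) ∷ (14 , 11 , 1) ∷ (4 , 2 , 10) ∷ (19 , 4 , 2) ∷ (19 , 11 , 10) ∷ (0 , 42 , 27) ∷
   (44 , 0 , 43) ∷ (44 , 42 , 1) ∷ (44 , 19 , 3) ∷ (10 , 43 , 10) ∷ (19 , 6 , 43) ∷ (42 , 14 , 3) ∷
   (9 , 11 , 27) ∷ (6 , 14 , 27) ∷ (6 , 17 , 10) ∷ (4 , 1 , 1) ∷ []) ∷
  ((21 , 0 , 5) ∷ (32 , 0 , 2) ∷ (0 , 16 , 2) ∷ (21 , 16 , 1) ∷ (0 , 15 , 5) ∷ (32 , 15 , 1) ∷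
   (22 , 27 , 22) ∷ (7 , 28 , 5) ∷ (28 , 11 , 22) ∷ (3 , 28 , 4) ∷ (7 , 1 , 22) ∷ (7 , 17 , 3) ∷
   (3 , 4 , 22) ∷ (16 , 15 , 27) ∷ (32 , 4 , 3) ∷ (21 , 3 , 4) ∷ []) ∷
  ((3 , 9 , 3) ∷ (1 , 11 , 5) ∷ (0 , 4 , 8) ∷ (0 , 13 , 4) ∷ (13 , 11 , 8) ∷ (3 , 13 , 5) ∷
   (0 , 14 , 12) ∷ (16 , 1 , 12) ∷ (21 , 14 , 23) ∷ (16 , 11 , 23) ∷ (33 , 31 , 0) ∷ (33 , 8 , 2) ∷
   (21 , 6 , 0) ∷ (16 , 6 , 8) ∷ (45 , 18 , 2) ∷ (8 , 18 , 1) ∷ []) ∷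
  ((3 , 6 , 18) ∷ (45 , 31 , 8) ∷ (12 , 45 , 4) ∷ (38 , 26 , 0) ∷ (38 , 46 , 8) ∷ (33 , 26 , 8) ∷
   (46 , 26 , 1) ∷ (23 , 46 , 12) ∷ (38 , 33 , 1) ∷ (23 , 38 , 5) ∷ (12 , 33 , 5) ∷ (21 , 4 , 12) ∷
   (7 , 2 , 8) ∷ (3 , 7 , 1) ∷ (16 , 7 , 4) ∷ (16 , 3 , 5) ∷ []) ∷
  ((20 , 2 , 12) ∷ (16 , 20 , 1) ∷ (23 , 39 , 0) ∷ (23 , 8 , 10) ∷ (39 , 47 , 2) ∷ (12 , 48 , 18) ∷
   (48 , 47 , 1) ∷ (23 , 48 , 3) ∷ (47 , 5 , 5) ∷ (16 , 13 , 39) ∷ (6 , 11 , 39) ∷ (21 , 20 , 10) ∷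
   (12 , 8 , 1) ∷ (15 , 4 , 18) ∷ (13 , 1 , 18) ∷ (15 , 34 , 4) ∷ []) ∷
  ((13 , 34 , 5) ∷ (34 , 11 , 18) ∷ (15 , 13 , 1) ∷ (14 , 2 , 29) ∷ (19 , 1 , 29) ∷ (49 , 14 , 2) ∷
   (19 , 49 , 5) ∷ (49 , 11 , 29) ∷ (19 , 14 , 1) ∷ (15 , 14 , 8) ∷ (32 , 13 , 10) ∷
   (32 , 19 , 8) ∷ (4 , 11 , 4) ∷ (1 , 2 , 1) ∷ (7 , 30 , 7) ∷ (3 , 50 , 7) ∷ []) ∷
  ((50 , 30 , 1) ∷ (0 , 6 , 3) ∷ (24 , 4 , 5) ∷ (24 , 6 , 1) ∷ (0 , 7 , 10) ∷ (24 , 9 , 10) ∷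
   (6 , 50 , 2) ∷ (9 , 30 , 2) ∷ (3 , 35 , 27) ∷ (13 , 14 , 22) ∷ (35 , 1 , 7) ∷ (35 , 13 , 2) ∷
   (13 , 7 , 2) ∷ (15 , 1 , 3) ∷ (13 , 2 , 3) ∷ (15 , 6 , 7) ∷ []) ∷
  ((0 , 9 , 36) ∷ (7 , 9 , 18) ∷ (13 , 9 , 7) ∷ (7 , 6 , 51) ∷ (28 , 17 , 7) ∷ (28 , 1 , 51) ∷
   (35 , 6 , 40) ∷ (34 , 9 , 40) ∷ (35 , 34 , 1) ∷ (3 , 40 , 10) ∷ (28 , 40 , 2) ∷ (13 , 4 , 51) ∷
   (3 , 17 , 36) ∷ (15 , 2 , 36) ∷ (0 , 52 , 7) ∷ (52 , 30 , 10) ∷ []) ∷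
  ((52 , 9 , 4) ∷ (20 , 9 , 8) ∷ (20 , 7 , 5) ∷ (20 , 17 , 0) ∷ (3 , 20 , 2) ∷ (16 , 9 , 0) ∷
   (15 , 11 , 0) ∷ (20 , 6 , 22) ∷ (15 , 3 , 2) ∷ (30 , 17 , 5) ∷ (3 , 30 , 53) ∷ (36 , 29 , 0) ∷
   (36 , 53 , 1) ∷ (1 , 17 , 29) ∷ (4 , 9 , 29) ∷ (15 , 9 , 53) ∷ []) ∷
  ((37 , 25 , 5) ∷ (25 , 1 , 10) ∷ (54 , 37 , 5) ∷ (24 , 17 , 55) ∷ (56 , 24 , 5) ∷ (54 , 56 , 1) ∷
   (37 , 11 , 41) ∷ (57 , 14 , 41) ∷ (25 , 14 , 4) ∷ (41 , 10 , 10) ∷ (56 , 2 , 41) ∷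
   (57 , 6 , 55) ∷ (57 , 25 , 4) ∷ (25 , 2 , 55) ∷ (54 , 4 , 25) ∷ (25 , 24 , 2) ∷ []) ∷
  ((37 , 6 , 10) ∷ (37 , 4 , 4) ∷ (6 , 1 , 5) ∷ (0 , 24 , 18) ∷ []) ∷
  []

-- Point 2 is a. It cannot have the colour of a², because a · a² = a · a + (a - 1) · a² (solution
-- 109). If it has the colour of a³, the next point is 2a - 1, where a(2a - 1) = a · a + (a - 1) · a
-- excludes that colour.
tree2 : Tree
tree2 =
  split 2
   (split 11
     (leaf 0)
     (split 5
       (split 3
         (leaf 1)
         (only₂ 8 2 3 (only₂ 12 4 5 (only₁ 26 6 10 (none 31 7 8 9))))
         (only₁ 9 11 48 (only₂ 17 12 13 (
          split 4
           (only₂ 6 14 15 (only₂ 14 16 17 (only₁ 10 18 30 (only₀ 27 28 29 (only₂ 19 19 20 (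
            only₁ 42 21 27 (only₀ 43 25 26 (none 44 22 23 24))))))))
           (leaf 31)
           (only₁ 21 32 47 (only₁ 32 33 46 (only₂ 16 34 35 (only₂ 15 36 37 (only₀ 27 28 45 (
            only₁ 22 38 44 (only₀ 7 42 43 (none 28 39 40 41))))))))))))
       (leaf 49)
       (split 4
         (only₁ 8 50 2 (only₂ 3 1 3 (none 13 51 52 53)))
         (leaf 31)
         (only₀ 14 17 16 (
          split 16
           (leaf 34)
           (only₂ 12 54 55 (only₀ 21 35 75 (only₂ 23 56 57 (
            split 33
             (only₁ 31 58 7 (only₁ 8 59 2 (only₂ 3 1 3 (only₂ 6 60 61 (only₀ 45 65 66 (
              none 18 62 63 64))))))
             (only₀ 38 72 73 (only₁ 26 67 10 (only₀ 46 70 71 (none 8 68 69 2))))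
             (leaf 74)))))
           (only₁ 3 1 79 (only₀ 7 77 78 (none 8 76 3 2)))))))
     (only₀ 4 31 108 (
      split 8
       (leaf 50)
       (only₂ 3 1 3 (only₀ 12 92 5 (only₂ 5 4 2 (only₁ 16 34 79 (only₁ 13 51 53 (only₂ 21 75 35 (
        only₂ 20 80 81 (only₂ 6 14 61 (only₁ 10 18 91 (only₀ 39 89 90 (only₀ 18 63 64 (
        only₂ 23 82 83 (only₁ 47 84 88 (none 48 85 86 87))))))))))))))
       (only₀ 4 31 108 (only₁ 13 51 52 (
        split 15
         (only₁ 5 36 2 (only₂ 18 93 94 (none 34 95 96 97)))
         (leaf 98)
         (split 19
           (leaf 19)
           (only₀ 14 104 105 (only₂ 29 99 100 (only₁ 5 16 2 (none 49 101 102 103))))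
           (only₁ 10 18 20 (none 32 33 106 107)))))))))
   (leaf 109)
   -- Now a³, a² and a have three different colours, as in the colouring for the lower bound. Point
   -- 4 is a(2a - 1), kept from the colour of a² by a · a(2a - 1) = a · a² + (a - 1) · a² (solution
   -- 31).
   (split 4
     (only₁ 11 108 0 (
      split 13
       (leaf 51)
       (only₂ 8 50 52 (only₀ 5 49 2 (only₂ 15 36 98 (none 14 16 17 105))))
       (split 3
         (split 7
           (only₁ 17 43 12 (only₂ 9 48 13 (only₁ 30 110 119 (only₀ 5 49 11 (only₂ 50 111 112 (
            only₁ 6 113 118 (only₂ 24 114 115 (none 10 116 30 117))))))))
           (only₀ 35 122 123 (only₂ 22 44 42 (only₁ 27 120 38 (only₀ 14 17 121 (only₂ 9 48 28 (
            none 5 16 49 11))))))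
           (leaf 124))
         (only₂ 8 50 3 (only₀ 5 49 2 (only₂ 15 36 125 (none 14 16 17 105))))
         (leaf 126))))
     (leaf 31)
     (split 6
       (split 3
         (leaf 113)
         (split 7
           (only₁ 10 116 18 (only₂ 15 127 125 (
            split 9
             (only₁ 36 128 141 (only₁ 18 129 93 (only₀ 17 140 12 (only₂ 13 130 94 (
              only₁ 51 131 139 (only₂ 28 132 133 (only₀ 40 137 138 (only₁ 35 134 123 (
              none 34 135 136 95)))))))))
             (leaf 48)
             (only₁ 30 110 119 (none 52 142 143 144)))))
           (leaf 77)
           (only₀ 8 3 76 (only₁ 16 61 78 (only₂ 5 2 79 (only₀ 9 48 11 (none 20 145 81 146))))))
         (only₁ 21 60 47 (
          split 17
           (only₁ 20 147 148 (none 10 30 91 18))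
           (only₀ 9 13 48 (only₂ 16 149 35 (
            split 15
             (only₁ 11 150 0 (none 5 36 49 79))
             (only₀ 32 37 46 (only₀ 13 98 126 (only₁ 7 130 78 (only₁ 10 106 18 (only₀ 22 42 44 (
              none 20 151 91 148))))))
             (leaf 152))))
           (leaf 12))))
       (split 5
         (split 10
           (split 7
             (leaf 116)
             (only₂ 15 36 127 (only₀ 3 77 152 (only₂ 9 48 15 (only₀ 30 110 119 (only₁ 17 153 12 (
              only₁ 53 154 159 (only₀ 29 157 158 (none 36 155 156 141))))))))
             (only₁ 8 2 76 (only₀ 16 61 78 (only₂ 9 149 15 (none 3 79 3 48)))))
           (only₀ 37 176 177 (only₀ 17 30 12 (only₂ 25 160 161 (only₀ 24 115 175 (
            only₁ 54 162 174 (only₁ 55 163 173 (only₂ 56 164 165 (only₀ 57 171 172 (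
            only₀ 41 169 170 (only₁ 11 166 0 (none 14 167 17 168)))))))))))
           (leaf 18))
         (leaf 178)
         (only₀ 9 15 11 (only₀ 24 115 114 (only₁ 10 117 18 (only₀ 17 30 12 (
          split 3
           (leaf 48)
           (only₀ 8 3 2 (only₂ 18 179 64 (only₀ 15 125 93 (only₁ 11 150 0 (none 14 105 17 16)))))
           (only₁ 20 147 148 (none 16 149 81 79))))))))
       (leaf 14)))

certificate2 : Certificate 1
certificate2 = record
  { α = 3 ∷ 1 ∷ [] ; β = 2 ∷ 1 ∷ [] ; N = 31 ∷ 31 ∷ 10 ∷ 1 ∷ []
  ; points = points2 ; solutions = solutions2
  -- Points 0 and 1 are a³ and a². They have different colours because a · a³ = a · a² + (a - 1) ·
  -- a³.
  ; p₀ = 0 ; p₁ = 1 ; s₀ = (0 , 1 , 0) ; tree = tree2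
  }

-- Certificate for (3), polynomials in t and b′ where b = b′ + 1 and a = b′ + t + 3

points3 : List (Poly 2)
points3 =
  cubic 27 27 9 1 27 18 3 9 3 1 ∷ cubic 18 12 2 0 21 10 1 8 2 1 ∷ cubic 9 6 1 0 6 2 0 1 0 0 ∷
  cubic 6 2 0 0 5 1 0 1 0 0 ∷ cubic 12 10 2 0 7 3 0 1 0 0 ∷ cubic 15 8 1 0 20 9 1 8 2 1 ∷
  cubic 3 4 1 0 1 1 0 0 0 0 ∷ cubic 12 4 0 0 16 4 0 7 1 1 ∷ cubic 9 6 1 0 15 8 1 7 2 1 ∷
  cubic 18 12 2 0 12 4 0 2 0 0 ∷ cubic 6 8 2 0 5 6 1 1 1 0 ∷ cubic 12 10 2 0 10 7 1 2 1 0 ∷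
  cubic 21 16 3 0 22 11 1 8 2 1 ∷ cubic 15 8 1 0 17 5 0 7 1 1 ∷ cubic 24 23 8 1 26 17 3 9 3 1 ∷
  cubic 15 14 3 0 8 4 0 1 0 0 ∷ cubic 18 21 8 1 12 10 2 2 1 0 ∷ cubic 21 19 7 1 22 12 2 8 2 1 ∷
  cubic 15 14 3 0 11 8 1 2 1 0 ∷ cubic 15 8 1 0 11 3 0 2 0 0 ∷ cubic 9 15 7 1 6 8 2 1 1 0 ∷
  cubic 24 20 4 0 26 16 2 9 3 1 ∷ cubic 21 16 3 0 25 15 2 9 3 1 ∷ cubic 27 18 3 0 27 12 1 9 2 1 ∷
  cubic 10 8 2 0 6 2 0 1 0 0 ∷ cubic 18 21 8 1 21 16 3 8 3 1 ∷ cubic 21 16 3 0 13 5 0 2 0 0 ∷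
  cubic 18 15 6 1 21 11 2 8 2 1 ∷ cubic 24 23 8 1 23 13 2 8 2 1 ∷ cubic 19 14 3 0 21 10 1 8 2 1 ∷
  cubic 16 10 2 0 20 9 1 8 2 1 ∷ cubic 11 8 1 0 7 3 0 1 0 0 ∷ cubic 8 4 0 0 6 2 0 1 0 0 ∷
  cubic 13 12 3 0 7 3 0 1 0 0 ∷ cubic 12 4 0 0 10 2 0 2 0 0 ∷ cubic 6 2 0 0 14 7 1 7 2 1 ∷
  cubic 20 16 4 0 22 12 2 8 2 1 ∷ cubic 12 10 2 0 16 9 1 7 2 1 ∷ cubic 18 18 4 0 12 9 1 2 1 0 ∷
  cubic 3 4 1 0 4 5 1 1 1 0 ∷ cubic 15 11 5 1 17 6 1 7 1 1 ∷ cubic 12 4 0 0 19 8 1 8 2 1 ∷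
  cubic 6 11 6 1 5 7 2 1 1 0 ∷ cubic 12 19 8 1 7 9 2 1 1 0 ∷ cubic 16 16 4 0 8 4 0 1 0 0 ∷
  cubic 15 23 9 1 11 14 3 2 2 0 ∷ cubic 3 7 5 1 1 2 1 0 0 0 ∷ cubic 24 14 2 0 26 11 1 9 2 1 ∷
  cubic 14 12 2 0 11 8 1 2 1 0 ∷ cubic 14 8 2 0 17 6 1 7 1 1 ∷ cubic 26 25 8 1 26 16 2 9 3 1 ∷
  cubic 14 12 2 0 8 4 0 1 0 0 ∷ cubic 6 8 2 0 2 2 0 0 0 0 ∷ cubic 16 8 0 0 20 8 0 8 2 1 ∷
  cubic 17 10 1 0 21 10 1 8 2 1 ∷ cubic 20 17 6 1 22 12 2 8 2 1 ∷ cubic 24 20 4 0 14 6 0 2 0 0 ∷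
  cubic 19 15 5 1 21 10 1 8 2 1 ∷ cubic 16 16 4 0 11 8 1 2 1 0 ∷ cubic 17 19 7 1 12 10 2 2 1 0 ∷
  cubic 15 17 7 1 11 9 2 2 1 0 ∷ cubic 6 2 0 0 11 3 0 6 1 1 ∷ cubic 14 14 4 0 8 5 1 1 0 0 ∷
  cubic 21 19 7 1 25 16 3 9 3 1 ∷ cubic 17 16 3 0 12 9 1 2 1 0 ∷ cubic 23 23 9 1 23 14 3 8 2 1 ∷
  cubic 18 15 6 1 18 7 1 7 1 1 ∷ cubic 20 17 6 1 21 10 1 8 2 1 ∷ cubic 18 18 4 0 9 5 0 1 0 0 ∷
  cubic 27 18 3 0 18 6 0 3 0 0 ∷ cubic 17 18 5 0 8 4 0 1 0 0 ∷ cubic 10 2 0 0 15 3 0 7 1 1 ∷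
  cubic 13 6 1 0 16 4 0 7 1 1 ∷ cubic 6 11 6 1 2 3 1 0 0 0 ∷ cubic 4 4 0 0 4 4 0 1 1 0 ∷
  cubic 12 16 4 0 10 12 2 2 2 0 ∷ cubic 26 25 8 1 27 18 3 9 3 1 ∷ cubic 23 21 7 1 23 13 2 8 2 1 ∷
  cubic 14 6 0 0 19 7 0 8 2 1 ∷ cubic 13 12 3 0 10 7 1 2 1 0 ∷ cubic 22 18 4 0 25 15 2 9 3 1 ∷
  cubic 20 14 2 0 25 15 2 9 3 1 ∷ cubic 7 4 1 0 5 1 0 1 0 0 ∷ cubic 11 10 3 0 7 4 1 1 0 0 ∷
  cubic 14 14 4 0 7 3 0 1 0 0 ∷ cubic 14 6 0 0 17 5 0 7 1 1 ∷ cubic 16 10 2 0 18 7 1 7 1 1 ∷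
  cubic 23 18 3 0 26 16 2 9 3 1 ∷ cubic 17 10 1 0 20 8 0 8 2 1 ∷ cubic 19 20 5 0 9 5 0 1 0 0 ∷
  cubic 13 12 3 0 8 5 1 1 0 0 ∷ cubic 17 16 3 0 9 5 0 1 0 0 ∷ cubic 4 0 0 0 4 0 0 1 0 0 ∷
  cubic 21 22 5 0 13 10 1 2 1 0 ∷ cubic 13 10 1 0 11 8 1 2 1 0 ∷ cubic 23 21 7 1 26 17 3 9 3 1 ∷
  cubic 11 8 1 0 10 7 1 2 1 0 ∷ cubic 7 11 5 1 5 6 1 1 1 0 ∷ cubic 20 22 6 0 10 7 1 1 0 0 ∷
  cubic 17 18 5 0 9 6 1 1 0 0 ∷ cubic 20 22 6 0 9 5 0 1 0 0 ∷ cubic 15 16 5 0 8 5 1 1 0 0 ∷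
  cubic 16 16 4 0 12 10 2 2 1 0 ∷ cubic 10 6 0 0 7 3 0 1 0 0 ∷ cubic 20 20 4 0 13 10 1 2 1 0 ∷
  cubic 25 23 7 1 26 16 2 9 3 1 ∷ cubic 17 15 7 1 18 8 2 7 1 1 ∷ cubic 13 7 3 1 16 4 0 7 1 1 ∷
  cubic 17 13 5 1 21 11 2 8 2 1 ∷ cubic 13 6 1 0 19 8 1 8 2 1 ∷ cubic 20 14 2 0 24 13 1 9 3 1 ∷
  cubic 9 6 1 0 9 6 1 2 1 0 ∷ cubic 14 15 6 1 11 9 2 2 1 0 ∷ cubic 22 24 6 0 14 12 2 2 1 0 ∷
  cubic 19 14 3 0 12 4 0 2 0 0 ∷ cubic 10 8 2 0 9 6 1 2 1 0 ∷ cubic 22 16 2 0 25 14 1 9 3 1 ∷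
  cubic 8 0 0 0 12 0 0 6 0 1 ∷ cubic 23 19 5 1 25 14 1 9 3 1 ∷ cubic 15 17 7 1 20 15 3 8 3 1 ∷
  cubic 13 6 1 0 17 6 1 7 1 1 ∷ cubic 17 10 1 0 12 4 0 2 0 0 ∷ cubic 16 16 4 0 9 6 1 1 0 0 ∷
  cubic 22 24 6 0 13 10 1 2 1 0 ∷ cubic 16 14 2 0 12 9 1 2 1 0 ∷ cubic 10 12 2 0 9 10 1 2 2 0 ∷
  cubic 17 12 3 0 21 11 2 8 2 1 ∷ cubic 10 2 0 0 13 1 0 6 0 1 ∷ cubic 19 17 7 1 21 11 2 8 2 1 ∷
  cubic 11 4 1 0 15 3 0 7 1 1 ∷ cubic 21 25 9 1 13 11 2 2 1 0 ∷ cubic 21 18 5 0 22 12 2 8 2 1 ∷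
  cubic 19 14 3 0 22 12 2 8 2 1 ∷ cubic 23 21 7 1 25 15 2 9 3 1 ∷ cubic 11 10 3 0 6 2 0 1 0 0 ∷
  cubic 22 24 6 0 10 6 0 1 0 0 ∷ cubic 20 14 2 0 13 5 0 2 0 0 ∷ cubic 9 15 7 1 15 14 3 7 3 1 ∷
  cubic 19 20 5 0 12 9 1 2 1 0 ∷ cubic 20 14 2 0 22 11 1 8 2 1 ∷ cubic 22 18 4 0 22 11 1 8 2 1 ∷
  cubic 19 20 5 0 13 11 2 2 1 0 ∷ cubic 12 10 2 0 19 13 2 8 3 1 ∷ cubic 19 23 9 1 12 10 2 2 1 0 ∷
  cubic 2 4 2 0 1 2 1 0 0 0 ∷ cubic 8 12 4 0 6 8 2 1 1 0 ∷ cubic 5 6 1 0 5 6 1 1 1 0 ∷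
  cubic 23 21 7 1 22 11 1 8 2 1 ∷ cubic 23 20 5 0 26 17 3 9 3 1 ∷ cubic 24 20 4 0 17 10 1 3 1 0 ∷
  cubic 20 22 6 0 13 11 2 2 1 0 ∷ cubic 13 10 1 0 8 4 0 1 0 0 ∷ cubic 10 6 0 0 10 7 1 2 1 0 ∷
  cubic 19 12 1 0 24 13 1 9 3 1 ∷ cubic 11 4 1 0 16 5 1 7 1 1 ∷ cubic 16 10 2 0 17 5 0 7 1 1 ∷
  cubic 17 10 1 0 24 14 2 9 3 1 ∷ cubic 18 12 2 0 24 14 2 9 3 1 ∷ cubic 14 6 0 0 20 9 1 8 2 1 ∷
  cubic 17 18 5 0 12 10 2 2 1 0 ∷ cubic 12 13 6 1 7 4 1 1 0 0 ∷ cubic 25 25 9 1 26 17 3 9 3 1 ∷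
  cubic 8 13 6 1 5 6 1 1 1 0 ∷ cubic 14 21 8 1 11 14 3 2 2 0 ∷ cubic 16 12 4 0 18 8 2 7 1 1 ∷
  cubic 20 19 8 1 19 9 2 7 1 1 ∷ cubic 22 19 6 1 22 11 1 8 2 1 ∷ cubic 24 21 6 1 25 14 1 9 3 1 ∷
  cubic 26 24 6 0 27 18 3 9 3 1 ∷ cubic 23 20 5 0 23 13 2 8 2 1 ∷ cubic 21 10 1 0 22 6 0 8 1 1 ∷
  cubic 25 22 5 0 27 18 3 9 3 1 ∷ cubic 23 26 7 0 10 6 0 1 0 0 ∷ cubic 25 22 5 0 14 6 0 2 0 0 ∷
  cubic 19 20 5 0 10 7 1 1 0 0 ∷ cubic 20 23 8 1 16 15 3 3 2 0 ∷ cubic 22 22 4 0 14 11 1 2 1 0 ∷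
  cubic 20 19 8 1 22 13 3 8 2 1 ∷ cubic 19 14 3 0 24 14 2 9 3 1 ∷ cubic 8 0 0 0 14 2 0 7 1 1 ∷
  cubic 15 17 7 1 8 5 1 1 0 0 ∷ cubic 22 21 8 1 25 16 3 9 3 1 ∷ cubic 13 19 7 1 10 12 2 2 2 0 ∷
  cubic 22 21 8 1 23 14 3 8 2 1 ∷ cubic 22 21 8 1 22 12 2 8 2 1 ∷ cubic 9 3 3 1 12 0 0 6 0 1 ∷
  cubic 8 13 6 1 6 8 2 1 1 0 ∷ cubic 22 19 6 1 24 13 1 9 3 1 ∷ cubic 18 20 6 0 9 6 1 1 0 0 ∷
  cubic 21 24 7 0 10 7 1 1 0 0 ∷ cubic 22 18 4 0 13 5 0 2 0 0 ∷ cubic 21 24 7 0 9 5 0 1 0 0 ∷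
  cubic 20 23 8 1 13 11 2 2 1 0 ∷ cubic 3 4 1 0 10 7 1 6 2 1 ∷ cubic 15 16 5 0 7 3 0 1 0 0 ∷
  cubic 27 24 5 0 18 11 1 3 1 0 ∷ cubic 23 18 3 0 14 6 0 2 0 0 ∷ cubic 10 2 0 0 9 1 0 2 0 0 ∷
  cubic 13 6 1 0 10 2 0 2 0 0 ∷ cubic 14 6 0 0 11 3 0 2 0 0 ∷ cubic 23 27 9 1 17 16 3 3 2 0 ∷
  cubic 19 18 3 0 13 10 1 2 1 0 ∷ cubic 8 6 2 0 5 1 0 1 0 0 ∷ cubic 18 16 2 0 16 14 2 3 2 0 ∷
  cubic 22 19 6 1 25 15 2 9 3 1 ∷ cubic 17 12 3 0 18 7 1 7 1 1 ∷ cubic 24 21 6 1 26 16 2 9 3 1 ∷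
  cubic 10 8 2 0 15 8 1 7 2 1 ∷ cubic 25 25 9 1 23 13 2 8 2 1 ∷ cubic 25 22 5 0 26 16 2 9 3 1 ∷
  cubic 19 12 1 0 25 15 2 9 3 1 ∷ cubic 23 24 5 0 17 15 2 3 2 0 ∷ cubic 13 15 7 1 7 4 1 1 0 0 ∷
  cubic 10 15 6 1 6 7 1 1 1 0 ∷ cubic 9 12 3 0 9 11 2 2 2 0 ∷ cubic 12 6 2 0 16 5 1 7 1 1 ∷
  cubic 17 11 3 1 20 8 0 8 2 1 ∷ cubic 16 11 4 1 17 5 0 7 1 1 ∷ cubic 20 15 4 1 21 9 0 8 2 1 ∷
  cubic 12 19 8 1 10 13 3 2 2 0 ∷ cubic 17 13 5 1 17 5 0 7 1 1 ∷ cubic 22 18 4 0 26 17 3 9 3 1 ∷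
  cubic 19 22 7 0 9 6 1 1 0 0 ∷ cubic 16 14 2 0 9 5 0 1 0 0 ∷ cubic 16 10 2 0 11 3 0 2 0 0 ∷
  cubic 24 26 6 0 14 11 1 2 1 0 ∷ cubic 14 11 6 1 17 7 2 7 1 1 ∷ cubic 17 10 1 0 18 6 0 7 1 1 ∷
  cubic 10 2 0 0 18 7 1 8 2 1 ∷ cubic 16 23 8 1 11 13 2 2 2 0 ∷ cubic 16 13 6 1 18 8 2 7 1 1 ∷
  cubic 7 8 1 0 5 5 0 1 1 0 ∷ cubic 9 12 3 0 6 7 1 1 1 0 ∷ cubic 10 4 2 0 13 2 1 6 0 1 ∷
  cubic 12 7 4 1 13 1 0 6 0 1 ∷ cubic 19 12 1 0 21 9 0 8 2 1 ∷ cubic 10 17 8 1 7 10 3 1 1 0 ∷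
  cubic 21 25 9 1 16 15 3 3 2 0 ∷ cubic 27 24 5 0 15 7 0 2 0 0 ∷ cubic 19 22 7 0 8 4 0 1 0 0 ∷
  cubic 16 8 0 0 12 4 0 2 0 0 ∷ cubic 22 26 8 0 10 7 1 1 0 0 ∷ cubic 18 18 4 0 15 13 2 3 2 0 ∷
  cubic 16 11 4 1 20 9 1 8 2 1 ∷ cubic 19 17 7 1 19 9 2 7 1 1 ∷ cubic 16 13 6 1 20 10 2 8 2 1 ∷
  cubic 24 20 4 0 23 12 1 8 2 1 ∷ cubic 16 8 0 0 24 14 2 9 3 1 ∷ cubic 18 20 6 0 12 10 2 2 1 0 ∷
  cubic 21 16 3 0 16 9 1 3 1 0 ∷ cubic 21 25 9 1 22 17 3 8 3 1 ∷ cubic 13 12 3 0 11 9 2 2 1 0 ∷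
  cubic 1 3 3 1 0 0 0 0 0 0 ∷ cubic 11 19 9 1 7 10 3 1 1 0 ∷ cubic 5 11 7 1 2 4 2 0 0 0 ∷
  cubic 12 17 6 1 9 10 1 2 2 0 ∷ cubic 11 17 7 1 6 7 1 1 1 0 ∷ cubic 10 15 6 1 9 11 2 2 2 0 ∷
  cubic 15 10 3 0 18 8 2 7 1 1 ∷ cubic 11 4 1 0 13 1 0 6 0 1 ∷ cubic 12 6 2 0 14 3 1 6 0 1 ∷
  cubic 19 19 9 1 19 10 3 7 1 1 ∷ cubic 1 2 1 0 1 2 1 0 0 0 ∷ cubic 23 18 3 0 25 14 1 9 3 1 ∷
  cubic 22 21 8 1 20 10 2 7 1 1 ∷ cubic 14 8 2 0 15 4 1 6 0 1 ∷ cubic 21 19 7 1 19 8 1 7 1 1 ∷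
  cubic 24 20 4 0 27 18 3 9 3 1 ∷ cubic 15 14 3 0 20 14 2 8 3 1 ∷ cubic 12 12 4 0 7 4 1 1 0 0 ∷
  cubic 16 18 6 0 8 5 1 1 0 0 ∷ cubic 23 26 7 0 14 12 2 2 1 0 ∷ cubic 22 24 6 0 11 8 1 1 0 0 ∷
  cubic 21 22 5 0 14 12 2 2 1 0 ∷ cubic 18 18 4 0 13 11 2 2 1 0 ∷ cubic 21 25 9 1 14 13 3 2 1 0 ∷
  cubic 15 14 3 0 9 6 1 1 0 0 ∷ cubic 13 13 5 1 11 9 2 2 1 0 ∷ cubic 18 20 6 0 8 4 0 1 0 0 ∷
  cubic 23 26 7 0 11 8 1 1 0 0 ∷ cubic 26 22 4 0 15 7 0 2 0 0 ∷ cubic 24 14 2 0 17 5 0 3 0 0 ∷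
  cubic 21 10 1 0 16 4 0 3 0 0 ∷ cubic 14 8 2 0 10 2 0 2 0 0 ∷ cubic 8 0 0 0 8 0 0 2 0 0 ∷
  cubic 20 22 6 0 12 9 1 2 1 0 ∷ cubic 17 18 5 0 11 8 1 2 1 0 ∷ cubic 12 13 6 1 19 14 3 8 3 1 ∷
  cubic 12 8 0 0 8 4 0 1 0 0 ∷ cubic 23 24 5 0 14 11 1 2 1 0 ∷ cubic 14 14 4 0 10 7 1 2 1 0 ∷
  cubic 20 20 4 0 16 14 2 3 2 0 ∷ cubic 20 15 4 1 24 13 1 9 3 1 ∷ cubic 14 9 4 1 17 6 1 7 1 1 ∷
  cubic 27 25 7 1 27 17 2 9 3 1 ∷ cubic 21 17 5 1 25 15 2 9 3 1 ∷ cubic 15 11 5 1 18 8 2 7 1 1 ∷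
  cubic 9 15 7 1 9 12 3 2 2 0 ∷ cubic 19 23 9 1 15 14 3 3 2 0 ∷ cubic 16 16 4 0 20 14 2 8 3 1 ∷
  cubic 26 25 8 1 24 14 2 8 2 1 ∷ cubic 22 19 6 1 23 13 2 8 2 1 ∷ cubic 17 12 3 0 17 5 0 7 1 1 ∷
  cubic 21 10 1 0 25 10 1 9 2 1 ∷ cubic 14 8 2 0 16 4 0 7 1 1 ∷ cubic 17 12 3 0 20 9 1 8 2 1 ∷
  cubic 20 16 4 0 21 10 1 8 2 1 ∷ cubic 24 23 8 1 17 11 2 3 1 0 ∷ cubic 26 22 4 0 27 17 2 9 3 1 ∷
  cubic 25 20 3 0 27 17 2 9 3 1 ∷ cubic 8 4 0 0 8 4 0 2 1 0 ∷ cubic 15 14 3 0 14 12 2 3 2 0 ∷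
  cubic 14 14 4 0 11 9 2 2 1 0 ∷ cubic 21 24 7 0 13 11 2 2 1 0 ∷ cubic 18 6 0 0 21 5 0 8 1 1 ∷
  cubic 12 13 6 1 10 8 2 2 1 0 ∷ cubic 16 17 6 1 12 10 2 2 1 0 ∷ cubic 4 0 0 0 10 2 0 6 1 1 ∷
  cubic 8 4 0 0 9 6 1 2 1 0 ∷ cubic 12 8 0 0 11 8 1 2 1 0 ∷ cubic 14 17 8 1 7 4 1 1 0 0 ∷
  cubic 17 21 9 1 11 9 2 2 1 0 ∷ cubic 5 2 1 0 4 0 0 1 0 0 ∷ cubic 23 27 9 1 14 12 2 2 1 0 ∷
  cubic 13 15 7 1 10 8 2 2 1 0 ∷ cubic 16 19 8 1 11 9 2 2 1 0 ∷ cubic 18 15 6 1 24 15 3 9 3 1 ∷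
  cubic 14 8 2 0 19 8 1 8 2 1 ∷ cubic 11 4 1 0 18 7 1 8 2 1 ∷ cubic 15 11 5 1 20 10 2 8 2 1 ∷
  cubic 19 17 7 1 24 15 3 9 3 1 ∷ cubic 6 9 4 1 4 4 0 1 1 0 ∷ cubic 5 6 1 0 4 4 0 1 1 0 ∷
  cubic 13 21 9 1 7 9 2 1 1 0 ∷ cubic 10 14 4 0 6 7 1 1 1 0 ∷ cubic 4 7 4 1 1 1 0 0 0 0 ∷
  cubic 8 15 8 1 6 9 3 1 1 0 ∷ cubic 4 7 4 1 4 5 1 1 1 0 ∷ cubic 5 8 3 0 5 7 2 1 1 0 ∷
  cubic 19 17 7 1 22 13 3 8 2 1 ∷ cubic 5 8 3 0 2 3 1 0 0 0 ∷ cubic 11 17 7 1 7 9 2 1 1 0 ∷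
  cubic 11 16 5 0 7 9 2 1 1 0 ∷ cubic 17 24 7 0 12 15 3 2 2 0 ∷ cubic 13 16 3 0 10 11 1 2 2 0 ∷
  cubic 18 17 8 1 18 8 2 7 1 1 ∷ cubic 20 12 0 0 24 12 0 9 3 1 ∷ cubic 26 23 6 1 26 15 1 9 3 1 ∷
  cubic 21 14 1 0 24 12 0 9 3 1 ∷ cubic 18 13 4 1 20 8 0 8 2 1 ∷ cubic 22 20 6 0 23 14 3 8 2 1 ∷
  cubic 11 15 5 1 9 10 1 2 2 0 ∷ cubic 7 10 3 0 6 8 2 1 1 0 ∷ cubic 6 9 4 1 5 6 1 1 1 0 ∷
  cubic 12 17 6 1 10 12 2 2 2 0 ∷ cubic 20 14 2 0 21 9 0 8 2 1 ∷ cubic 14 9 4 1 16 4 0 7 1 1 ∷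
  cubic 18 14 4 0 19 9 2 7 1 1 ∷ cubic 17 10 1 0 23 12 1 9 3 1 ∷ cubic 15 17 7 1 17 11 2 7 2 1 ∷
  cubic 16 8 0 0 22 10 0 9 3 1 ∷ cubic 19 15 5 1 20 8 0 8 2 1 ∷ cubic 17 13 5 1 20 9 1 8 2 1 ∷
  cubic 16 13 6 1 17 6 1 7 1 1 ∷ cubic 14 9 4 1 20 10 2 8 2 1 ∷ cubic 27 26 7 0 27 18 3 9 3 1 ∷
  cubic 15 10 3 0 17 6 1 7 1 1 ∷ cubic 16 10 2 0 21 11 2 8 2 1 ∷ []

solutions3 : List (List (ℕ × ℕ × ℕ))
solutions3 =
  ((4 , 2 , 2) ∷ (2 , 3 , 2) ∷ (44 , 2 , 26) ∷ (89 , 44 , 2) ∷ (89 , 4 , 26) ∷ (44 , 33 , 2) ∷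
   (33 , 3 , 26) ∷ (15 , 2 , 9) ∷ (44 , 24 , 9) ∷ (4 , 24 , 3) ∷ (38 , 11 , 9) ∷ (38 , 4 , 1) ∷
   (90 , 2 , 11) ∷ (98 , 44 , 11) ∷ (98 , 90 , 26) ∷ (99 , 44 , 39) ∷ []) ∷
  ((99 , 90 , 4) ∷ (51 , 31 , 2) ∷ (15 , 31 , 4) ∷ (99 , 31 , 38) ∷ (51 , 4 , 3) ∷ (98 , 51 , 38) ∷
   (90 , 4 , 39) ∷ (98 , 89 , 39) ∷ (11 , 111 , 2) ∷ (11 , 2 , 8) ∷ (111 , 3 , 8) ∷ (58 , 79 , 2) ∷
   (79 , 111 , 4) ∷ (79 , 24 , 8) ∷ (58 , 111 , 26) ∷ (58 , 33 , 8) ∷ []) ∷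
  ((90 , 24 , 111) ∷ (11 , 3 , 1) ∷ (100 , 70 , 2) ∷ (100 , 15 , 15) ∷ (70 , 134 , 9) ∷
   (134 , 3 , 15) ∷ (70 , 44 , 6) ∷ (44 , 82 , 69) ∷ (82 , 3 , 6) ∷ (62 , 83 , 2) ∷ (83 , 2 , 10) ∷
   (62 , 4 , 10) ∷ (101 , 269 , 2) ∷ (62 , 269 , 3) ∷ (269 , 24 , 10) ∷ (101 , 62 , 6) ∷ []) ∷
  ((101 , 134 , 11) ∷ (62 , 24 , 11) ∷ (188 , 101 , 2) ∷ (188 , 83 , 26) ∷ (101 , 2 , 38) ∷
   (62 , 2 , 18) ∷ (222 , 270 , 2) ∷ (222 , 62 , 15) ∷ (222 , 33 , 38) ∷ (270 , 83 , 15) ∷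
   (270 , 24 , 38) ∷ (83 , 3 , 18) ∷ (188 , 33 , 18) ∷ (101 , 83 , 4) ∷ (83 , 82 , 11) ∷
   (100 , 89 , 6) ∷ []) ∷
  ((70 , 4 , 15) ∷ (99 , 62 , 2) ∷ (99 , 2 , 149) ∷ (62 , 3 , 149) ∷ (189 , 188 , 2) ∷
   (188 , 62 , 4) ∷ (188 , 24 , 149) ∷ (189 , 62 , 26) ∷ (189 , 70 , 11) ∷ (189 , 44 , 18) ∷
   (99 , 4 , 18) ∷ (189 , 101 , 9) ∷ (99 , 101 , 3) ∷ (101 , 24 , 18) ∷ (189 , 99 , 4) ∷
   (99 , 33 , 11) ∷ []) ∷
  ((15 , 3 , 69) ∷ (89 , 24 , 69) ∷ (4 , 3 , 9) ∷ (89 , 33 , 9) ∷ (51 , 32 , 9) ∷ (4 , 32 , 4) ∷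
   (33 , 32 , 15) ∷ (89 , 51 , 15) ∷ (15 , 33 , 3) ∷ (100 , 33 , 26) ∷ (70 , 24 , 26) ∷
   (135 , 44 , 9) ∷ (9 , 19 , 2) ∷ (135 , 70 , 19) ∷ (135 , 100 , 3) ∷ (15 , 24 , 19) ∷ []) ∷
  ((135 , 15 , 26) ∷ (51 , 2 , 19) ∷ (91 , 51 , 2) ∷ (91 , 4 , 19) ∷ (31 , 3 , 19) ∷
   (91 , 31 , 9) ∷ (26 , 19 , 9) ∷ (44 , 32 , 56) ∷ (2 , 32 , 6) ∷ (33 , 4 , 6) ∷ (172 , 100 , 2) ∷
   (172 , 89 , 4) ∷ (89 , 70 , 3) ∷ (172 , 70 , 9) ∷ (100 , 4 , 56) ∷ (173 , 190 , 2) ∷ []) ∷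
  ((136 , 121 , 2) ∷ (173 , 121 , 56) ∷ (9 , 121 , 6) ∷ (173 , 9 , 26) ∷ (56 , 136 , 4) ∷
   (26 , 136 , 6) ∷ (56 , 190 , 3) ∷ (190 , 26 , 6) ∷ (56 , 9 , 9) ∷ (82 , 92 , 2) ∷
   (33 , 92 , 69) ∷ (191 , 44 , 15) ∷ (191 , 33 , 56) ∷ (191 , 100 , 6) ∷ (89 , 15 , 4) ∷
   (24 , 82 , 2) ∷ []) ∷
  ((70 , 84 , 2) ∷ (84 , 24 , 4) ∷ (84 , 3 , 56) ∷ (70 , 33 , 4) ∷ (3 , 92 , 3) ∷ (4 , 82 , 19) ∷
   (31 , 32 , 2) ∷ (134 , 2 , 52) ∷ (33 , 31 , 52) ∷ (70 , 15 , 52) ∷ (134 , 82 , 4) ∷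
   (33 , 82 , 9) ∷ (136 , 19 , 19) ∷ (26 , 121 , 4) ∷ (136 , 9 , 3) ∷ (173 , 26 , 4) ∷ []) ∷
  ((4 , 31 , 6) ∷ (173 , 56 , 6) ∷ (89 , 31 , 56) ∷ (190 , 9 , 4) ∷ (32 , 3 , 3) ∷ (44 , 4 , 4) ∷
   (11 , 32 , 37) ∷ (18 , 11 , 2) ∷ (98 , 99 , 2) ∷ (98 , 15 , 18) ∷ (271 , 150 , 2) ∷
   (174 , 122 , 2) ∷ (150 , 122 , 37) ∷ (122 , 31 , 18) ∷ (150 , 18 , 18) ∷ (174 , 99 , 3) ∷ []) ∷
  ((174 , 51 , 18) ∷ (271 , 99 , 1) ∷ (271 , 38 , 18) ∷ (122 , 32 , 149) ∷ (98 , 4 , 149) ∷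
   (272 , 122 , 9) ∷ (272 , 98 , 3) ∷ (272 , 51 , 149) ∷ (98 , 122 , 4) ∷ (38 , 51 , 37) ∷
   (16 , 2 , 0) ∷ (112 , 32 , 25) ∷ (16 , 4 , 25) ∷ (192 , 112 , 9) ∷ (192 , 16 , 3) ∷
   (192 , 51 , 25) ∷ []) ∷
  ((16 , 112 , 4) ∷ (59 , 32 , 0) ∷ (16 , 59 , 6) ∷ (60 , 2 , 25) ∷ (137 , 193 , 25) ∷
   (102 , 32 , 21) ∷ (21 , 1 , 1) ∷ (113 , 102 , 9) ∷ (102 , 2 , 22) ∷ (113 , 15 , 22) ∷
   (273 , 274 , 2) ∷ (113 , 274 , 4) ∷ (274 , 31 , 22) ∷ (113 , 273 , 6) ∷ (273 , 51 , 22) ∷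
   (113 , 51 , 21) ∷ []) ∷
  ((275 , 276 , 25) ∷ (102 , 276 , 193) ∷ (276 , 31 , 11) ∷ (275 , 102 , 60) ∷ (275 , 59 , 11) ∷
   (102 , 11 , 11) ∷ (11 , 31 , 193) ∷ (59 , 11 , 60) ∷ (59 , 31 , 25) ∷ (277 , 103 , 137) ∷
   (16 , 277 , 15) ∷ (112 , 277 , 6) ∷ (15 , 103 , 15) ∷ (31 , 103 , 6) ∷ (16 , 15 , 137) ∷
   (112 , 31 , 137) ∷ []) ∷
  ((16 , 11 , 16) ∷ (44 , 15 , 6) ∷ (44 , 31 , 15) ∷ (33 , 24 , 2) ∷ (70 , 2 , 56) ∷
   (100 , 84 , 9) ∷ (84 , 2 , 15) ∷ (194 , 24 , 15) ∷ (70 , 194 , 3) ∷ (24 , 32 , 52) ∷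
   (84 , 4 , 52) ∷ (194 , 33 , 52) ∷ (84 , 33 , 6) ∷ (84 , 32 , 68) ∷ (194 , 2 , 68) ∷
   (194 , 84 , 6) ∷ []) ∷
  ((68 , 15 , 2) ∷ (70 , 32 , 238) ∷ (191 , 278 , 2) ∷ (191 , 4 , 238) ∷ (239 , 33 , 68) ∷
   (239 , 70 , 52) ∷ (239 , 84 , 15) ∷ (191 , 239 , 3) ∷ (278 , 84 , 4) ∷ (100 , 278 , 3) ∷
   (194 , 3 , 238) ∷ (100 , 31 , 238) ∷ (44 , 84 , 3) ∷ (68 , 4 , 9) ∷ (240 , 34 , 34) ∷
   (56 , 240 , 56) ∷ []) ∷
  ((9 , 240 , 52) ∷ (68 , 84 , 34) ∷ (9 , 34 , 9) ∷ (70 , 31 , 68) ∷ (151 , 2 , 34) ∷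
   (135 , 91 , 15) ∷ (91 , 151 , 4) ∷ (151 , 31 , 3) ∷ (135 , 68 , 4) ∷ (151 , 103 , 2) ∷
   (223 , 151 , 2) ∷ (223 , 4 , 34) ∷ (223 , 103 , 9) ∷ (68 , 51 , 4) ∷ (223 , 51 , 3) ∷
   (103 , 3 , 34) ∷ []) ∷
  ((68 , 151 , 15) ∷ (68 , 44 , 3) ∷ (26 , 9 , 2) ∷ (93 , 38 , 2) ∷ (93 , 15 , 1) ∷
   (98 , 83 , 69) ∷ (98 , 101 , 19) ∷ (56 , 19 , 69) ∷ (93 , 11 , 69) ∷ (101 , 32 , 93) ∷
   (98 , 62 , 9) ∷ (279 , 62 , 69) ∷ (174 , 90 , 9) ∷ (279 , 174 , 4) ∷ (90 , 32 , 18) ∷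
   (279 , 91 , 38) ∷ []) ∷
  ((91 , 32 , 69) ∷ (122 , 90 , 2) ∷ (241 , 222 , 2) ∷ (241 , 33 , 195) ∷ (195 , 26 , 1) ∷
   (222 , 24 , 195) ∷ (241 , 62 , 56) ∷ (241 , 44 , 38) ∷ (62 , 32 , 38) ∷ (196 , 136 , 2) ∷
   (196 , 26 , 3) ∷ (280 , 136 , 9) ∷ (280 , 56 , 3) ∷ (224 , 197 , 9) ∷ (224 , 34 , 4) ∷
   (9 , 197 , 281) ∷ []) ∷
  ((114 , 197 , 69) ∷ (26 , 114 , 3) ∷ (69 , 282 , 9) ∷ (198 , 197 , 2) ∷ (26 , 198 , 281) ∷
   (283 , 284 , 9) ∷ (34 , 284 , 34) ∷ (198 , 284 , 19) ∷ (26 , 283 , 282) ∷ (114 , 283 , 19) ∷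
   (196 , 224 , 282) ∷ (196 , 19 , 281) ∷ (26 , 34 , 69) ∷ (280 , 121 , 69) ∷ (34 , 197 , 3) ∷
   (19 , 197 , 19) ∷ []) ∷
  ((121 , 34 , 19) ∷ (172 , 15 , 56) ∷ (172 , 44 , 26) ∷ (15 , 32 , 26) ∷ (51 , 24 , 34) ∷
   (24 , 2 , 6) ∷ (198 , 34 , 6) ∷ (121 , 199 , 2) ∷ (199 , 34 , 3) ∷ (19 , 199 , 6) ∷
   (121 , 198 , 34) ∷ (9 , 198 , 19) ∷ (15 , 51 , 6) ∷ (44 , 103 , 68) ∷ (89 , 68 , 6) ∷
   (135 , 33 , 69) ∷ []) ∷
  ((91 , 15 , 3) ∷ (51 , 103 , 4) ∷ (172 , 135 , 6) ∷ (136 , 199 , 9) ∷ (26 , 199 , 26) ∷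
   (173 , 136 , 15) ∷ (26 , 240 , 15) ∷ (190 , 121 , 15) ∷ (190 , 114 , 2) ∷ (173 , 114 , 9) ∷
   (138 , 58 , 2) ∷ (138 , 33 , 1) ∷ (58 , 2 , 12) ∷ (285 , 286 , 2) ∷ (286 , 24 , 12) ∷
   (138 , 286 , 3) ∷ []) ∷
  ((285 , 33 , 12) ∷ (285 , 138 , 6) ∷ (138 , 4 , 12) ∷ (58 , 24 , 1) ∷ (18 , 31 , 37) ∷
   (58 , 4 , 37) ∷ (58 , 18 , 6) ∷ (58 , 11 , 4) ∷ (0 , 63 , 9) ∷ (59 , 24 , 63) ∷ (25 , 287 , 9) ∷
   (59 , 33 , 287) ∷ (200 , 175 , 2) ∷ (175 , 112 , 1) ∷ (175 , 58 , 287) ∷ (200 , 59 , 1) ∷ []) ∷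
  ((200 , 58 , 63) ∷ (24 , 92 , 9) ∷ (288 , 32 , 34) ∷ (68 , 288 , 68) ∷ (288 , 103 , 3) ∷
   (172 , 91 , 68) ∷ (91 , 103 , 26) ∷ (68 , 103 , 56) ∷ (68 , 91 , 6) ∷ (44 , 51 , 52) ∷
   (123 , 138 , 2) ∷ (104 , 64 , 2) ∷ (104 , 51 , 1) ∷ (64 , 2 , 47) ∷ (225 , 93 , 2) ∷
   (93 , 33 , 47) ∷ []) ∷
  ((93 , 138 , 3) ∷ (225 , 44 , 47) ∷ (225 , 104 , 4) ∷ (104 , 4 , 47) ∷ (64 , 31 , 1) ∷
   (138 , 64 , 52) ∷ (123 , 58 , 9) ∷ (123 , 104 , 52) ∷ (123 , 33 , 23) ∷ (138 , 24 , 23) ∷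
   (123 , 79 , 69) ∷ (79 , 82 , 1) ∷ (64 , 79 , 34) ∷ (58 , 82 , 23) ∷ (104 , 58 , 34) ∷
   (123 , 44 , 1) ∷ []) ∷
  ((225 , 176 , 52) ∷ (176 , 51 , 47) ∷ (176 , 104 , 3) ∷ (225 , 123 , 3) ∷ (123 , 64 , 15) ∷
   (135 , 89 , 2) ∷ (104 , 48 , 9) ∷ (48 , 2 , 5) ∷ (289 , 48 , 69) ∷ (289 , 91 , 1) ∷
   (176 , 201 , 2) ∷ (201 , 51 , 5) ∷ (289 , 201 , 4) ∷ (176 , 91 , 5) ∷ (104 , 15 , 5) ∷
   (64 , 48 , 2) ∷ []) ∷
  ((124 , 94 , 2) ∷ (124 , 31 , 5) ∷ (201 , 94 , 9) ∷ (48 , 94 , 6) ∷ (104 , 201 , 6) ∷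
   (64 , 124 , 6) ∷ (104 , 124 , 4) ∷ (201 , 64 , 3) ∷ (94 , 32 , 5) ∷ (64 , 94 , 4) ∷
   (64 , 4 , 5) ∷ (48 , 32 , 1) ∷ (11 , 24 , 35) ∷ (11 , 92 , 47) ∷ (32 , 92 , 34) ∷
   (58 , 115 , 9) ∷ []) ∷
  ((115 , 202 , 35) ∷ (290 , 11 , 52) ∷ (290 , 202 , 1) ∷ (58 , 290 , 3) ∷ (58 , 48 , 52) ∷
   (4 , 202 , 34) ∷ (115 , 92 , 1) ∷ (48 , 115 , 34) ∷ (38 , 24 , 47) ∷ (48 , 3 , 47) ∷
   (38 , 48 , 4) ∷ (37 , 35 , 9) ∷ (242 , 58 , 35) ∷ (242 , 115 , 47) ∷ (115 , 3 , 37) ∷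
   (242 , 11 , 1) ∷ []) ∷
  ((242 , 48 , 37) ∷ (48 , 11 , 3) ∷ (124 , 152 , 9) ∷ (203 , 152 , 47) ∷ (203 , 124 , 35) ∷
   (291 , 11 , 47) ∷ (291 , 38 , 35) ∷ (11 , 152 , 52) ∷ (38 , 124 , 52) ∷ (291 , 203 , 52) ∷
   (38 , 44 , 35) ∷ (124 , 32 , 47) ∷ (124 , 48 , 3) ∷ (152 , 32 , 35) ∷ (48 , 152 , 4) ∷
   (48 , 4 , 35) ∷ []) ∷
  ((223 , 31 , 19) ∷ (151 , 32 , 19) ∷ (17 , 7 , 0) ∷ (0 , 105 , 10) ∷ (105 , 1 , 17) ∷
   (20 , 10 , 20) ∷ (17 , 1 , 20) ∷ (21 , 116 , 10) ∷ (53 , 7 , 7) ∷ (116 , 53 , 1) ∷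
   (153 , 5 , 7) ∷ (116 , 153 , 2) ∷ (0 , 57 , 21) ∷ (5 , 7 , 8) ∷ (14 , 5 , 0) ∷ (14 , 17 , 8) ∷ []) ∷
  ((45 , 10 , 0) ∷ (0 , 204 , 18) ∷ (18 , 2 , 1) ∷ (204 , 27 , 7) ∷ (17 , 27 , 2) ∷ (0 , 65 , 7) ∷
   (65 , 1 , 45) ∷ (65 , 27 , 18) ∷ (14 , 153 , 45) ∷ (204 , 57 , 8) ∷ (204 , 153 , 20) ∷
   (153 , 53 , 8) ∷ (57 , 53 , 20) ∷ (105 , 116 , 20) ∷ (17 , 53 , 45) ∷ (125 , 10 , 7) ∷ []) ∷
  ((10 , 74 , 10) ∷ (125 , 74 , 1) ∷ (20 , 74 , 45) ∷ (45 , 125 , 45) ∷ (21 , 53 , 21) ∷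
   (49 , 7 , 10) ∷ (7 , 117 , 7) ∷ (49 , 117 , 1) ∷ (5 , 154 , 7) ∷ (49 , 154 , 2) ∷
   (126 , 5 , 10) ∷ (126 , 49 , 8) ∷ (27 , 7 , 25) ∷ (14 , 1 , 25) ∷ (27 , 226 , 7) ∷
   (205 , 13 , 10) ∷ []) ∷
  ((205 , 49 , 2) ∷ (0 , 27 , 23) ∷ (65 , 226 , 23) ∷ (65 , 205 , 25) ∷ (205 , 117 , 23) ∷
   (226 , 117 , 25) ∷ (1 , 13 , 8) ∷ (17 , 13 , 25) ∷ (14 , 27 , 1) ∷ (27 , 154 , 17) ∷
   (14 , 126 , 17) ∷ (154 , 117 , 8) ∷ (17 , 49 , 17) ∷ (1 , 53 , 10) ∷ (0 , 21 , 20) ∷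
   (36 , 7 , 21) ∷ []) ∷
  ((36 , 1 , 10) ∷ (17 , 57 , 10) ∷ (177 , 5 , 45) ∷ (65 , 177 , 2) ∷ (106 , 7 , 45) ∷
   (65 , 106 , 1) ∷ (243 , 5 , 46) ∷ (57 , 243 , 2) ∷ (105 , 21 , 46) ∷ (105 , 57 , 1) ∷
   (0 , 116 , 45) ∷ (17 , 243 , 18) ∷ (177 , 106 , 8) ∷ (57 , 1 , 46) ∷ (17 , 36 , 46) ∷
   (65 , 36 , 20) ∷ []) ∷
  ((27 , 5 , 20) ∷ (40 , 7 , 20) ∷ (17 , 40 , 1) ∷ (27 , 40 , 8) ∷ (107 , 7 , 46) ∷
   (57 , 107 , 1) ∷ (0 , 118 , 75) ∷ (292 , 5 , 40) ∷ (118 , 292 , 2) ∷ (204 , 292 , 10) ∷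
   (118 , 1 , 40) ∷ (40 , 107 , 10) ∷ (243 , 107 , 8) ∷ (118 , 53 , 17) ∷ (65 , 57 , 75) ∷
   (36 , 53 , 75) ∷ []) ∷
  ((206 , 57 , 5) ∷ (206 , 53 , 14) ∷ (54 , 7 , 5) ∷ (0 , 76 , 6) ∷ (1 , 54 , 6) ∷ (76 , 57 , 22) ∷
   (22 , 1 , 8) ∷ (22 , 153 , 10) ∷ (10 , 6 , 8) ∷ (206 , 54 , 17) ∷ (76 , 1 , 14) ∷
   (76 , 206 , 10) ∷ (17 , 107 , 21) ∷ (65 , 17 , 10) ∷ (1 , 7 , 1) ∷ (0 , 55 , 12) ∷ []) ∷
  ((0 , 12 , 25) ∷ (0 , 77 , 37) ∷ (77 , 55 , 2) ∷ (27 , 293 , 37) ∷ (55 , 293 , 1) ∷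
   (294 , 12 , 27) ∷ (108 , 5 , 42) ∷ (55 , 108 , 2) ∷ (295 , 5 , 27) ∷ (12 , 5 , 9) ∷
   (294 , 295 , 9) ∷ (77 , 108 , 9) ∷ (295 , 108 , 7) ∷ (55 , 1 , 42) ∷ (293 , 7 , 42) ∷
   (294 , 77 , 7) ∷ []) ∷
  ((14 , 55 , 37) ∷ (25 , 37 , 25) ∷ (12 , 85 , 12) ∷ (55 , 85 , 25) ∷ (12 , 227 , 37) ∷
   (227 , 85 , 2) ∷ (77 , 227 , 25) ∷ (1 , 85 , 37) ∷ (77 , 12 , 42) ∷ (13 , 127 , 13) ∷
   (12 , 86 , 13) ∷ (86 , 127 , 1) ∷ (28 , 13 , 0) ∷ (139 , 13 , 5) ∷ (54 , 5 , 3) ∷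
   (139 , 54 , 2) ∷ []) ∷
  ((17 , 5 , 16) ∷ (28 , 1 , 16) ∷ (77 , 54 , 16) ∷ (28 , 17 , 2) ∷ (77 , 86 , 17) ∷
   (139 , 86 , 7) ∷ (28 , 86 , 28) ∷ (85 , 127 , 7) ∷ (244 , 127 , 0) ∷ (76 , 12 , 119) ∷
   (76 , 55 , 1) ∷ (296 , 127 , 119) ∷ (55 , 296 , 13) ∷ (0 , 28 , 8) ∷ (28 , 244 , 13) ∷
   (297 , 42 , 8) ∷ []) ∷
  ((12 , 155 , 5) ∷ (244 , 155 , 297) ∷ (28 , 155 , 14) ∷ (296 , 7 , 297) ∷ (76 , 77 , 8) ∷
   (77 , 244 , 7) ∷ (55 , 13 , 119) ∷ (108 , 7 , 119) ∷ (77 , 13 , 14) ∷ (80 , 5 , 12) ∷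
   (60 , 3 , 0) ∷ (79 , 3 , 12) ∷ (178 , 5 , 37) ∷ (80 , 1 , 37) ∷ (298 , 115 , 0) ∷
   (298 , 79 , 25) ∷ []) ∷
  ((298 , 60 , 37) ∷ (79 , 115 , 2) ∷ (60 , 115 , 60) ∷ (60 , 79 , 42) ∷ (80 , 178 , 2) ∷
   (14 , 178 , 60) ∷ (299 , 37 , 37) ∷ (37 , 207 , 3) ∷ (299 , 207 , 1) ∷ (25 , 207 , 14) ∷
   (25 , 299 , 42) ∷ (14 , 80 , 42) ∷ (85 , 7 , 3) ∷ (139 , 5 , 19) ∷ (5 , 109 , 3) ∷
   (1 , 109 , 19) ∷ []) ∷
  ((0 , 300 , 193) ∷ (14 , 77 , 193) ∷ (109 , 7 , 193) ∷ (300 , 77 , 2) ∷ (300 , 55 , 9) ∷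
   (227 , 13 , 3) ∷ (227 , 7 , 19) ∷ (139 , 85 , 1) ∷ (76 , 27 , 47) ∷ (76 , 301 , 37) ∷
   (301 , 85 , 14) ∷ (5 , 71 , 5) ∷ (1 , 71 , 47) ∷ (27 , 245 , 3) ∷ (14 , 245 , 47) ∷
   (245 , 71 , 25) ∷ []) ∷
  ((301 , 55 , 3) ∷ (139 , 7 , 47) ∷ (76 , 139 , 25) ∷ (55 , 7 , 14) ∷ (12 , 1 , 2) ∷
   (21 , 29 , 5) ∷ (29 , 5 , 4) ∷ (81 , 5 , 5) ∷ (156 , 5 , 35) ∷ (81 , 156 , 2) ∷ (22 , 29 , 35) ∷
   (157 , 5 , 8) ∷ (22 , 157 , 2) ∷ (29 , 155 , 8) ∷ (80 , 29 , 8) ∷ (5 , 72 , 35) ∷ []) ∷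
  ((155 , 72 , 2) ∷ (30 , 5 , 6) ∷ (80 , 30 , 1) ∷ (29 , 302 , 35) ∷ (43 , 6 , 0) ∷
   (14 , 81 , 43) ∷ (0 , 208 , 35) ∷ (208 , 302 , 14) ∷ (208 , 12 , 43) ∷ (14 , 30 , 14) ∷
   (302 , 72 , 4) ∷ (22 , 81 , 6) ∷ (157 , 156 , 6) ∷ (80 , 157 , 4) ∷ (155 , 7 , 4) ∷
   (21 , 12 , 8) ∷ []) ∷
  ((22 , 156 , 4) ∷ (81 , 1 , 35) ∷ (87 , 158 , 23) ∷ (87 , 5 , 47) ∷ (23 , 47 , 2) ∷
   (30 , 72 , 8) ∷ (22 , 30 , 5) ∷ (87 , 156 , 9) ∷ (54 , 109 , 34) ∷ (87 , 30 , 303) ∷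
   (23 , 303 , 9) ∷ (109 , 179 , 5) ∷ (29 , 304 , 5) ∷ (304 , 179 , 9) ∷ (12 , 304 , 303) ∷
   (7 , 179 , 34) ∷ []) ∷
  ((109 , 71 , 8) ∷ (22 , 109 , 47) ∷ (72 , 71 , 2) ∷ (12 , 72 , 47) ∷ (30 , 71 , 1) ∷
   (21 , 30 , 47) ∷ (7 , 71 , 3) ∷ (87 , 139 , 8) ∷ (81 , 54 , 8) ∷ (21 , 54 , 12) ∷
   (12 , 7 , 23) ∷ (87 , 81 , 2) ∷ (87 , 12 , 35) ∷ (81 , 158 , 1) ∷ (158 , 7 , 35) ∷
   (21 , 81 , 4) ∷ []) ∷
  ((29 , 30 , 2) ∷ (0 , 140 , 119) ∷ (140 , 29 , 2) ∷ (13 , 85 , 6) ∷ (29 , 13 , 37) ∷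
   (140 , 13 , 12) ∷ (30 , 7 , 37) ∷ (27 , 72 , 119) ∷ (29 , 72 , 1) ∷ (29 , 71 , 23) ∷
   (128 , 27 , 6) ∷ (128 , 245 , 2) ∷ (128 , 72 , 25) ∷ (14 , 29 , 119) ∷ (29 , 1 , 6) ∷
   (140 , 72 , 23) ∷ []) ∷
  ((72 , 129 , 3) ∷ (140 , 306 , 3) ∷ (306 , 129 , 23) ∷ (246 , 140 , 3) ∷ (140 , 305 , 19) ∷
   (246 , 29 , 19) ∷ (13 , 72 , 3) ∷ (246 , 13 , 23) ∷ (13 , 71 , 19) ∷ (306 , 7 , 246) ∷
   (305 , 129 , 1) ∷ (305 , 71 , 12) ∷ (129 , 71 , 6) ∷ (140 , 12 , 6) ∷ (72 , 7 , 6) ∷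
   (29 , 7 , 12) ∷ []) ∷
  ((1 , 5 , 2) ∷ (0 , 95 , 4) ∷ (12 , 54 , 4) ∷ (95 , 54 , 25) ∷ (12 , 29 , 3) ∷ (21 , 5 , 23) ∷
   (95 , 55 , 8) ∷ (54 , 85 , 8) ∷ (76 , 14 , 3) ∷ (14 , 108 , 12) ∷ (14 , 12 , 137) ∷
   (63 , 41 , 0) ∷ (63 , 1 , 137) ∷ (307 , 19 , 0) ∷ (76 , 63 , 19) ∷ (307 , 9 , 25) ∷ []) ∷
  ((77 , 5 , 307) ∷ (1 , 41 , 9) ∷ (108 , 41 , 60) ∷ (108 , 85 , 137) ∷ (95 , 5 , 14) ∷
   (12 , 139 , 6) ∷ (108 , 158 , 20) ∷ (0 , 209 , 42) ∷ (209 , 29 , 1) ∷ (209 , 21 , 6) ∷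
   (55 , 54 , 20) ∷ (20 , 6 , 25) ∷ (54 , 158 , 2) ∷ (5 , 158 , 6) ∷ (77 , 1 , 60) ∷
   (55 , 5 , 60) ∷ []) ∷
  ((308 , 21 , 3) ∷ (308 , 81 , 9) ∷ (308 , 12 , 5) ∷ (54 , 41 , 19) ∷ (158 , 41 , 3) ∷
   (29 , 41 , 26) ∷ (30 , 41 , 4) ∷ (109 , 41 , 6) ∷ (29 , 109 , 9) ∷ (41 , 179 , 41) ∷
   (155 , 129 , 19) ∷ (155 , 71 , 9) ∷ (129 , 179 , 2) ∷ (30 , 129 , 5) ∷ (12 , 158 , 26) ∷
   (41 , 228 , 3) ∷ []) ∷
  ((30 , 228 , 9) ∷ (12 , 30 , 19) ∷ (5 , 228 , 19) ∷ (210 , 156 , 3) ∷ (87 , 210 , 4) ∷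
   (81 , 247 , 4) ∷ (81 , 210 , 6) ∷ (156 , 247 , 6) ∷ (21 , 87 , 6) ∷ (247 , 41 , 41) ∷
   (156 , 41 , 5) ∷ (309 , 87 , 3) ∷ (309 , 210 , 9) ∷ (309 , 12 , 41) ∷ (210 , 247 , 2) ∷
   (210 , 5 , 41) ∷ []) ∷
  ((84 , 134 , 2) ∷ (140 , 30 , 9) ∷ (31 , 82 , 34) ∷ (2 , 92 , 19) ∷ (64 , 18 , 3) ∷
   (18 , 3 , 23) ∷ (64 , 32 , 23) ∷ (18 , 79 , 3) ∷ (79 , 92 , 23) ∷ (96 , 111 , 3) ∷
   (96 , 32 , 8) ∷ (18 , 4 , 8) ∷ (18 , 96 , 4) ∷ (11 , 96 , 6) ∷ (11 , 310 , 11) ∷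
   (96 , 310 , 111) ∷ []) ∷
  ((311 , 11 , 8) ∷ (311 , 111 , 1) ∷ (79 , 11 , 6) ∷ (11 , 115 , 3) ∷ (311 , 115 , 5) ∷
   (79 , 310 , 18) ∷ (24 , 202 , 3) ∷ (134 , 24 , 6) ∷ (134 , 202 , 2) ∷ (141 , 159 , 3) ∷
   (159 , 102 , 6) ∷ (141 , 102 , 2) ∷ (141 , 18 , 11) ∷ (150 , 141 , 6) ∷ (113 , 150 , 3) ∷
   (113 , 141 , 2) ∷ []) ∷
  ((102 , 312 , 3) ∷ (159 , 312 , 2) ∷ (38 , 58 , 3) ∷ (150 , 248 , 3) ∷ (313 , 150 , 6) ∷
   (313 , 248 , 2) ∷ (101 , 3 , 195) ∷ (248 , 111 , 195) ∷ (313 , 11 , 195) ∷ (248 , 312 , 4) ∷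
   (113 , 38 , 11) ∷ (141 , 58 , 111) ∷ (150 , 159 , 2) ∷ (159 , 11 , 18) ∷ (202 , 92 , 4) ∷
   (18 , 24 , 5) ∷ []) ∷
  ((11 , 82 , 5) ∷ (111 , 92 , 5) ∷ (211 , 18 , 47) ∷ (211 , 64 , 1) ∷ (211 , 48 , 23) ∷
   (176 , 64 , 19) ∷ (176 , 151 , 23) ∷ (174 , 31 , 149) ∷ (90 , 3 , 249) ∷ (113 , 18 , 249) ∷
   (113 , 122 , 1) ∷ (113 , 90 , 23) ∷ (122 , 2 , 249) ∷ (174 , 4 , 249) ∷ (149 , 19 , 23) ∷
   (104 , 62 , 314) ∷ []) ∷
  ((141 , 31 , 21) ∷ (90 , 31 , 10) ∷ (141 , 90 , 1) ∷ (62 , 90 , 6) ∷ (141 , 62 , 5) ∷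
   (64 , 83 , 314) ∷ (23 , 314 , 23) ∷ (122 , 83 , 19) ∷ (48 , 31 , 8) ∷ (160 , 3 , 16) ∷
   (60 , 160 , 8) ∷ (16 , 31 , 250) ∷ (60 , 32 , 250) ∷ (59 , 96 , 16) ∷ (200 , 48 , 0) ∷
   (175 , 96 , 0) ∷ []) ∷
  ((175 , 59 , 8) ∷ (94 , 96 , 3) ∷ (175 , 94 , 250) ∷ (200 , 124 , 250) ∷ (59 , 160 , 5) ∷
   (16 , 60 , 2) ∷ (112 , 3 , 14) ∷ (112 , 315 , 3) ∷ (315 , 2 , 137) ∷ (316 , 112 , 3) ∷
   (316 , 32 , 14) ∷ (316 , 11 , 315) ∷ (200 , 18 , 14) ∷ (60 , 4 , 137) ∷ (60 , 112 , 6) ∷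
   (175 , 60 , 5) ∷ []) ∷
  ((18 , 48 , 6) ∷ (35 , 317 , 35) ∷ (207 , 35 , 4) ∷ (207 , 317 , 1) ∷ (207 , 8 , 6) ∷
   (8 , 317 , 5) ∷ (96 , 2 , 35) ∷ (18 , 83 , 7) ∷ (159 , 18 , 10) ∷ (159 , 83 , 1) ∷
   (159 , 62 , 8) ∷ (251 , 318 , 18) ∷ (102 , 4 , 142) ∷ (251 , 2 , 142) ∷ (142 , 8 , 8) ∷
   (102 , 251 , 2) ∷ []) ∷
  ((102 , 83 , 5) ∷ (251 , 83 , 35) ∷ (96 , 318 , 2) ∷ (318 , 3 , 35) ∷ (96 , 3 , 5) ∷
   (93 , 4 , 23) ∷ (123 , 93 , 6) ∷ (18 , 33 , 35) ∷ (93 , 44 , 5) ∷ (38 , 2 , 23) ∷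
   (94 , 152 , 2) ∷ (48 , 24 , 41) ∷ (64 , 33 , 41) ∷ (38 , 33 , 5) ∷ (94 , 2 , 41) ∷
   (152 , 3 , 41) ∷ []) ∷
  ((93 , 64 , 4) ∷ (64 , 319 , 15) ∷ (211 , 203 , 15) ∷ (203 , 319 , 1) ∷ (203 , 94 , 5) ∷
   (319 , 152 , 3) ∷ (211 , 93 , 35) ∷ (211 , 38 , 5) ∷ (94 , 31 , 35) ∷ (38 , 94 , 15) ∷
   (123 , 48 , 56) ∷ (93 , 94 , 56) ∷ (130 , 4 , 0) ∷ (143 , 16 , 6) ∷ (143 , 11 , 130) ∷
   (16 , 180 , 8) ∷ []) ∷
  ((130 , 180 , 1) ∷ (320 , 212 , 6) ∷ (321 , 212 , 37) ∷ (321 , 79 , 43) ∷ (320 , 24 , 43) ∷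
   (143 , 321 , 3) ∷ (143 , 320 , 5) ∷ (212 , 2 , 43) ∷ (180 , 212 , 3) ∷ (143 , 18 , 43) ∷
   (130 , 16 , 2) ∷ (212 , 160 , 6) ∷ (160 , 32 , 43) ∷ (16 , 212 , 5) ∷ (16 , 48 , 43) ∷
   (130 , 48 , 130) ∷ []) ∷
  ((114 , 9 , 6) ∷ (224 , 19 , 6) ∷ (114 , 224 , 2) ∷ (196 , 9 , 19) ∷ (196 , 114 , 34) ∷
   (114 , 34 , 26) ∷ (56 , 26 , 2) ∷ (114 , 199 , 15) ∷ (322 , 92 , 6) ∷ (24 , 322 , 19) ∷
   (82 , 322 , 3) ∷ (24 , 3 , 4) ∷ (114 , 19 , 4) ∷ (121 , 19 , 3) ∷ (100 , 134 , 69) ∷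
   (29 , 54 , 52) ∷ []) ∷
  ((52 , 6 , 2) ∷ (0 , 29 , 14) ∷ (59 , 2 , 14) ∷ (192 , 31 , 0) ∷ (4 , 103 , 52) ∷
   (323 , 51 , 0) ∷ (323 , 59 , 9) ∷ (323 , 15 , 14) ∷ (192 , 59 , 2) ∷ (192 , 4 , 14) ∷
   (59 , 112 , 2) ∷ (143 , 24 , 0) ∷ (324 , 92 , 0) ∷ (143 , 324 , 9) ∷ (59 , 324 , 34) ∷
   (325 , 82 , 0) ∷ []) ∷
  ((143 , 325 , 2) ∷ (16 , 96 , 130) ∷ (48 , 96 , 2) ∷ (208 , 29 , 16) ∷ (208 , 1 , 130) ∷
   (59 , 60 , 3) ∷ (208 , 77 , 52) ∷ (130 , 59 , 4) ∷ (16 , 325 , 3) ∷ (143 , 59 , 52) ∷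
   (63 , 327 , 63) ∷ (326 , 328 , 63) ∷ (327 , 328 , 2) ∷ (5 , 328 , 34) ∷ (327 , 41 , 52) ∷
   (14 , 326 , 9) ∷ []) ∷
  ((326 , 41 , 25) ∷ (63 , 30 , 119) ∷ (95 , 30 , 63) ∷ (95 , 1 , 119) ∷ (27 , 129 , 63) ∷
   (128 , 71 , 0) ∷ (30 , 179 , 47) ∷ (329 , 179 , 63) ∷ (329 , 71 , 119) ∷ (95 , 329 , 47) ∷
   (128 , 129 , 14) ∷ (95 , 128 , 41) ∷ (5 , 129 , 41) ∷ (95 , 27 , 5) ∷ (59 , 4 , 119) ∷
   (14 , 63 , 2) ∷ []) ∷
  ((161 , 30 , 0) ∷ (181 , 30 , 25) ∷ (161 , 181 , 2) ∷ (181 , 63 , 6) ∷ (161 , 63 , 4) ∷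
   (63 , 5 , 25) ∷ (181 , 109 , 0) ∷ (0 , 181 , 19) ∷ (330 , 228 , 0) ∷ (161 , 330 , 9) ∷
   (14 , 330 , 19) ∷ (109 , 228 , 2) ∷ (14 , 181 , 3) ∷ (161 , 14 , 6) ∷ (181 , 128 , 8) ∷
   (161 , 29 , 25) ∷ []) ∷
  ((161 , 80 , 20) ∷ (128 , 30 , 20) ∷ (161 , 128 , 1) ∷ (14 , 128 , 5) ∷ (30 , 109 , 2) ∷
   (45 , 20 , 1) ∷ (10 , 144 , 7) ∷ (145 , 10 , 10) ∷ (145 , 144 , 1) ∷ (97 , 46 , 7) ∷
   (46 , 252 , 10) ∷ (97 , 252 , 1) ∷ (253 , 46 , 21) ∷ (254 , 46 , 10) ∷ (253 , 254 , 1) ∷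
   (182 , 75 , 46) ∷ []) ∷
  ((253 , 97 , 75) ∷ (254 , 252 , 75) ∷ (253 , 145 , 20) ∷ (20 , 252 , 21) ∷ (182 , 97 , 1) ∷
   (182 , 125 , 20) ∷ (43 , 213 , 10) ∷ (229 , 43 , 7) ∷ (229 , 213 , 1) ∷ (43 , 10 , 16) ∷
   (213 , 74 , 16) ∷ (229 , 125 , 16) ∷ (213 , 97 , 2) ∷ (42 , 46 , 8) ∷ (162 , 10 , 73) ∷
   (43 , 73 , 1) ∷ []) ∷
  ((255 , 162 , 7) ∷ (162 , 331 , 10) ∷ (255 , 331 , 1) ∷ (214 , 10 , 8) ∷ (45 , 255 , 214) ∷
   (20 , 331 , 214) ∷ (255 , 125 , 73) ∷ (162 , 74 , 43) ∷ (10 , 332 , 39) ∷ (333 , 256 , 10) ∷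
   (333 , 43 , 6) ∷ (256 , 334 , 46) ∷ (43 , 334 , 42) ∷ (333 , 334 , 20) ∷ (43 , 256 , 39) ∷
   (256 , 162 , 2) ∷ []) ∷
  ((20 , 162 , 39) ∷ (332 , 74 , 6) ∷ (162 , 332 , 20) ∷ (162 , 97 , 6) ∷ (20 , 42 , 2) ∷
   (45 , 43 , 8) ∷ (213 , 73 , 7) ∷ (73 , 335 , 10) ∷ (213 , 335 , 1) ∷ (97 , 335 , 8) ∷
   (20 , 73 , 8) ∷ (43 , 20 , 2) ∷ (97 , 74 , 20) ∷ (46 , 144 , 46) ∷ (20 , 145 , 46) ∷
   (45 , 145 , 17) ∷ []) ∷
  ((254 , 144 , 20) ∷ (20 , 144 , 17) ∷ (177 , 27 , 10) ∷ (177 , 49 , 25) ∷ (27 , 71 , 14) ∷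
   (163 , 10 , 14) ∷ (163 , 20 , 5) ∷ (45 , 163 , 6) ∷ (1 , 72 , 5) ∷ (27 , 126 , 46) ∷
   (27 , 215 , 27) ∷ (126 , 215 , 5) ∷ (177 , 215 , 14) ∷ (177 , 226 , 1) ∷ (257 , 42 , 7) ∷
   (336 , 42 , 10) ∷ []) ∷
  ((42 , 337 , 10) ∷ (257 , 337 , 1) ∷ (42 , 338 , 46) ∷ (336 , 338 , 20) ∷ (257 , 97 , 8) ∷
   (338 , 144 , 8) ∷ (97 , 337 , 2) ∷ (336 , 144 , 25) ∷ (257 , 74 , 25) ∷ (226 , 215 , 42) ∷
   (0 , 131 , 27) ∷ (65 , 131 , 42) ∷ (131 , 215 , 23) ∷ (45 , 42 , 23) ∷ (55 , 230 , 7) ∷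
   (183 , 55 , 10) ∷ []) ∷
  ((183 , 230 , 1) ∷ (8 , 61 , 8) ∷ (63 , 339 , 61) ∷ (339 , 230 , 8) ∷ (183 , 339 , 2) ∷
   (63 , 27 , 8) ∷ (27 , 230 , 61) ∷ (14 , 183 , 61) ∷ (230 , 117 , 14) ∷ (55 , 49 , 27) ∷
   (231 , 6 , 7) ∷ (340 , 6 , 10) ∷ (125 , 231 , 8) ∷ (163 , 145 , 27) ∷ (341 , 6 , 14) ∷
   (341 , 340 , 27) ∷ []) ∷
  ((163 , 341 , 8) ∷ (340 , 144 , 2) ∷ (231 , 74 , 2) ∷ (54 , 120 , 7) ∷ (183 , 120 , 0) ∷
   (65 , 183 , 6) ∷ (0 , 206 , 232) ∷ (232 , 6 , 1) ∷ (65 , 55 , 232) ∷ (206 , 1 , 27) ∷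
   (183 , 54 , 45) ∷ (49 , 120 , 6) ∷ (55 , 120 , 17) ∷ (17 , 55 , 6) ∷ (20 , 46 , 1) ∷
   (75 , 145 , 7) ∷ []) ∷
  ((75 , 74 , 21) ∷ (45 , 97 , 21) ∷ (40 , 233 , 40) ∷ (40 , 49 , 46) ∷ (164 , 7 , 75) ∷
   (164 , 233 , 1) ∷ (43 , 231 , 45) ∷ (43 , 342 , 46) ∷ (43 , 46 , 23) ∷ (229 , 97 , 23) ∷
   (343 , 344 , 75) ∷ (344 , 231 , 1) ∷ (344 , 74 , 23) ∷ (343 , 342 , 1) ∷ (343 , 145 , 23) ∷
   (342 , 145 , 2) ∷ []) ∷
  ((229 , 182 , 2) ∷ (50 , 21 , 73) ∷ (50 , 116 , 43) ∷ (66 , 7 , 16) ∷ (28 , 165 , 7) ∷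
   (165 , 66 , 10) ∷ (165 , 106 , 2) ∷ (28 , 66 , 1) ∷ (50 , 36 , 66) ∷ (184 , 345 , 7) ∷
   (345 , 49 , 43) ∷ (345 , 164 , 73) ∷ (184 , 1 , 43) ∷ (184 , 36 , 73) ∷ (106 , 233 , 17) ∷
   (105 , 36 , 40) ∷ []) ∷
  ((75 , 10 , 1) ∷ (106 , 49 , 20) ∷ (118 , 57 , 7) ∷ (118 , 116 , 46) ∷ (57 , 49 , 40) ∷
   (105 , 118 , 10) ∷ (106 , 40 , 10) ∷ (65 , 40 , 21) ∷ (65 , 165 , 8) ∷ (165 , 13 , 45) ∷
   (7 , 127 , 61) ∷ (120 , 7 , 39) ∷ (86 , 13 , 39) ∷ (10 , 39 , 2) ∷ (1 , 120 , 13) ∷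
   (120 , 127 , 8) ∷ []) ∷
  ((1 , 86 , 61) ∷ (0 , 132 , 28) ∷ (132 , 1 , 39) ∷ (132 , 120 , 1) ∷ (86 , 120 , 2) ∷
   (132 , 86 , 8) ∷ (165 , 259 , 0) ∷ (165 , 49 , 16) ∷ (258 , 260 , 8) ∷ (0 , 50 , 39) ∷
   (50 , 1 , 28) ∷ (36 , 258 , 13) ∷ (36 , 29 , 39) ∷ (29 , 49 , 13) ∷ (50 , 29 , 17) ∷
   (50 , 17 , 13) ∷ []) ∷
  ((36 , 49 , 1) ∷ (260 , 259 , 39) ∷ (66 , 260 , 66) ∷ (49 , 259 , 8) ∷ (17 , 66 , 8) ∷
   (66 , 259 , 17) ∷ (165 , 260 , 28) ∷ (65 , 258 , 28) ∷ (17 , 258 , 66) ∷ (21 , 346 , 75) ∷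
   (118 , 346 , 20) ∷ (216 , 7 , 40) ∷ (118 , 216 , 1) ∷ (166 , 12 , 46) ∷ (347 , 12 , 40) ∷
   (218 , 217 , 7) ∷ []) ∷
  ((347 , 218 , 1) ∷ (218 , 216 , 2) ∷ (166 , 217 , 1) ∷ (217 , 107 , 2) ∷ (347 , 346 , 16) ∷
   (166 , 53 , 16) ∷ (28 , 12 , 20) ∷ (21 , 153 , 18) ∷ (105 , 153 , 16) ∷ (105 , 204 , 2) ∷
   (28 , 57 , 18) ∷ (12 , 53 , 18) ∷ (116 , 348 , 39) ∷ (167 , 116 , 73) ∷ (167 , 57 , 13) ∷
   (349 , 107 , 13) ∷ []) ∷
  ((349 , 53 , 73) ∷ (50 , 349 , 21) ∷ (348 , 53 , 13) ∷ (50 , 348 , 45) ∷ (167 , 53 , 28) ∷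
   (50 , 167 , 10) ∷ (0 , 167 , 214) ∷ (50 , 88 , 0) ∷ (1 , 88 , 39) ∷ (167 , 88 , 17) ∷
   (214 , 39 , 1) ∷ (45 , 214 , 16) ∷ (106 , 117 , 0) ∷ (57 , 7 , 17) ∷ (40 , 117 , 17) ∷
   (17 , 164 , 40) ∷ []) ∷
  ((0 , 36 , 17) ∷ (168 , 21 , 10) ∷ (168 , 36 , 1) ∷ (0 , 350 , 40) ∷ (17 , 216 , 75) ∷
   (218 , 13 , 40) ∷ (166 , 13 , 17) ∷ (169 , 13 , 21) ∷ (169 , 205 , 1) ∷ (217 , 185 , 170) ∷
   (40 , 234 , 8) ∷ (66 , 185 , 23) ∷ (66 , 234 , 1) ∷ (50 , 350 , 234) ∷ (67 , 40 , 13) ∷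
   (67 , 53 , 43) ∷ []) ∷
  ((67 , 49 , 66) ∷ (217 , 234 , 7) ∷ (118 , 218 , 8) ∷ (168 , 169 , 8) ∷ (218 , 107 , 170) ∷
   (169 , 164 , 170) ∷ (166 , 107 , 23) ∷ (169 , 49 , 23) ∷ (166 , 57 , 2) ∷ (12 , 235 , 10) ∷
   (169 , 12 , 10) ∷ (235 , 85 , 13) ∷ (205 , 127 , 12) ∷ (116 , 235 , 8) ∷ (12 , 13 , 1) ∷
   (166 , 40 , 170) ∷ []) ∷
  ((50 , 57 , 12) ∷ (167 , 36 , 234) ∷ (167 , 216 , 12) ∷ (57 , 217 , 8) ∷ (13 , 117 , 170) ∷
   (12 , 49 , 170) ∷ (13 , 7 , 2) ∷ (216 , 107 , 7) ∷ (118 , 36 , 185) ∷ (57 , 164 , 185) ∷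
   (168 , 350 , 7) ∷ (36 , 164 , 7) ∷ (49 , 233 , 7) ∷ (106 , 185 , 21) ∷ (40 , 185 , 1) ∷
   (107 , 117 , 40) ∷ []) ∷
  ((107 , 185 , 7) ∷ (261 , 233 , 0) ∷ (261 , 106 , 10) ∷ (261 , 40 , 75) ∷ (65 , 261 , 7) ∷
   (164 , 117 , 21) ∷ (182 , 74 , 0) ∷ (351 , 74 , 17) ∷ (166 , 85 , 28) ∷ (86 , 85 , 10) ∷
   (28 , 106 , 170) ∷ (169 , 235 , 75) ∷ (235 , 7 , 170) ∷ (169 , 36 , 2) ∷ (146 , 74 , 39) ∷
   (236 , 146 , 45) ∷ []) ∷
  ((236 , 20 , 39) ∷ (163 , 146 , 0) ∷ (186 , 74 , 219) ∷ (163 , 125 , 219) ∷ (236 , 10 , 219) ∷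
   (186 , 97 , 39) ∷ (236 , 186 , 10) ∷ (163 , 236 , 7) ∷ (125 , 146 , 13) ∷ (45 , 352 , 28) ∷
   (144 , 262 , 6) ∷ (186 , 262 , 17) ∷ (20 , 186 , 6) ∷ (45 , 354 , 232) ∷ (353 , 74 , 42) ∷
   (354 , 125 , 42) ∷ []) ∷
  ((186 , 10 , 42) ∷ (354 , 186 , 7) ∷ (232 , 10 , 2) ∷ (10 , 146 , 6) ∷ (20 , 262 , 28) ∷
   (146 , 262 , 7) ∷ (182 , 146 , 28) ∷ (351 , 353 , 13) ∷ (353 , 146 , 46) ∷ (75 , 352 , 13) ∷
   (352 , 146 , 10) ∷ (182 , 351 , 10) ∷ (57 , 40 , 7) ∷ (0 , 67 , 22) ∷ (50 , 263 , 20) ∷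
   (67 , 88 , 20) ∷ []) ∷
  ((0 , 22 , 16) ∷ (22 , 78 , 22) ∷ (67 , 78 , 16) ∷ (50 , 80 , 160) ∷ (0 , 263 , 219) ∷
   (17 , 88 , 219) ∷ (50 , 147 , 8) ∷ (219 , 20 , 8) ∷ (5 , 78 , 39) ∷ (147 , 88 , 16) ∷
   (28 , 147 , 39) ∷ (40 , 120 , 73) ∷ (67 , 1 , 73) ∷ (88 , 13 , 61) ∷ (78 , 7 , 61) ∷
   (80 , 78 , 21) ∷ []) ∷
  ((16 , 160 , 1) ∷ (160 , 2 , 20) ∷ (20 , 39 , 16) ∷ (263 , 88 , 1) ∷ (21 , 263 , 39) ∷
   (50 , 22 , 180) ∷ (147 , 53 , 130) ∷ (355 , 13 , 13) ∷ (237 , 11 , 0) ∷ (237 , 60 , 1) ∷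
   (237 , 16 , 8) ∷ (355 , 53 , 4) ∷ (355 , 88 , 2) ∷ (53 , 78 , 3) ∷ (147 , 1 , 180) ∷
   (180 , 2 , 16) ∷ []) ∷
  ((1 , 78 , 11) ∷ (88 , 78 , 2) ∷ (50 , 67 , 1) ∷ (133 , 22 , 73) ∷ (66 , 86 , 73) ∷
   (66 , 356 , 11) ∷ (67 , 356 , 1) ∷ (264 , 66 , 11) ∷ (28 , 264 , 61) ∷ (265 , 127 , 11) ∷
   (187 , 110 , 73) ∷ (187 , 78 , 28) ∷ (220 , 13 , 73) ∷ (110 , 5 , 13) ∷ (133 , 5 , 28) ∷
   (266 , 265 , 266) ∷ []) ∷
  ((220 , 127 , 266) ∷ (187 , 5 , 266) ∷ (220 , 356 , 2) ∷ (110 , 78 , 1) ∷ (50 , 110 , 16) ∷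
   (264 , 265 , 28) ∷ (86 , 265 , 61) ∷ (264 , 86 , 16) ∷ (28 , 67 , 11) ∷ (67 , 66 , 61) ∷
   (357 , 86 , 10) ∷ (36 , 357 , 61) ∷ (28 , 357 , 66) ∷ (133 , 17 , 61) ∷ (50 , 28 , 61) ∷
   (50 , 133 , 2) ∷ []) ∷
  ((133 , 67 , 8) ∷ (22 , 358 , 11) ∷ (133 , 358 , 16) ∷ (358 , 78 , 8) ∷ (359 , 61 , 0) ∷
   (0 , 110 , 237) ∷ (187 , 67 , 61) ∷ (110 , 360 , 11) ∷ (133 , 360 , 237) ∷ (187 , 360 , 16) ∷
   (110 , 1 , 61) ∷ (133 , 1 , 359) ∷ (359 , 8 , 16) ∷ (28 , 220 , 22) ∷ (0 , 147 , 142) ∷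
   (132 , 13 , 142) ∷ []) ∷
  ((221 , 5 , 22) ∷ (87 , 1 , 5) ∷ (221 , 1 , 142) ∷ (221 , 132 , 8) ∷ (87 , 132 , 7) ∷
   (142 , 35 , 1) ∷ (8 , 35 , 2) ∷ (147 , 220 , 1) ∷ (147 , 67 , 2) ∷ (67 , 220 , 8) ∷
   (50 , 187 , 11) ∷ (50 , 361 , 22) ∷ (361 , 78 , 180) ∷ (147 , 66 , 13) ∷ (187 , 361 , 8) ∷
   (0 , 133 , 11) ∷ []) ∷
  ((0 , 184 , 5) ∷ (66 , 363 , 3) ∷ (28 , 184 , 3) ∷ (184 , 363 , 1) ∷ (67 , 363 , 7) ∷
   (50 , 184 , 7) ∷ (17 , 362 , 11) ∷ (105 , 53 , 0) ∷ (116 , 110 , 3) ∷ (105 , 67 , 5) ∷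
   (133 , 362 , 1) ∷ (67 , 362 , 2) ∷ (67 , 7 , 28) ∷ (171 , 36 , 5) ∷ (171 , 1 , 22) ∷
   (76 , 36 , 27) ∷ []) ∷
  ((95 , 108 , 1) ∷ (27 , 30 , 42) ∷ (364 , 41 , 42) ∷ (22 , 41 , 23) ∷ (171 , 131 , 41) ∷
   (95 , 364 , 23) ∷ (108 , 364 , 2) ∷ (30 , 215 , 7) ∷ (76 , 108 , 23) ∷ (95 , 22 , 42) ∷
   (76 , 21 , 42) ∷ (76 , 95 , 2) ∷ (25 , 8 , 0) ∷ (80 , 36 , 61) ∷ (209 , 36 , 13) ∷
   (209 , 1 , 12) ∷ []) ∷
  ((209 , 80 , 2) ∷ (37 , 61 , 1) ∷ (37 , 8 , 2) ∷ (267 , 221 , 3) ∷ (267 , 87 , 39) ∷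
   (221 , 22 , 39) ∷ (171 , 21 , 39) ∷ (171 , 221 , 2) ∷ (267 , 54 , 22) ∷ (171 , 267 , 6) ∷
   (87 , 54 , 1) ∷ (54 , 53 , 39) ∷ (78 , 71 , 7) ∷ (171 , 54 , 21) ∷ (36 , 30 , 11) ∷
   (36 , 5 , 18) ∷ []) ∷
  ((178 , 30 , 8) ∷ (22 , 178 , 3) ∷ (148 , 36 , 8) ∷ (148 , 157 , 18) ∷ (80 , 22 , 6) ∷
   (171 , 29 , 157) ∷ (178 , 157 , 6) ∷ (148 , 178 , 11) ∷ (1 , 30 , 3) ∷ (22 , 5 , 1) ∷
   (30 , 78 , 10) ∷ (29 , 88 , 10) ∷ (148 , 30 , 22) ∷ (148 , 22 , 10) ∷ (65 , 126 , 16) ∷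
   (17 , 106 , 7) ∷ []) ∷
  ((148 , 126 , 1) ∷ (148 , 5 , 21) ∷ (0 , 168 , 46) ∷ (65 , 49 , 0) ∷ (105 , 17 , 7) ∷
   (120 , 154 , 3) ∷ (132 , 54 , 10) ∷ (36 , 132 , 6) ∷ (132 , 49 , 5) ∷ (30 , 154 , 13) ∷
   (80 , 110 , 10) ∷ (110 , 53 , 37) ∷ (268 , 37 , 8) ∷ (22 , 53 , 268) ∷ (110 , 88 , 8) ∷
   (22 , 88 , 142) ∷ []) ∷
  ((80 , 88 , 268) ∷ (268 , 142 , 2) ∷ (110 , 30 , 7) ∷ (30 , 49 , 61) ∷ (36 , 72 , 22) ∷
   (131 , 29 , 10) ∷ (168 , 131 , 5) ∷ (131 , 5 , 38) ∷ (131 , 30 , 18) ∷ (365 , 148 , 4) ∷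
   (168 , 148 , 2) ∷ (81 , 78 , 157) ∷ (29 , 78 , 18) ∷ (365 , 22 , 38) ∷ (365 , 29 , 21) ∷
   (168 , 81 , 38) ∷ []) ∷
  ((131 , 36 , 6) ∷ (131 , 72 , 21) ∷ (126 , 71 , 22) ∷ (366 , 72 , 10) ∷ (126 , 366 , 35) ∷
   (367 , 154 , 5) ∷ (36 , 367 , 4) ∷ (29 , 366 , 7) ∷ (81 , 367 , 7) ∷ (126 , 154 , 1) ∷
   (21 , 22 , 2) ∷ []) ∷
  []

-- Point 2 is a². If it has the colour of a³, the next point is a(a + b), which cannot share this
-- colour since a · a(a + b) = a · a² + b · a² (solution 0).
tree3 : Tree
tree3 =
  split 2
   (split 4
     (leaf 0)
     (split 44
       (split 3
         (leaf 1)
         (split 26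
           (leaf 2)
           (only₂ 89 3 4 (only₂ 33 5 6 (only₀ 9 82 83 (
            split 15
             (leaf 7)
             (only₂ 89 3 4 (only₂ 33 5 6 (only₀ 9 82 83 (only₂ 24 8 9 (only₀ 69 80 81 (
              split 11
               (only₂ 38 10 11 (
                split 90
                 (leaf 12)
                 (only₂ 98 13 14 (only₀ 39 22 23 (only₀ 51 20 21 (only₂ 99 15 16 (
                  none 31 17 18 19)))))
                 (only₁ 111 24 32 (only₂ 8 25 26 (only₀ 58 30 31 (none 79 27 28 29))))))
               (leaf 33)
               (split 70
                 (only₂ 100 34 35 (only₂ 134 36 37 (only₁ 6 38 63 (only₂ 82 39 40 (
                  split 83
                   (only₁ 62 41 49 (only₂ 10 42 43 (only₀ 101 47 48 (none 269 44 45 46))))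
                   (only₀ 101 61 48 (only₂ 188 50 51 (only₂ 38 52 11 (only₀ 18 59 60 (
                    only₀ 270 57 58 (only₁ 62 53 49 (none 222 54 55 56)))))))
                   (leaf 62))))))
                 (leaf 64)
                 (split 99
                   (only₁ 62 65 49 (only₂ 149 66 67 (only₀ 189 71 72 (none 188 68 69 70))))
                   (only₀ 189 78 72 (only₂ 18 73 74 (none 101 75 76 77)))
                   (leaf 79)))))))))
             (only₀ 51 20 87 (none 32 84 85 86))))))
           (split 9
             (only₂ 24 8 9 (
              split 15
               (leaf 7)
               (only₀ 70 64 90 (only₂ 33 5 88 (none 100 34 35 89)))
               (only₁ 135 91 96 (only₁ 19 92 95 (only₀ 100 94 35 (none 70 34 93 90))))))
             (leaf 82)
             (split 51
               (only₁ 19 97 102 (only₂ 91 98 99 (none 31 17 100 101)))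
               (leaf 20)
               (only₀ 32 85 84 (only₁ 56 103 120 (
                split 6
                 (leaf 104)
                 (only₂ 33 5 105 (only₀ 100 110 89 (only₁ 89 3 83 (only₂ 172 106 107 (
                  none 70 34 108 109)))))
                 (only₀ 190 118 119 (only₀ 136 116 117 (only₁ 173 111 115 (
                  none 121 112 113 114))))))))))
         (only₀ 32 85 148 (
          split 33
           (leaf 5)
           (only₂ 6 104 105 (
            split 82
             (only₁ 92 121 132 (only₂ 69 39 122 (
              split 89
               (leaf 3)
               (only₀ 15 126 80 (only₂ 9 7 83 (only₁ 56 103 120 (only₂ 100 35 110 (
                none 191 123 124 125)))))
               (only₀ 70 131 108 (only₁ 24 127 81 (only₁ 100 34 63 (only₂ 84 128 129 (
                none 56 103 110 130))))))))
             (split 9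
               (only₂ 19 92 133 (only₁ 31 134 100 (only₂ 15 7 18 (only₀ 134 138 37 (
                only₂ 52 135 136 (none 70 36 131 137))))))
               (leaf 139)
               (only₁ 56 103 120 (only₀ 136 116 142 (only₂ 19 140 133 (only₁ 121 112 114 (
                none 26 2 141 102))))))
             (leaf 40)))
           (only₁ 26 2 6 (only₂ 89 3 4 (
            split 9
             (only₁ 15 7 88 (only₀ 70 64 108 (only₂ 135 91 96 (none 100 34 35 94))))
             (only₂ 56 103 120 (only₀ 190 147 118 (only₁ 31 134 146 (only₂ 173 111 143 (
              none 6 104 144 145)))))
             (leaf 83)))))))
       (leaf 149)
       (split 32
         (split 3
           (leaf 1)
           (split 9
             (only₂ 51 84 20 (
              split 15
               (leaf 7)
               (only₂ 31 134 18 (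
                split 11
                 (only₂ 38 10 11 (only₁ 37 150 169 (
                  split 18
                   (leaf 151)
                   (only₀ 99 74 19 (none 98 152 153 21))
                   (split 98
                     (only₁ 99 152 19 (only₀ 271 161 162 (only₀ 174 159 160 (only₁ 150 154 158 (
                      none 122 155 156 157)))))
                     (only₀ 122 168 157 (only₂ 149 163 164 (none 272 165 166 167)))
                     (leaf 21)))))
                 (leaf 33)
                 (only₁ 16 170 208 (
                  split 112
                   (only₂ 25 171 172 (none 192 173 174 175))
                   (leaf 176)
                   (only₀ 137 206 207 (
                    split 6
                     (leaf 104)
                     (only₂ 59 177 178 (only₀ 25 172 200 (only₁ 60 179 199 (only₁ 193 180 198 (
                      split 102
                       (only₂ 21 181 182 (only₁ 113 183 191 (only₂ 22 184 185 (only₀ 273 189 190 (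
                        none 274 186 187 188)))))
                       (only₀ 275 195 196 (none 276 192 193 194))
                       (leaf 197))))))
                     (only₀ 103 204 205 (none 277 201 202 203))))))))
               (only₁ 31 134 210 (none 6 104 144 209))))
             (leaf 82)
             (only₀ 24 9 8 (
              split 6
               (leaf 104)
               (only₂ 33 211 105 (none 82 127 40 139))
               (split 70
                 (only₁ 56 212 120 (only₂ 100 34 110 (none 84 128 130 213)))
                 (only₂ 33 211 131 (only₀ 15 64 209 (only₁ 84 214 220 (only₂ 194 215 216 (
                  none 52 217 218 219)))))
                 (leaf 38)))))
           (split 68
             (only₁ 84 221 236 (
              split 6
               (leaf 104)
               (only₂ 31 134 144 (only₂ 194 222 223 (only₁ 15 224 210 (only₀ 70 64 216 (
                only₂ 100 34 35 (only₁ 238 225 234 (only₀ 278 232 233 (only₂ 191 226 227 (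
                only₀ 239 230 231 (only₂ 33 228 105 (none 52 229 218 136)))))))))))
               (only₁ 15 224 209 (only₀ 70 64 38 (only₂ 31 134 18 (only₂ 100 34 35 (
                only₀ 278 232 233 (only₁ 238 225 235 (none 191 226 227 125)))))))))
             (split 31
               (leaf 134)
               (only₂ 6 104 144 (only₀ 70 243 38 (only₀ 15 18 209 (only₁ 84 128 236 (
                only₂ 9 7 237 (only₂ 52 137 218 (only₁ 56 212 120 (only₀ 34 241 242 (
                none 240 238 239 240)))))))))
               (split 15
                 (only₁ 84 214 236 (only₂ 9 7 237 (only₀ 34 241 242 (only₀ 135 248 91 (
                  only₁ 151 244 247 (none 91 245 246 101))))))
                 (only₀ 151 256 247 (only₂ 103 249 204 (only₁ 34 244 255 (only₂ 223 250 251 (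
                  only₀ 51 253 254 (none 9 84 237 252))))))
                 (leaf 210)))
             (leaf 257)))
         (leaf 85)
         (only₁ 3 1 148 (
          split 9
           (only₁ 56 120 103 (
            split 26
             (leaf 258)
             (split 19
               (leaf 92)
               (only₁ 3 1 148 (only₁ 56 120 103 (
                split 15
                 (leaf 7)
                 (split 38
                   (only₂ 93 259 260 (only₂ 11 10 33 (only₁ 101 52 265 (only₀ 69 263 264 (
                    only₀ 98 262 13 (only₂ 99 152 76 (only₂ 83 261 61 (only₀ 33 6 79 (
                    none 82 139 133 62)))))))))
                   (leaf 11)
                   (split 62
                     (split 31
                       (only₂ 51 17 20 (only₂ 91 101 99 (only₁ 98 266 21 (only₀ 69 263 272 (
                        only₂ 18 53 153 (only₁ 279 267 271 (only₀ 90 14 270 (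
                        none 174 268 269 160))))))))
                       (leaf 100)
                       (only₁ 99 65 19 (only₂ 18 53 74 (only₀ 90 16 270 (only₁ 122 273 157 (
                        only₂ 11 12 33 (none 98 266 168 13)))))))
                     (only₀ 241 278 279 (only₂ 222 274 55 (only₀ 33 6 56 (only₂ 24 211 9 (
                      none 195 275 276 277)))))
                     (leaf 280)))
                 (only₀ 31 100 210 (only₀ 33 6 86 (only₂ 51 17 20 (none 89 83 4 87)))))))
               (only₀ 136 116 140 (only₂ 196 281 282 (only₂ 121 112 141 (only₂ 280 283 284 (
                only₁ 34 242 304 (only₀ 197 302 303 (only₀ 69 300 301 (only₂ 224 285 286 (
                only₁ 281 287 299 (only₂ 114 288 289 (only₁ 282 290 298 (only₂ 198 291 292 (
                only₀ 283 296 297 (none 284 293 294 295)))))))))))))))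
             (only₁ 15 7 307 (only₀ 172 305 306 (only₂ 100 106 110 (only₂ 70 109 64 (
              only₀ 33 88 89 (none 24 211 9 90))))))))
           (leaf 82)
           (only₁ 3 1 148 (only₀ 24 9 8 (only₀ 51 20 84 (only₁ 34 308 242 (
            split 19
             (leaf 97)
             (only₂ 91 98 99 (none 31 17 100 101))
             (only₀ 197 302 303 (only₁ 198 291 315 (only₂ 6 309 310 (only₀ 121 314 114 (
              none 199 311 312 313))))))))))))))
     (split 32
       (split 44
         (split 6
           (leaf 104)
           (split 9
             (split 15
               (leaf 7)
               (only₂ 51 84 316 (only₀ 103 204 321 (only₁ 3 1 20 (only₁ 68 317 253 (only₂ 33 5 88 (
                only₂ 89 3 318 (only₂ 151 249 256 (only₁ 26 2 4 (only₀ 91 320 246 (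
                only₂ 135 91 96 (none 69 272 80 319)))))))))))
               (only₁ 89 3 126 (only₁ 31 134 18 (only₀ 100 63 35 (only₀ 103 205 204 (
                only₂ 56 103 146 (only₂ 68 317 318 (only₁ 172 106 305 (none 135 91 322 248)))))))))
             (only₂ 56 103 120 (
              split 121
               (only₁ 136 112 116 (only₂ 26 2 117 (none 199 311 323 324)))
               (leaf 114)
               (only₁ 26 2 141 (only₀ 136 117 116 (only₀ 173 115 113 (only₂ 19 140 102 (
                only₂ 190 111 119 (only₀ 34 242 304 (only₁ 15 325 327 (
                none 240 238 326 239))))))))))
             (only₁ 56 103 120 (only₁ 3 1 82 (only₀ 190 118 147 (only₂ 173 111 145 (
              only₁ 26 2 143 (none 114 328 289 329)))))))
           (only₁ 33 5 105 (only₁ 31 134 144 (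
            split 3
             (leaf 1)
             (only₂ 26 2 6 (only₁ 89 3 4 (only₂ 56 103 146 (only₀ 9 83 120 (only₂ 15 7 88 (
              only₀ 70 108 64 (only₁ 135 91 96 (none 100 34 94 110))))))))
             (split 24
               (only₁ 82 127 40 (none 9 8 139 82))
               (split 9
                 (split 58
                   (only₂ 138 330 331 (only₁ 12 332 338 (only₀ 285 336 337 (
                    none 286 333 334 335))))
                   (leaf 339)
                   (split 16
                     (leaf 170)
                     (only₀ 11 208 343 (only₁ 18 151 342 (none 37 150 340 341)))
                     (only₁ 59 177 178 (only₀ 25 200 172 (only₂ 63 344 345 (only₁ 112 171 176 (
                      only₂ 287 346 347 (only₀ 200 351 352 (none 175 348 349 350)))))))))
                 (only₀ 82 139 40 (none 92 121 353 132))
                 (leaf 82))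
               (leaf 9))))))
         (split 31
           (leaf 134)
           (split 15
             (split 68
               (leaf 224)
               (only₂ 103 204 317 (only₂ 3 1 257 (only₁ 9 7 82 (only₀ 288 355 356 (
                none 34 354 242 255)))))
               (only₁ 9 7 237 (only₀ 135 91 248 (only₂ 91 245 101 (only₁ 6 104 360 (
                only₂ 103 204 205 (only₀ 56 120 359 (only₁ 26 307 358 (
                none 172 305 306 357)))))))))
             (leaf 210)
             (split 3
               (leaf 1)
               (split 68
                 (only₂ 84 221 236 (
                  split 70
                   (only₁ 100 34 35 (only₂ 238 225 235 (only₀ 278 233 232 (only₁ 191 226 227 (
                    only₀ 239 231 230 (only₂ 6 104 125 (only₁ 52 229 218 (
                    none 33 228 136 105))))))))
                   (only₂ 6 104 38 (none 194 222 216 223))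
                   (leaf 64)))
                 (leaf 257)
                 (only₀ 151 247 256 (only₁ 103 249 204 (only₂ 34 244 255 (only₁ 223 250 251 (
                  only₀ 51 254 253 (none 9 84 252 237)))))))
               (split 51
                 (only₁ 91 98 320 (none 9 84 101 82))
                 (split 123
                   (split 24
                     (only₁ 33 211 88 (only₂ 52 217 361 (only₂ 138 362 331 (only₀ 64 372 373 (
                      only₂ 104 363 364 (only₁ 47 365 371 (only₀ 225 369 370 (
                      none 93 366 367 368))))))))
                     (only₀ 9 8 82 (only₂ 34 242 308 (only₂ 58 374 339 (only₀ 104 364 382 (
                      only₂ 64 363 372 (only₂ 52 375 361 (only₁ 138 362 373 (only₀ 33 331 88 (
                      only₂ 23 376 377 (only₁ 89 83 126 (only₁ 82 139 381 (only₀ 69 81 80 (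
                      none 79 378 379 380)))))))))))))
                     (leaf 9))
                   (leaf 383)
                   (only₀ 64 372 388 (only₂ 104 363 364 (only₁ 47 365 371 (only₀ 52 361 375 (
                    only₀ 225 369 387 (none 176 384 385 386)))))))
                 (leaf 20))))
           (only₁ 6 104 144 (only₀ 15 209 18 (
            split 68
             (leaf 224)
             (only₂ 103 204 317 (only₂ 3 1 257 (only₁ 9 7 82 (only₀ 288 355 356 (
              none 34 354 242 255)))))
             (only₁ 9 7 237 (only₀ 70 38 243 (only₀ 135 91 248 (only₂ 56 212 120 (
              only₁ 100 35 110 (none 89 389 63 146))))))))))
         (leaf 149))
       (only₂ 3 1 148 (
        split 9
         (only₂ 3 1 148 (
          split 48
           (split 15
             (leaf 7)
             (only₂ 26 258 307 (only₀ 33 86 6 (only₁ 44 5 149 (only₁ 24 211 9 (only₁ 89 83 4 (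
              only₂ 19 92 95 (only₀ 51 87 20 (none 31 17 210 100))))))))
             (split 31
               (only₁ 51 17 20 (only₁ 91 101 320 (only₂ 104 390 364 (only₀ 69 272 80 (
                only₁ 5 391 398 (only₂ 289 392 393 (only₀ 176 397 386 (none 201 394 395 396))))))))
               (only₂ 64 399 372 (only₁ 5 391 410 (only₀ 94 408 409 (only₂ 124 400 401 (
                only₁ 201 402 407 (only₁ 104 390 406 (none 6 403 404 405)))))))
               (leaf 18)))
           (leaf 411)
           (split 35
             (split 11
               (only₁ 38 10 426 (only₁ 24 412 9 (only₀ 47 424 425 (only₁ 92 413 132 (
                only₂ 34 242 414 (only₀ 115 422 423 (only₂ 58 415 339 (only₁ 202 416 421 (
                only₀ 52 217 420 (none 290 417 418 419))))))))))
               (only₂ 37 427 150 (only₀ 242 431 432 (only₁ 58 428 341 (only₀ 24 339 9 (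
                only₁ 92 353 132 (only₀ 115 422 430 (none 47 429 413 425)))))))
               (leaf 433))
             (only₀ 152 445 446 (only₁ 124 434 444 (only₀ 47 443 425 (only₂ 203 435 436 (
              split 11
               (only₁ 38 10 426 (only₂ 291 437 438 (none 52 439 440 441)))
               (only₀ 24 412 9 (only₁ 44 8 149 (none 38 424 442 426)))
               (leaf 433))))))
             (leaf 447))))
         (only₀ 51 84 20 (
          split 31
           (leaf 17)
           (only₂ 91 98 101 (only₁ 19 97 99 (only₀ 151 449 246 (only₂ 223 250 448 (
            none 34 244 242 251)))))
           (only₁ 19 97 100 (only₀ 151 449 247 (only₂ 34 244 242 (only₁ 223 250 251 (
            none 103 249 252 255)))))))
         (leaf 82)))
       (leaf 85)))
   -- Here a² has the colour of a²(a - b). Point 5 is a²(a - b) - ab, which is then excluded from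
   -- this colour: multiplied by a, the difference ab becomes b · a² (solution 752).
   (split 5
     (split 7
       (split 10
         (split 17
           (leaf 450)
           (only₂ 105 451 452 (only₂ 20 453 454 (
            split 21
             (only₁ 116 455 477 (only₂ 53 456 457 (only₂ 153 458 459 (only₁ 57 460 476 (
              only₁ 8 461 475 (only₂ 14 462 463 (only₀ 204 473 474 (only₁ 45 464 472 (
              only₂ 18 465 466 (only₂ 27 467 468 (none 65 469 470 471)))))))))))
             (leaf 182)
             (only₁ 53 456 484 (only₂ 45 464 478 (only₁ 125 479 483 (none 74 480 481 482)))))))
           (only₁ 49 485 508 (only₂ 117 486 487 (only₂ 154 488 489 (only₁ 8 461 507 (
            only₂ 126 490 491 (only₁ 14 462 506 (only₀ 27 504 505 (only₂ 25 492 493 (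
            only₀ 13 502 503 (only₁ 226 494 501 (only₂ 205 495 496 (only₁ 23 497 500 (
            none 65 469 498 499))))))))))))))
         (only₂ 53 456 509 (only₀ 21 182 484 (only₂ 20 510 453 (only₂ 36 511 512 (
          only₁ 57 460 476 (only₁ 65 469 527 (only₂ 17 450 513 (only₀ 45 470 478 (
          only₀ 46 525 526 (only₂ 177 514 515 (only₂ 106 516 517 (only₂ 243 518 519 (
          only₂ 105 520 521 (only₁ 8 461 524 (only₀ 18 466 523 (only₁ 116 522 477 (
          only₂ 204 465 473 (none 153 458 459 474))))))))))))))))))
         (split 17
           (leaf 450)
           (only₀ 20 454 453 (only₂ 21 510 182 (only₂ 27 528 468 (only₂ 40 529 530 (
            only₁ 53 456 484 (only₁ 8 461 531 (only₀ 116 457 455 (only₂ 14 462 463 (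
            only₂ 153 458 475 (none 45 522 478 472))))))))))
           (only₁ 65 469 557 (
            split 21
             (only₁ 57 460 513 (only₁ 20 510 453 (only₂ 36 511 527 (only₂ 53 456 476 (
              only₀ 46 525 526 (only₀ 75 542 543 (only₂ 243 518 519 (only₂ 107 532 533 (
              only₁ 118 534 541 (only₀ 18 466 523 (only₁ 8 461 540 (only₀ 40 538 539 (
              only₂ 204 465 473 (none 292 535 536 537))))))))))))))
             (leaf 182)
             (only₁ 53 456 484 (only₀ 116 457 455 (only₂ 45 522 470 (
              split 14
               (leaf 462)
               (split 57
                 (only₂ 206 544 545 (only₀ 76 554 555 (only₁ 54 546 553 (only₂ 6 547 548 (
                  only₁ 8 461 552 (only₂ 22 549 550 (none 153 458 475 551)))))))
                 (only₀ 107 533 556 (only₀ 20 476 453 (only₂ 46 532 525 (none 105 477 521 520))))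
                 (leaf 513))
               (only₁ 8 461 463 (none 153 458 475 472))))))))))
       (leaf 558)
       (split 12
         (split 55
           (leaf 559)
           (split 14
             (leaf 462)
             (only₂ 25 560 493 (only₀ 37 576 577 (only₀ 27 504 492 (only₂ 77 561 562 (
              only₂ 293 563 564 (only₁ 294 565 575 (only₀ 42 573 574 (only₂ 108 566 567 (
              only₁ 295 568 572 (none 9 569 570 571))))))))))
             (split 3
               (split 85
                 (leaf 578)
                 (only₂ 25 560 579 (only₀ 37 583 577 (only₂ 77 561 562 (none 227 580 581 582))))
                 (split 42
                   (only₂ 108 566 567 (only₂ 77 584 562 (
                    split 13
                     (only₁ 127 585 599 (only₂ 86 586 587 (only₁ 28 588 598 (only₁ 139 589 597 (
                      only₀ 17 595 596 (only₂ 54 590 591 (none 16 592 593 594)))))))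
                     (only₀ 127 585 599 (only₀ 119 614 615 (only₁ 244 600 613 (only₂ 76 601 602 (
                      only₂ 296 603 604 (only₀ 8 502 612 (only₂ 28 605 606 (only₁ 297 607 611 (
                      none 155 608 609 610)))))))))
                     (leaf 616))))
                   (leaf 573)
                   (only₁ 80 617 635 (
                    split 25
                     (leaf 560)
                     (only₂ 60 618 179 (only₀ 178 628 629 (only₁ 79 619 627 (only₂ 37 620 621 (
                      only₀ 115 625 626 (none 298 622 623 624))))))
                     (only₀ 37 621 577 (only₁ 299 630 634 (none 207 631 632 633)))))))
               (leaf 1)
               (only₁ 85 578 636 (only₂ 25 560 579 (only₀ 37 583 577 (only₂ 77 561 562 (
                none 227 580 581 582)))))))
           (only₁ 14 462 659 (only₂ 25 560 493 (only₀ 27 504 492 (only₁ 85 578 579 (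
            only₀ 37 583 577 (only₂ 227 580 581 (only₁ 77 561 582 (
            split 139
             (only₂ 13 589 616 (only₁ 19 637 646 (only₀ 3 1 645 (only₂ 9 569 92 (
              only₂ 109 638 639 (only₀ 300 643 644 (none 193 640 641 642)))))))
             (leaf 647)
             (only₀ 76 554 658 (only₁ 47 648 657 (only₂ 301 649 650 (only₂ 71 651 652 (
              only₀ 3 1 656 (none 245 653 654 655)))))))))))))))
         (leaf 660)
         (split 29
           (only₂ 21 661 182 (only₂ 4 662 0 (only₁ 81 663 719 (
            split 35
             (only₂ 156 664 665 (only₁ 22 666 688 (only₀ 8 550 687 (only₂ 157 667 668 (
              only₁ 155 669 686 (only₁ 80 670 685 (only₀ 6 683 684 (only₂ 72 671 672 (
              only₂ 30 673 674 (only₁ 302 675 682 (only₁ 14 462 681 (only₂ 43 676 677 (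
              none 208 678 679 680)))))))))))))
             (leaf 689)
             (only₀ 158 717 718 (only₀ 87 715 716 (only₁ 23 690 714 (only₂ 47 691 692 (
              split 54
               (only₂ 3 590 1 (only₁ 71 651 710 (only₀ 30 708 709 (only₀ 72 706 707 (
                only₁ 8 693 687 (only₂ 22 694 550 (only₀ 156 665 688 (only₀ 109 704 705 (
                only₁ 9 695 82 (only₂ 34 696 242 (only₂ 303 697 698 (only₁ 179 699 703 (
                none 304 700 701 702)))))))))))))
               (only₀ 139 591 657 (none 8 711 712 687))
               (leaf 713))))))))))
           (split 6
             (only₂ 30 673 720 (only₁ 14 462 681 (only₂ 76 547 554 (only₀ 119 733 601 (
              only₂ 140 721 722 (
              split 25
               (only₁ 37 577 726 (only₀ 85 583 578 (none 13 723 724 725)))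
               (leaf 493)
               (only₀ 27 504 492 (only₁ 23 497 714 (only₂ 72 727 728 (only₂ 71 651 729 (
                only₁ 128 730 732 (only₀ 3 1 710 (none 245 653 731 655)))))))))))))
             (leaf 734)
             (only₀ 72 728 750 (only₀ 140 722 749 (only₁ 23 735 714 (only₂ 71 651 729 (
              only₀ 3 1 710 (only₁ 129 736 748 (only₀ 305 746 747 (only₂ 306 737 738 (
              only₁ 246 739 745 (only₂ 19 740 741 (none 13 742 743 744))))))))))))
           (leaf 751))))
     (leaf 752)
     (split 3
       (split 4
         (split 12
           (split 55
             (leaf 559)
             (split 85
               (leaf 578)
               (only₂ 25 560 579 (only₀ 37 583 577 (only₂ 77 561 562 (none 227 580 581 582))))
               (split 25
                 (leaf 560)
                 (only₂ 60 618 179 (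
                  split 95
                   (leaf 753)
                   (only₂ 54 754 755 (only₀ 7 558 546 (only₀ 8 758 759 (only₁ 71 710 651 (
                    only₂ 21 687 182 (only₁ 29 756 661 (none 23 714 729 757)))))))
                   (only₀ 14 493 772 (only₂ 76 760 602 (only₂ 108 761 567 (only₀ 42 573 566 (
                    only₁ 137 762 771 (only₂ 77 584 562 (only₁ 9 82 571 (only₀ 41 769 770 (
                    only₀ 307 767 768 (only₂ 63 763 764 (none 19 765 92 766)))))))))))))
                 (split 54
                   (leaf 754)
                   (split 6
                     (only₂ 76 547 602 (none 139 773 591 658))
                     (leaf 548)
                     (only₀ 158 780 781 (only₀ 20 778 779 (only₂ 21 510 182 (only₂ 108 774 567 (
                      only₁ 29 756 661 (only₀ 42 573 566 (none 209 775 776 777))))))))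
                   (only₀ 7 558 546 (only₁ 95 753 755 (only₁ 71 710 651 (only₀ 8 758 759 (
                    only₂ 21 687 182 (only₁ 29 756 661 (none 23 714 729 757))))))))))
             (only₁ 60 618 783 (only₂ 25 560 179 (only₁ 85 578 579 (only₀ 37 583 577 (
              only₂ 77 561 782 (none 227 580 581 582)))))))
           (leaf 660)
           (only₁ 9 82 569 (
            split 21
             (only₁ 308 784 786 (none 81 719 785 663))
             (leaf 182)
             (only₁ 9 82 569 (
              split 41
               (split 19
                 (only₁ 54 787 713 (only₂ 158 788 780 (only₀ 6 548 781 (only₀ 26 258 798 (
                  only₁ 29 789 661 (only₂ 30 790 720 (only₂ 109 791 792 (only₁ 179 793 699 (
                  only₀ 129 796 797 (only₁ 155 794 608 (none 71 748 795 651)))))))))))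
                 (leaf 92)
                 (only₁ 228 799 802 (none 30 790 800 801)))
               (leaf 769)
               (split 210
                 (only₁ 156 803 810 (only₀ 81 665 663 (only₂ 87 804 695 (only₁ 247 805 809 (
                  none 6 806 807 808)))))
                 (only₀ 247 814 809 (only₀ 309 812 813 (only₁ 81 805 663 (only₂ 87 811 715 (
                  only₀ 156 665 810 (none 6 807 806 808))))))
                 (leaf 815)))))))
         (leaf 0)
         (only₁ 32 148 85 (
          split 6
           (split 92
             (leaf 132)
             (only₂ 82 40 121 (only₀ 19 819 133 (only₂ 31 100 134 (only₀ 34 414 818 (
              split 9
               (leaf 242)
               (only₀ 15 7 18 (only₁ 134 37 138 (only₁ 44 209 149 (only₂ 51 316 84 (
                only₂ 24 95 353 (only₁ 103 255 321 (only₀ 84 816 129 (none 68 241 317 253))))))))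
               (only₀ 12 660 569 (only₁ 29 756 662 (only₂ 140 749 722 (none 30 801 720 817)))))))))
             (split 18
               (only₁ 64 820 410 (only₂ 23 821 822 (only₁ 79 823 824 (only₂ 82 40 379 (
                none 58 342 27 381)))))
               (leaf 466)
               (split 111
                 (only₁ 96 825 828 (none 8 26 826 827))
                 (split 11
                   (only₁ 96 829 828 (only₀ 8 826 827 (only₂ 310 830 831 (only₂ 311 832 833 (
                    only₁ 79 834 837 (none 115 835 625 836))))))
                   (leaf 24)
                   (only₁ 82 40 864 (only₀ 24 127 863 (only₁ 202 838 862 (only₂ 134 839 840 (
                    split 159
                     (only₁ 141 841 844 (none 102 842 843 197))
                     (only₀ 150 860 158 (only₁ 141 845 844 (only₂ 113 846 847 (only₀ 102 843 197 (
                      only₀ 58 859 343 (only₂ 312 848 849 (only₁ 38 850 858 (only₁ 248 851 857 (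
                      only₀ 101 52 48 (only₂ 313 852 853 (none 195 854 855 856)))))))))))
                     (leaf 861)))))))
                 (leaf 865))))
           (leaf 104)
           (only₁ 32 148 85 (only₀ 31 134 144 (
            split 18
             (only₁ 64 820 410 (only₂ 23 821 822 (only₀ 21 182 757 (
              split 47
               (only₂ 48 425 411 (none 211 866 867 868))
               (leaf 365)
               (only₀ 104 363 371 (
                split 19
                 (leaf 100)
                 (only₂ 151 247 449 (none 176 386 869 870))
                 (split 122
                   (leaf 157)
                   (only₀ 149 163 878 (only₂ 174 871 155 (only₀ 249 876 877 (only₂ 90 872 273 (
                    none 113 873 874 875)))))
                   (only₁ 83 59 887 (only₀ 314 885 886 (only₂ 62 879 41 (only₁ 141 880 884 (
                    only₀ 10 42 43 (none 90 881 882 883)))))))))))))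
             (leaf 466)
             (only₀ 48 411 912 (only₁ 8 888 827 (only₂ 11 433 25 (only₀ 96 826 828 (
              split 60
               (leaf 618)
               (only₀ 16 901 208 (only₂ 160 889 890 (only₂ 250 891 892 (only₁ 59 893 900 (
                only₂ 200 894 351 (only₂ 175 895 896 (only₁ 124 444 899 (
                none 94 897 400 898))))))))
               (only₁ 175 895 911 (only₀ 112 349 910 (only₂ 200 894 348 (only₁ 137 207 909 (
                only₁ 14 902 908 (only₂ 315 903 904 (none 316 905 906 907))))))))))))))))))
       (leaf 1)
       (split 4
         (only₁ 32 85 148 (
          split 18
           (only₁ 32 85 148 (only₁ 96 828 932 (only₂ 8 827 826 (only₀ 7 558 461 (
            split 6
             (only₂ 31 144 134 (none 48 912 411 888))
             (leaf 104)
             (split 35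
               (only₁ 317 913 917 (none 207 914 915 916))
               (leaf 918)
               (only₀ 318 930 931 (
                split 83
                 (leaf 919)
                 (only₀ 10 42 552 (only₂ 62 43 41 (none 159 920 921 922)))
                 (only₁ 251 923 929 (only₀ 102 927 928 (none 142 924 925 926)))))))))))
           (leaf 466)
           (split 48
             (only₁ 32 85 148 (
              split 38
               (leaf 426)
               (only₀ 23 937 821 (only₂ 93 933 259 (only₁ 44 149 936 (only₂ 35 447 442 (
                only₀ 33 5 935 (only₂ 6 105 104 (none 123 376 383 934)))))))
               (split 64
                 (split 94
                   (leaf 409)
                   (only₂ 152 446 938 (only₀ 41 942 943 (only₁ 24 939 863 (none 33 940 211 941))))
                   (split 93
                     (leaf 944)
                     (only₀ 15 260 953 (only₂ 31 18 134 (only₁ 35 447 952 (only₂ 152 446 445 (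
                      only₀ 211 950 951 (only₁ 319 945 949 (none 203 946 947 948)))))))
                     (only₁ 44 149 936 (only₀ 33 5 941 (only₀ 56 103 955 (only₂ 6 105 104 (
                      none 123 954 383 934)))))))
                 (only₀ 211 867 951 (none 23 868 822 821))
                 (leaf 820))))
             (leaf 411)
             (only₁ 130 956 975 (only₀ 6 104 912 (only₂ 31 144 134 (
              split 16
               (only₁ 11 208 433 (only₀ 8 25 888 (only₀ 37 150 340 (only₂ 143 957 958 (
                only₂ 180 959 960 (only₁ 43 676 969 (only₀ 212 967 968 (only₁ 320 961 966 (
                only₁ 321 962 965 (only₀ 24 964 863 (none 79 29 963 823)))))))))))
               (leaf 970)
               (only₁ 43 676 974 (only₀ 212 967 973 (none 160 971 972 889))))))))))
         (leaf 0)
         (split 6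
           (split 9
             (split 19
               (split 114
                 (leaf 976)
                 (only₂ 224 977 978 (only₁ 34 242 286 (only₂ 196 979 980 (none 26 102 981 282))))
                 (only₁ 26 102 289 (only₂ 199 313 324 (only₀ 44 2 149 (only₂ 56 120 982 (
                  only₁ 15 209 983 (only₀ 100 35 110 (none 84 213 214 130))))))))
               (only₀ 51 97 20 (only₀ 92 819 132 (only₁ 24 353 987 (only₂ 15 316 95 (
                only₂ 322 984 985 (only₀ 33 211 88 (none 82 139 127 986)))))))
               (only₁ 121 114 989 (only₁ 114 976 988 (only₀ 136 112 140 (only₂ 199 323 311 (
                only₁ 26 117 324 (none 34 242 981 312)))))))
             (split 44
               (only₂ 15 209 7 (only₁ 70 38 64 (only₀ 100 34 35 (only₀ 134 36 37 (only₁ 89 63 126 (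
                only₁ 24 839 987 (none 69 990 81 80)))))))
               (only₀ 24 8 987 (
                split 15
                 (only₁ 51 316 20 (only₀ 32 84 148 (only₂ 33 86 5 (none 26 307 258 6))))
                 (leaf 7)
                 (only₁ 134 839 37 (only₀ 89 3 126 (only₁ 100 63 35 (none 69 81 990 80))))))
               (leaf 149))
             (leaf 82))
           (only₀ 29 734 662 (only₀ 54 548 590 (only₀ 24 309 987 (only₀ 32 104 148 (
            only₂ 52 991 992 (
            split 59
             (leaf 177)
             (only₂ 14 993 994 (only₀ 112 1002 902 (only₀ 192 1000 1001 (only₁ 9 173 82 (
              split 15
               (only₁ 103 204 996 (only₂ 19 95 92 (none 31 995 205 100)))
               (leaf 7)
               (only₁ 31 995 18 (only₀ 323 998 999 (none 51 997 17 20))))))))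
             (only₁ 143 1003 1017 (
              split 92
               (only₁ 9 353 82 (only₂ 34 414 242 (none 324 1004 1005 1006)))
               (split 325
                 (only₂ 82 1007 121 (only₀ 322 984 986 (none 19 985 819 133)))
                 (leaf 1008)
                 (only₀ 16 957 1016 (
                  split 130
                   (only₁ 96 1009 932 (only₂ 48 975 1010 (none 11 208 829 433)))
                   (only₂ 208 1011 1012 (only₂ 11 208 958 (only₁ 77 594 1014 (only₀ 115 422 835 (
                    none 60 626 782 1013)))))
                   (leaf 1015))))
               (leaf 132)))))))))
           (split 30
             (split 14
               (leaf 681)
               (split 63
                 (only₁ 9 344 82 (only₂ 41 763 769 (
                  split 59
                   (only₁ 32 177 148 (only₁ 24 345 987 (only₀ 31 134 144 (only₀ 33 211 105 (
                    only₀ 82 127 40 (only₂ 25 200 493 (only₂ 52 136 217 (only₂ 34 818 242 (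
                    only₀ 326 1023 1024 (only₁ 327 1018 1022 (none 328 1019 1020 1021)))))))))))
                   (leaf 994)
                   (only₁ 119 1025 1038 (only₂ 95 1026 1027 (only₀ 27 504 1037 (
                    only₁ 129 1028 1036 (only₀ 179 796 793 (only₀ 128 1034 1035 (
                    only₁ 71 1029 651 (only₂ 47 1030 652 (none 329 1031 1032 1033))))))))))))
                 (leaf 1039)
                 (only₀ 25 493 1045 (only₁ 161 1040 1044 (none 181 1041 1042 1043))))
               (only₁ 161 1040 1053 (only₀ 181 1042 1052 (only₁ 109 1046 638 (only₂ 19 1047 639 (
                only₀ 228 1051 802 (only₁ 330 1048 1050 (none 9 800 1049 82))))))))
             (only₀ 71 708 651 (only₀ 29 720 662 (only₀ 109 1060 638 (only₂ 14 993 681 (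
              only₁ 128 1029 1059 (only₁ 181 1046 1052 (only₀ 161 1058 1053 (only₂ 8 704 1054 (
              only₂ 25 1055 1041 (only₀ 7 558 461 (only₀ 20 1057 779 (only₂ 12 751 660 (
              none 80 1056 674 617)))))))))))))
             (leaf 673))))))
   -- Here a² has the third colour. Point 7 is a(a - b)², kept from the colour of a²(a - b) by a ·
   -- a²(a - b) = a · a(a - b)² + b · a²(a - b) (solution 558).
   (split 7
     (split 10
       (split 45
         (leaf 464)
         (only₂ 125 479 483 (only₂ 20 453 1061 (
          split 144
           (leaf 1062)
           (only₂ 145 1063 1064 (only₀ 46 1117 1118 (
            split 97
             (leaf 1065)
             (only₀ 182 1076 1077 (only₂ 252 1066 1067 (only₀ 21 182 1075 (only₁ 253 1068 1074 (
              only₂ 254 1069 1070 (none 75 1071 1072 1073))))))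
             (only₁ 74 480 1116 (
              split 43
               (only₁ 213 1078 1084 (only₂ 229 1079 1080 (none 16 1081 1082 1083)))
               (split 8
                 (only₁ 42 1085 1108 (
                  split 162
                   (only₂ 73 1086 1087 (only₁ 255 1088 1094 (only₂ 331 1089 1090 (
                    none 214 1091 1092 1093))))
                   (leaf 1095)
                   (only₁ 6 552 1107 (only₀ 332 1105 1106 (only₁ 39 1096 1104 (
                    only₀ 256 1102 1103 (only₂ 333 1097 1098 (none 334 1099 1100 1101))))))))
                 (leaf 1109)
                 (only₀ 73 1087 1114 (only₁ 213 1110 1084 (none 335 1111 1112 1113))))
               (leaf 1115))))))
           (only₁ 17 450 1121 (only₂ 145 1063 1119 (only₂ 53 456 478 (only₀ 21 182 484 (
            only₁ 57 460 476 (only₀ 46 525 1117 (only₁ 254 1069 1120 (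
            none 253 1068 1070 1074)))))))))))
         (only₁ 125 479 483 (only₂ 74 480 481 (only₁ 20 453 482 (only₂ 17 450 454 (
          only₁ 49 485 508 (only₁ 145 1063 1119 (only₂ 117 486 487 (only₂ 144 1062 1064 (
          only₀ 46 1182 1117 (
          split 27
           (split 25
             (leaf 492)
             (only₂ 177 1122 1123 (
              split 14
               (only₁ 5 462 514 (only₂ 71 1124 651 (only₂ 163 1125 1126 (only₀ 72 1128 706 (
                none 6 750 779 1127)))))
               (leaf 493)
               (only₁ 126 1129 506 (only₁ 215 1130 1132 (only₀ 8 491 463 (none 5 461 1131 514))))))
             (only₁ 226 494 501 (only₂ 177 1122 1133 (only₁ 65 469 515 (only₂ 23 497 498 (
              split 42
               (only₁ 257 1134 1144 (only₁ 336 1135 1143 (only₂ 337 1136 1137 (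
                only₂ 338 1138 1139 (only₁ 97 1065 1142 (none 8 1085 1140 1141))))))
               (only₂ 215 1130 1145 (none 131 1146 1147 1148))
               (leaf 1149)))))))
           (split 55
             (only₂ 14 659 504 (only₁ 230 1150 1160 (only₂ 183 1151 1152 (only₀ 61 1158 1159 (
              only₁ 8 1153 463 (only₀ 63 1157 1039 (none 339 1154 1155 1156)))))))
             (leaf 1161)
             (split 6
               (only₁ 231 1162 1170 (only₁ 340 1163 1169 (only₂ 8 552 1164 (only₀ 14 504 463 (
                only₂ 163 1125 1165 (none 341 1166 1167 1168))))))
               (only₀ 120 1179 1180 (only₂ 54 1171 548 (only₁ 183 1172 1178 (only₀ 206 1177 553 (
                only₂ 65 469 1173 (none 232 1174 1175 1176))))))
               (leaf 1181)))
           (leaf 468))))))))))))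
       (only₂ 53 456 509 (only₀ 21 182 484 (only₂ 20 510 453 (only₂ 36 511 512 (only₁ 57 460 476 (
        only₀ 75 1216 543 (only₁ 65 469 527 (only₂ 17 450 513 (only₂ 145 1183 1063 (
        only₂ 74 1184 480 (only₁ 118 534 541 (only₀ 45 470 478 (only₀ 46 525 526 (
        only₂ 106 516 517 (only₁ 97 1185 1116 (only₂ 105 520 521 (only₂ 182 1071 1076 (
        only₁ 116 522 477 (only₀ 40 538 1215 (only₁ 233 1186 1214 (only₁ 49 1187 508 (
        only₂ 164 1188 1189 (
        split 43
         (only₁ 229 1079 1200 (only₁ 231 1190 1170 (only₁ 342 1191 1199 (only₂ 23 1192 1193 (
          only₀ 343 1197 1198 (none 344 1194 1195 1196))))))
         (split 73
           (only₂ 213 1110 1078 (only₂ 50 1201 1202 (only₀ 16 1081 1082 (only₁ 66 1203 1208 (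
            only₀ 28 1207 595 (none 165 1204 1205 1206))))))
           (leaf 1087)
           (only₀ 184 1212 1213 (none 345 1209 1210 1211)))
         (leaf 1115))))))))))))))))))))))))
       (split 17
         (leaf 450)
         (only₀ 20 454 453 (only₂ 21 510 182 (only₂ 40 529 530 (only₁ 53 456 484 (
          only₁ 65 469 1223 (only₀ 116 457 455 (only₀ 106 517 1222 (only₂ 105 477 452 (
          only₂ 49 1217 508 (only₀ 118 541 1221 (only₁ 57 1218 1220 (
          none 46 1219 525 520))))))))))))
         (only₁ 65 469 557 (
          split 28
           (split 8
             (leaf 605)
             (only₂ 13 588 502 (only₂ 165 1204 1224 (only₀ 106 517 1206 (none 45 516 470 1225))))
             (split 86
               (leaf 598)
               (only₀ 61 1232 1153 (only₂ 127 1226 587 (only₁ 13 588 585 (only₀ 120 1230 1231 (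
                none 39 1227 1228 1229)))))
               (only₁ 132 1233 1237 (only₀ 120 1235 1236 (none 39 1227 1234 1229)))))
           (only₁ 65 469 557 (
            split 16
             (only₂ 66 1203 1207 (only₀ 258 1255 1256 (
              split 165
               (only₁ 259 1238 1253 (only₁ 49 1239 508 (only₀ 8 1251 1252 (only₁ 260 1240 1250 (
                only₀ 39 1249 1229 (only₂ 50 1241 1242 (only₀ 36 1248 1208 (only₁ 13 1243 1247 (
                none 29 1244 1245 1246)))))))))
               (only₀ 8 1224 1252 (none 260 1240 1254 1250))
               (leaf 1205))))
             (leaf 593)
             (split 21
               (only₁ 57 460 513 (only₁ 20 510 453 (only₂ 36 511 527 (only₂ 53 456 476 (
                only₀ 46 525 526 (only₀ 75 542 543 (only₂ 107 532 533 (only₂ 105 520 521 (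
                only₁ 118 534 541 (only₀ 40 538 539 (only₂ 346 1257 1258 (only₂ 216 1259 1260 (
                split 12
                 (only₁ 166 1261 1269 (only₁ 347 1262 1268 (only₀ 217 1266 1267 (
                  none 218 1263 1264 1265))))
                 (leaf 1270)
                 (only₀ 18 1274 1275 (only₁ 204 465 1273 (none 153 1271 474 1272))))))))))))))))
               (leaf 182)
               (only₁ 53 456 484 (only₀ 116 457 455 (only₂ 45 522 470 (
                split 39
                 (only₂ 50 1241 1242 (only₀ 167 1284 1285 (only₁ 348 1276 1283 (
                  only₁ 73 1277 1201 (only₀ 13 1282 1247 (only₀ 349 1280 1281 (only₁ 57 1278 513 (
                  none 107 1279 533 556))))))))
                 (only₀ 214 1290 1291 (only₂ 167 1286 1284 (only₀ 50 1242 1285 (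
                  none 88 1287 1288 1289))))
                 (leaf 1229))))))))
           (leaf 595)))))
     (leaf 558)
     (split 21
       (only₁ 53 484 456 (
        split 57
         (leaf 460)
         (only₂ 20 510 476 (only₀ 10 509 453 (only₂ 105 451 521 (none 116 455 457 477))))
         (split 116
           (only₂ 10 455 509 (only₁ 20 510 453 (only₀ 17 454 1293 (only₂ 45 522 1061 (
            only₁ 49 508 485 (only₀ 117 487 486 (none 106 1292 1217 516)))))))
           (leaf 457)
           (only₁ 53 484 456 (
            split 40
             (split 17
               (only₁ 117 1294 486 (only₂ 49 508 487 (only₁ 233 1186 1340 (only₀ 10 509 485 (
                only₂ 164 1295 1189 (only₁ 36 1296 1339 (only₂ 168 1297 1298 (only₀ 75 543 1188 (
                only₁ 350 1299 1338 (only₁ 118 534 1218 (only₂ 216 1300 1260 (only₀ 185 1336 1337 (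
                only₁ 107 556 1335 (
                split 13
                 (only₁ 218 1301 1265 (only₁ 166 1302 1320 (only₁ 205 495 496 (
                  only₂ 169 1303 1304 (only₀ 23 1318 1319 (only₀ 170 1316 1317 (only₀ 8 1314 1315 (
                  only₂ 217 1305 1266 (only₁ 234 1306 1313 (only₂ 66 1307 1308 (
                  only₂ 50 1247 1309 (only₀ 16 1269 1203 (only₁ 67 1310 1312 (
                  none 43 1081 1311 1202))))))))))))))
                 (split 12
                   (only₂ 8 687 502 (only₁ 235 1321 1325 (only₁ 169 1322 1315 (only₂ 85 578 1323 (
                    only₀ 205 1304 496 (none 127 1324 585 599))))))
                   (leaf 1326)
                   (only₀ 170 1332 1333 (only₁ 166 1327 1320 (only₂ 217 1305 1266 (
                    only₀ 8 502 1331 (only₁ 234 1306 1313 (only₀ 167 1329 1330 (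
                    none 50 1285 1309 1328))))))))
                 (leaf 1334)))))))))))))))
               (only₂ 20 510 454 (only₀ 10 509 453 (none 105 451 452 477)))
               (leaf 1293))
             (only₀ 118 538 1218 (only₀ 17 530 1293 (
              split 10
               (split 65
                 (leaf 557)
                 (only₂ 45 464 470 (only₀ 106 517 516 (only₁ 117 1292 486 (only₂ 185 1341 1342 (
                  none 107 556 1343 1344)))))
                 (only₁ 75 534 542 (only₂ 36 1296 543 (only₀ 261 1347 1348 (only₁ 20 510 527 (
                  only₂ 233 1345 1186 (only₂ 45 464 1061 (only₁ 49 508 1340 (
                  none 106 1346 1217 516)))))))))
               (leaf 509)
               (only₁ 20 510 453 (only₁ 49 508 485 (only₂ 36 1296 1248 (only₀ 117 487 486 (
                only₂ 106 1292 1217 (only₁ 164 1349 1339 (only₀ 45 1061 516 (only₁ 125 483 479 (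
                only₁ 145 1119 1063 (only₀ 74 481 480 (only₀ 144 1064 1062 (only₂ 182 1350 1077 (
                only₂ 46 1117 1182 (only₁ 351 1351 1387 (only₁ 97 1185 1065 (only₁ 75 534 1071 (
                split 13
                 (only₁ 169 1303 1357 (only₁ 166 1302 1320 (only₂ 170 1332 1317 (
                  only₀ 235 1355 1356 (only₁ 28 588 1354 (only₂ 50 1247 1242 (only₂ 85 1323 1352 (
                  only₀ 12 1270 1328 (none 86 586 598 1353)))))))))
                 (split 146
                   (only₁ 39 1358 1229 (only₂ 236 1359 1360 (only₁ 163 1361 1367 (
                    only₀ 186 1365 1366 (none 219 1362 1363 1364)))))
                   (leaf 1368)
                   (only₀ 352 1385 1386 (only₀ 353 1383 1384 (only₁ 28 1369 1382 (
                    only₀ 262 1380 1381 (only₁ 6 1370 1379 (only₀ 232 1175 1378 (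
                    only₂ 186 1371 1372 (only₁ 354 1373 1377 (none 42 1374 1375 1376))))))))))
                 (leaf 1334)))))))))))))))))))))
             (leaf 1388))))))
       (leaf 182)
       (split 22
         (split 67
           (leaf 1389)
           (split 50
             (split 88
               (leaf 1287)
               (only₂ 39 1241 1288 (only₀ 263 1411 1412 (only₂ 20 1390 1391 (only₁ 16 1392 1410 (
                only₀ 160 1408 1409 (only₂ 78 1393 1394 (only₁ 80 1395 1407 (
                split 13
                 (only₂ 28 588 593 (only₁ 17 1247 595 (only₀ 147 1401 1402 (only₂ 219 1396 1397 (
                  only₀ 5 592 1400 (only₁ 8 1398 1399 (only₂ 30 694 674 (
                  none 14 462 463 681))))))))
                 (only₀ 120 1230 1227 (only₀ 40 1310 529 (only₀ 61 1405 1406 (only₂ 73 1403 1404 (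
                  none 8 1153 502 1114)))))
                 (leaf 1334)))))))))
               (only₁ 78 1393 1425 (only₂ 16 1392 1394 (only₀ 11 1424 208 (only₁ 180 1413 1423 (
                only₀ 147 1422 1401 (only₀ 130 960 970 (only₁ 4 956 0 (only₁ 53 1414 456 (
                only₀ 3 1421 1 (only₀ 355 1419 1420 (only₁ 60 618 901 (only₁ 13 1415 1334 (
                only₂ 237 1416 1417 (none 8 1398 502 1418)))))))))))))))
             (leaf 1426)
             (only₀ 73 1404 1201 (only₁ 133 1427 1455 (
              split 8
               (only₀ 73 1404 1201 (only₁ 133 1427 1455 (
                split 28
                 (leaf 605)
                 (only₂ 16 1392 593 (only₀ 11 1448 208 (only₀ 66 1207 1203 (only₂ 86 1428 598 (
                  only₂ 356 1429 1430 (only₁ 264 1431 1447 (only₂ 61 1153 1432 (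
                  only₁ 78 1393 1406 (only₀ 265 1445 1446 (only₀ 110 1443 1444 (
                  only₁ 127 1433 1226 (only₂ 187 1434 1435 (only₀ 13 585 1334 (
                  only₁ 220 1436 1442 (only₂ 5 1437 1438 (none 266 1439 1440 1441))))))))))))))))
                 (only₁ 61 1153 1454 (only₀ 86 1232 598 (only₀ 17 1453 595 (only₂ 66 1428 1449 (
                  only₁ 36 1296 511 (only₂ 49 508 1248 (only₀ 357 1451 1452 (
                  none 10 1450 512 485)))))))))))
               (leaf 1456)
               (split 16
                 (leaf 1392)
                 (only₀ 11 208 25 (only₂ 78 1393 1394 (none 358 1457 1458 1459)))
                 (only₀ 359 1467 1468 (only₁ 61 1460 1153 (only₀ 110 1466 1444 (
                  only₁ 237 1461 1418 (only₂ 187 1434 1462 (only₀ 60 1417 901 (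
                  only₀ 360 1464 1465 (only₁ 3 618 1 (none 11 1463 33 25))))))))))))))
           (split 28
             (only₁ 13 588 1334 (only₂ 8 605 502 (only₀ 12 1326 687 (only₁ 220 1469 1481 (
              only₀ 147 1479 1480 (only₁ 142 1470 926 (only₀ 35 1477 1478 (only₂ 132 1233 1471 (
              only₁ 87 716 1476 (only₀ 221 1474 1475 (none 5 1472 1473 461)))))))))))
             (only₂ 16 1392 593 (only₀ 66 1207 1203 (only₁ 78 1393 1394 (only₀ 11 1424 208 (
              split 50
               (only₁ 180 1413 1423 (only₂ 187 1482 1435 (only₀ 147 1422 1480 (
                only₂ 361 1483 1484 (only₁ 13 1485 1334 (none 8 1398 502 1486))))))
               (leaf 1242)
               (only₁ 133 1487 1455 (only₀ 110 1443 1444 (only₀ 362 1498 1499 (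
                split 5
                 (only₁ 184 1488 1493 (only₀ 363 1491 1492 (none 3 1489 1490 1)))
                 (leaf 1438)
                 (only₁ 17 1494 592 (only₀ 105 452 1497 (only₁ 53 1495 456 (only₂ 10 451 509 (
                  only₀ 3 1421 1 (none 116 1496 457 455)))))))))))))))
             (leaf 1500)))
         (split 36
           (split 5
             (only₂ 171 1501 1502 (
              split 14
               (leaf 462)
               (split 27
                 (only₂ 76 1503 554 (only₁ 95 1037 1515 (only₀ 42 1513 1514 (only₂ 108 566 1504 (
                  only₂ 30 1505 681 (only₁ 23 497 1512 (only₁ 215 1130 1511 (only₀ 364 1509 1510 (
                  only₂ 131 1146 1148 (none 41 1506 1507 1508))))))))))
                 (leaf 504)
                 (only₀ 25 493 492 (only₂ 8 1516 550 (only₁ 37 577 1522 (only₁ 12 560 687 (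
                  only₀ 61 1521 1153 (only₀ 13 1326 1334 (only₂ 80 1517 621 (
                  none 209 1518 1519 1520)))))))))
               (split 3
                 (only₁ 54 590 1533 (
                  split 30
                   (only₂ 6 673 548 (only₀ 87 1530 808 (only₀ 267 1528 1529 (only₁ 221 1523 1527 (
                    none 39 1524 1525 1526)))))
                   (only₂ 71 651 708 (only₀ 78 1393 1532 (only₁ 39 1400 1526 (
                    none 53 1421 1531 456))))
                   (leaf 681)))
                 (only₀ 30 1544 681 (only₂ 11 1534 33 (only₁ 18 1535 151 (only₀ 8 550 25 (
                  only₂ 178 1536 1537 (only₁ 148 1538 1543 (only₂ 157 667 1539 (only₁ 6 673 1542 (
                  only₀ 29 734 1541 (none 80 670 1540 628))))))))))
                 (leaf 1))))
             (leaf 1545)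
             (only₀ 8 550 461 (only₁ 148 1538 1553 (
              split 10
               (split 6
                 (leaf 552)
                 (only₀ 54 548 546 (none 81 712 683 663))
                 (only₀ 30 1548 673 (only₁ 72 693 750 (only₂ 78 1546 1393 (only₀ 29 728 661 (
                  only₁ 39 1244 1400 (none 88 1547 1288 1425)))))))
               (leaf 1549)
               (only₀ 126 1552 490 (only₁ 49 491 485 (only₂ 17 1296 508 (only₀ 117 487 486 (
                only₁ 28 605 595 (only₁ 106 1292 1551 (only₀ 16 593 592 (
                none 65 1550 517 557))))))))))))
           (split 49
             (split 17
               (leaf 508)
               (split 46
                 (only₂ 168 1554 1298 (only₂ 40 1187 530 (only₀ 10 512 1297 (
                  none 20 453 454 529))))
                 (leaf 526)
                 (only₀ 105 452 520 (only₁ 53 1495 456 (only₂ 10 451 512 (only₀ 20 454 453 (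
                  none 116 477 457 455))))))
               (split 10
                 (only₁ 105 451 1556 (only₀ 57 521 1293 (only₂ 40 1220 1215 (only₁ 20 453 529 (
                  none 65 1555 527 1223)))))
                 (leaf 512)
                 (only₁ 65 1555 557 (only₀ 106 517 1551 (none 20 1217 527 453)))))
             (leaf 1248)
             (only₀ 10 512 485 (
              split 8
               (split 72
                 (split 30
                   (leaf 693)
                   (only₀ 3 1544 1 (only₁ 13 742 1334 (only₀ 154 1561 489 (only₂ 120 1557 1230 (
                    only₁ 6 552 1179 (only₀ 54 548 1171 (only₂ 132 1558 1559 (
                    none 5 590 1545 1560))))))))
                   (only₁ 61 1153 1571 (only₀ 110 1466 1570 (only₀ 37 1521 726 (
                    only₂ 80 1562 1517 (only₁ 53 1563 456 (only₂ 268 1564 1565 (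
                    only₁ 142 926 1569 (none 88 1566 1567 1568)))))))))
                 (leaf 1572)
                 (only₁ 6 552 750 (only₀ 131 1584 1585 (only₂ 29 1573 734 (only₀ 5 1545 661 (
                  only₂ 81 663 683 (only₁ 71 651 706 (only₂ 168 1574 1298 (only₀ 30 708 720 (
                  only₁ 38 1575 1583 (only₂ 78 1546 1393 (only₀ 4 11 0 (only₀ 365 1581 1582 (
                  only₁ 18 1576 1580 (only₁ 157 667 1579 (none 148 1577 1539 1578))))))))))))))))
               (leaf 550)
               (only₀ 5 1545 461 (only₁ 126 490 491 (only₀ 154 1593 489 (only₂ 71 651 1586 (
                only₀ 72 1572 706 (only₁ 35 671 1478 (only₂ 81 663 689 (only₂ 366 1587 1588 (
                only₁ 367 1589 1592 (only₀ 29 666 1591 (none 4 662 1590 0))))))))))))))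
           (leaf 511))
         (leaf 1594))))

certificate3 : Certificate 2
certificate3 = record
  { α = (3 ∷ 1 ∷ []) ∷ (1 ∷ []) ∷ [] ; β = (1 ∷ 1 ∷ []) ∷ [] ; N = cubic 27 27 9 1 27 18 3 9 3 1
  ; points = points3 ; solutions = solutions3
  -- Points 0 and 1 are a³ and a²(a - b). They have different colours because a · a³ = a · a²(a - b)
  -- + b · a³.
  ; p₀ = 0 ; p₁ = 1 ; s₀ = (0 , 1 , 0) ; tree = tree3
  }

-- Equations over ℕ and lower bounds

eqB⁺ : ∀ a b x y z → a * x ≡ a * y + b * z → eqB (+ a) (+ b) (+ x) (+ y) (+ z)
eqB⁺ a b x y z e = begin
  + a ℤ.* (+ x ℤ.- + y)                   ≡⟨ ℤ.*-distribˡ-+ (+ a) (+ x) (ℤ.- (+ y)) ⟩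
  + a ℤ.* + x ℤ.+ + a ℤ.* (ℤ.- (+ y))     ≡⟨ cong₂ ℤ._+_ (sym (ℤ.pos-* a x)) (sym (ℤ.neg-distribʳ-* (+ a) (+ y))) ⟩
  + (a * x) ℤ.- + a ℤ.* + y               ≡⟨ cong₂ (λ u v → + u ℤ.- v) e (sym (ℤ.pos-* a y)) ⟩
  + (a * y + b * z) ℤ.- + (a * y)         ≡⟨ cong (λ v → v ℤ.- + (a * y)) (ℤ.+-comm (+ (a * y)) (+ (b * z))) ⟩
  + (b * z) ℤ.+ + (a * y) ℤ.- + (a * y)   ≡⟨ ℤ.+-assoc (+ (b * z)) (+ (a * y)) (ℤ.- (+ (a * y))) ⟩
  + (b * z) ℤ.+ (+ (a * y) ℤ.- + (a * y)) ≡⟨ cong (λ v → + (b * z) ℤ.+ v) (ℤ.+-inverseʳ (+ (a * y))) ⟩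
  + (b * z) ℤ.+ + 0                       ≡⟨ ℤ.+-identityʳ _ ⟩
  + (b * z)                               ≡⟨ ℤ.pos-* b z ⟩
  + b ℤ.* + z                             ∎
  where open ≡-Reasoning

eqB⁻ : ∀ a b x y z → eqB (+ a) (+ b) (+ x) (+ y) (+ z) → a * x ≡ a * y + b * z
eqB⁻ a b x y z e = ℤ.+-injective (begin
  + (a * x)                               ≡⟨ ℤ.pos-* a x ⟩
  -- Expanding x as y + (x - y) lets distributivity produce the left-hand side of the hypothesis.
  + a ℤ.* + x                             ≡⟨ cong (λ v → + a ℤ.* v) (sym y+[x-y]) ⟩
  + a ℤ.* (+ y ℤ.+ (+ x ℤ.- + y))         ≡⟨ ℤ.*-distribˡ-+ (+ a) (+ y) _ ⟩
  + a ℤ.* + y ℤ.+ + a ℤ.* (+ x ℤ.- + y)   ≡⟨ cong (λ v → + a ℤ.* + y ℤ.+ v) e ⟩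
  + a ℤ.* + y ℤ.+ + b ℤ.* + z             ≡⟨ cong₂ ℤ._+_ (sym (ℤ.pos-* a y)) (sym (ℤ.pos-* b z)) ⟩
  + (a * y + b * z)                       ∎)
  where
  open ≡-Reasoning
  y+[x-y] : + y ℤ.+ (+ x ℤ.- + y) ≡ + x
  y+[x-y] = trans (ℤ.+-comm (+ y) (+ x ℤ.- + y)) (trans (ℤ.+-assoc (+ x) (ℤ.- (+ y)) (+ y))
            (trans (cong (λ v → + x ℤ.+ v) (ℤ.+-inverseˡ (+ y))) (ℤ.+-identityʳ (+ x))))

-- The equation of (1) is that of the other parts with a = 1; keeping the factor 1 lets all three
-- share `LinearSol` and `Avoids`.
eqA⁺ : ∀ c x y z → 1 * x ≡ 1 * y + c * z → eqA (+ c) (+ x) (+ y) (+ z)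
eqA⁺ c x y z e = trans (sym (ℤ.*-identityˡ (+ x ℤ.- + y))) (eqB⁺ 1 c x y z e)

eqA⁻ : ∀ c x y z → eqA (+ c) (+ x) (+ y) (+ z) → 1 * x ≡ 1 * y + c * z
eqA⁻ c x y z e = eqB⁻ 1 c x y z (trans (ℤ.*-identityˡ (+ x ℤ.- + y)) e)

-- Rado numbers from an upper bound and a colouring

-- A colouring is given as a relation whose constructors state why a number has its colour, so that
-- `no-sol` can match on the reasons for x, y and z; `classify` turns it into a function. One
-- colouring of all numbers serves every m < N.
record Avoids (a b N : ℕ) (C : ℕ → Fin 3 → Set) : Set where
  field
    classify : ∀ x → ∃ (C x)
    no-sol   : ∀ {x y z k} → 1 ≤ y → 1 ≤ z → x < N → z < N → C x k → C y k → C z k →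
               a * x ≡ a * y + b * z → ⊥

isRado : ∀ E {a b N C} →
         (∀ x y z → E (+ x) (+ y) (+ z) → a * x ≡ a * y + b * z) →
         (∀ x y z → a * x ≡ a * y + b * z → E (+ x) (+ y) (+ z)) →
         1 ≤ N → (∀ c → LinearSol a b N c) → Avoids a b N C → IsRadoNumber E 3 N
isRado E {a} {b} {N} {C} E⁻ E⁺ 1≤N upper lower = 1≤N , has , hasn't
  where
  open Avoids lower
  has : RadoProp E 3 N
  has c with upper c
  ... | x , y , z , rx , ry , rz , cxy , cyz , e = x , y , z , rx , ry , rz , cxy , cyz , E⁺ x y z e
  hasn't : ∀ m → 1 ≤ m → m < N → ¬ RadoProp E 3 m
  hasn't m _ m<N rado with rado (proj₁ ∘ classify)
  ... | x , y , z , (_ , x≤m) , (1≤y , _) , (1≤z , z≤m) , cxy , cyz , e =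
    no-sol 1≤y 1≤z (≤-<-trans x≤m m<N) (≤-<-trans z≤m m<N)
      -- The classes of x and y are transported to the colour of z, so that the three share one
      -- index.
      (subst (C x) (trans cxy cyz) (proj₂ (classify x)))
      (subst (C y) cyz (proj₂ (classify y)))
      (proj₂ (classify z)) (E⁻ x y z e)

-- Lower bound for (3): colouring by the exponent of a

module Valuation (a b : ℕ) .{{_ : NonZero a}} (coprime : Coprime a b) where

  -- Since b is coprime to a, the powers of a can be extracted one at a time: once z = q a^k,
  -- cancelling a^k from the next hypothesis leaves a ∣ b q, hence a ∣ q.
  power-divides : ∀ k z → a ^ k ∣ b * z → a ^ k ∣ z
  power-divides zero    z _ = 1∣ z
  power-divides (suc k) z h with power-divides k z (∣-trans (n∣m*n a) h)
  ... | divides q refl = *-monoˡ-∣ (a ^ k) (coprime-divisor coprime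
          (*-cancelʳ-∣ (a ^ k) {{m^n≢0 a k}} (subst (a ^ suc k ∣_) (sym (*-assoc b q (a ^ k))) h)))

  -- Modulo a^(k+1) both a x and a y vanish, so b z does too. In a solution the exponent of z thus
  -- exceeds the smaller of the exponents of x and y, which rules out equal exponents.
  raise : ∀ k {x y z} → a ^ k ∣ x → a ^ k ∣ y → a * x ≡ a * y + b * z → a ^ suc k ∣ z
  raise k {x} {y} {z} hx hy e = power-divides (suc k) z
    (∣m+n∣m⇒∣n (subst (a ^ suc k ∣_) e (*-monoʳ-∣ a hx)) (*-monoʳ-∣ a hy))

  -- The colours are the exponents 0, 1 and at least 2. Writing `a ^ 1` for a makes the conclusions
  -- of `raise` fit without conversion.
  data Class (x : ℕ) : Fin 3 → Set where
    val₀ : ¬ a ^ 1 ∣ x → Class x 0F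
    val₁ : a ^ 1 ∣ x → ¬ a ^ 2 ∣ x → Class x 1F
    val₂ : a ^ 2 ∣ x → Class x 2F

  classify : ∀ x → ∃ (Class x)
  classify x with a ^ 1 ∣? x
  ... | no  ¬a∣x = 0F , val₀ ¬a∣x
  ... | yes a∣x with a ^ 2 ∣? x
  ...   | no  ¬a²∣x = 1F , val₁ a∣x ¬a²∣x
  ...   | yes a²∣x  = 2F , val₂ a²∣x

  avoids : Avoids a b (a ^ 3) Class
  avoids = record { classify = classify ; no-sol = no-sol }
    where
    no-sol : ∀ {x y z k} → 1 ≤ y → 1 ≤ z → x < a ^ 3 → z < a ^ 3 →
             Class x k → Class y k → Class z k → a * x ≡ a * y + b * z → ⊥
    no-sol {x} {y} _ _ _ _ (val₀ _) (val₀ _) (val₀ ¬a∣z) e = ¬a∣z (raise 0 (1∣ x) (1∣ y) e)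
    no-sol _ _ _ _ (val₁ hx _) (val₁ hy _) (val₁ _ ¬a²∣z) e = ¬a²∣z (raise 1 hx hy e)
    -- Exponent at least 2 in x and y makes z a positive multiple of a³, which is out of range.
    no-sol _ 1≤z _ z<a³ (val₂ hx) (val₂ hy) (val₂ _) e =
      <⇒≱ z<a³ (∣⇒≤ {{>-nonZero 1≤z}} (raise 2 hx hy e))

-- Lower bound for (2): the repaired exponent colouring

module Consecutive (b : ℕ) where

  a : ℕ
  a = suc b

  coprime : Coprime a b
  coprime {d} (d∣a , d∣b) = ∣1⇒≡1 (∣m+n∣m⇒∣n (subst (d ∣_) (+-comm 1 b) d∣a) d∣b)

  open Valuation a b coprime using (raise)

  -- For z = q a² the equation becomes x - y = q ab. The multiples of a² below a³ have 1 ≤ q ≤ b, so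
  -- their colour may contain non-multiples of a that differ by less than ab or by more than b · ab:
  -- these come from two outer intervals, each of length ab within the range. In colour 2 the
  -- relevant z is a³ with the difference a²b, hence a middle interval of length a²b. The three
  -- lengths add up to a³ + b² - 1.
  data Class (x : ℕ) : Fin 3 → Set where
    low   : ¬ a ∣ x → x ≤ a * b → Class x 0F
    high  : ¬ a ∣ x → a ^ 3 < x + a → Class x 0F
    mid   : ¬ a ∣ x → a * b < x → x + a ≤ a ^ 3 → Class x 2F
    val₁  : a ^ 1 ∣ x → ¬ a ^ 2 ∣ x → Class x 1F
    small : a ^ 2 ∣ x → x < a ^ 3 → Class x 0F
    big   : a ^ 2 ∣ x → a ^ 3 ≤ x → Class x 2F

  a^1∣⇒a∣ : ∀ {x} → a ^ 1 ∣ x → a ∣ x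
  a^1∣⇒a∣ {x} = subst (_∣ x) (*-identityʳ a)

  a∣⇒a^1∣ : ∀ {x} → a ∣ x → a ^ 1 ∣ x
  a∣⇒a^1∣ {x} = subst (_∣ x) (sym (*-identityʳ a))

  a²∣⇒a∣ : ∀ {x} → a ^ 2 ∣ x → a ∣ x
  a²∣⇒a∣ = ∣-trans (m∣m*n (a ^ 1))

  classify : ∀ x → ∃ (Class x)
  classify x with a ∣? x
  ... | no ¬a∣x with x ≤? a * b | x + a ≤? a ^ 3
  ...   | yes p | _     = 0F , low ¬a∣x p
  ...   | no p  | yes q = 2F , mid ¬a∣x (≰⇒> p) q
  ...   | no p  | no q  = 0F , high ¬a∣x (≰⇒> q)
  classify x | yes a∣x with a ^ 2 ∣? x
  ... | no ¬a²∣x = 1F , val₁ (a∣⇒a^1∣ a∣x) ¬a²∣x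
  ... | yes a²∣x with x <? a ^ 3
  ...   | yes p = 0F , small a²∣x p
  ...   | no p  = 2F , big a²∣x (≮⇒≥ p)

  -- With z = q a² every term has a factor a, and cancelling it leaves b z / a = q ab.
  gap : ∀ {x y z} → a * x ≡ a * y + b * z → (h : a ^ 2 ∣ z) → x ≡ y + quotient h * (a * b)
  gap {x} {y} e (divides q refl) = *-cancelˡ-≡ x _ a (trans e (lem b q y))
    where
    lem : ∀ b q y → suc b * y + b * (q * (suc b * (suc b * 1))) ≡ suc b * (y + q * (suc b * b))
    lem = solve-∀

  avoids : Avoids a b (a ^ 3 + b ^ 2) Class
  avoids = record { classify = classify ; no-sol = no-sol }
    where
    open ≤-Reasoning

    gap-divides : ∀ {x y} q → x ≡ y + q * (a * b) → a ∣ x → a ∣ y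
    gap-divides {x} {y} q e a∣x = ∣m+n∣m⇒∣n (subst (a ∣_) (trans e (+-comm y _)) a∣x)
                                    (∣-trans (m∣m*n b) (n∣m*n q))

    divides-gap : ∀ {x y} q → x ≡ y + q * (a * b) → a ∣ y → a ∣ x
    divides-gap {x} {y} q e a∣y =
      subst (a ∣_) (sym e) (∣m∣n⇒∣m+n a∣y (∣-trans (m∣m*n b) (n∣m*n q)))

    -- The difference q ab is a multiple of a, so x and y are both multiples of a or both not.
    -- Multiples of a in colour 0 are multiples of a², and `¬both` excludes two of them.
    -- Non-multiples in the same outer interval are less than ab apart, and those in opposite ones
    -- more than b · ab.
    zero-case : ∀ {x y} q → 1 ≤ q → q ≤ b → 1 ≤ y → x < a ^ 3 + b ^ 2 → x ≡ y + q * (a * b) →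
                ¬ (a ^ 2 ∣ x × a ^ 2 ∣ y) → Class x 0F → Class y 0F → ⊥
    zero-case {x} {y} q 1≤q q≤b 1≤y x< e ¬both = go
      where
      x≥ : y + a * b ≤ x
      x≥ = begin
        y + a * b       ≡⟨ cong (λ v → y + v) (sym (*-identityˡ (a * b))) ⟩
        y + 1 * (a * b) ≤⟨ +-monoʳ-≤ y (*-monoˡ-≤ (a * b) 1≤q) ⟩
        y + q * (a * b) ≡⟨ sym e ⟩
        x               ∎
      go : Class x 0F → Class y 0F → ⊥
      go (small hx _) (small hy _)  = ¬both (hx , hy)
      go (small hx _) (low ¬a∣y _)  = ¬a∣y (gap-divides q e (a²∣⇒a∣ hx))
      go (small hx _) (high ¬a∣y _) = ¬a∣y (gap-divides q e (a²∣⇒a∣ hx))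
      go (low ¬a∣x _)  (small hy _) = ¬a∣x (divides-gap q e (a²∣⇒a∣ hy))
      go (high ¬a∣x _) (small hy _) = ¬a∣x (divides-gap q e (a²∣⇒a∣ hy))
      go (low _ x≤) _  = <⇒≱ (+-monoˡ-≤ (a * b) 1≤y) (≤-trans x≥ x≤)
      -- The largest number in range minus the first one above a³ - a is b² + a - 2 = ab - 1, just
      -- less than the smallest difference. A larger summand than b² in the bound would break this.
      go (high _ _) (high _ y>) = <-irrefl refl (begin-strict
        a ^ 3 + a * b         <⟨ +-monoˡ-< (a * b) y> ⟩
        y + a + a * b         ≡⟨ swap y a (a * b) ⟩
        y + a * b + a         ≤⟨ +-monoˡ-≤ a x≥ ⟩
        x + a                 ≡⟨ +-suc x b ⟩
        suc x + b             ≤⟨ +-monoˡ-≤ b x< ⟩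
        a ^ 3 + b ^ 2 + b     ≡⟨ lem b (a ^ 3) ⟩
        a ^ 3 + a * b         ∎)
        where
        swap : ∀ y a c → y + a + c ≡ y + c + a
        swap = solve-∀
        lem : ∀ b A → A + b * (b * 1) + b ≡ A + suc b * b
        lem = solve-∀
      -- Even the largest difference, starting at the end ab of the low interval, stops short: ab +
      -- b · ab = a³ - a².
      go (high _ x>) (low _ y≤) = <⇒≱ x> (begin
        x + a                       ≡⟨ cong (_+ a) e ⟩
        y + q * (a * b) + a         ≤⟨ +-monoˡ-≤ a (+-mono-≤ y≤ (*-monoˡ-≤ (a * b) q≤b)) ⟩
        a * b + b * (a * b) + a     ≤⟨ +-monoʳ-≤ (a * b + b * (a * b)) (m≤m*n a a) ⟩
        a * b + b * (a * b) + a * a ≡⟨ lem b ⟩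
        a ^ 3                       ∎)
        where
        lem : ∀ b → suc b * b + b * (suc b * b) + suc b * suc b ≡ suc b * (suc b * (suc b * 1))
        lem = solve-∀

    no-sol : ∀ {x y z k} → 1 ≤ y → 1 ≤ z → x < a ^ 3 + b ^ 2 → z < a ^ 3 + b ^ 2 →
             Class x k → Class y k → Class z k → a * x ≡ a * y + b * z → ⊥
    no-sol _ _ _ _ (val₁ hx _) (val₁ hy _) (val₁ _ ¬a²∣z) e = ¬a²∣z (raise 1 hx hy e)
    -- In every solution a divides z, whatever x and y are; this settles the three kinds of
    -- non-multiples in the position of z.
    no-sol {x} {y} _ _ _ _ _ _ (low ¬a∣z _) e = ¬a∣z (a^1∣⇒a∣ (raise 0 (1∣ x) (1∣ y) e))
    no-sol {x} {y} _ _ _ _ _ _ (high ¬a∣z _) e = ¬a∣z (a^1∣⇒a∣ (raise 0 (1∣ x) (1∣ y) e))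
    no-sol {x} {y} _ _ _ _ _ _ (mid ¬a∣z _ _) e = ¬a∣z (a^1∣⇒a∣ (raise 0 (1∣ x) (1∣ y) e))
    -- From 0 < q a² < a³ follows 1 ≤ q ≤ b. Two multiples of a² as x and y would make z a multiple
    -- of a³.
    no-sol {x} {y} {z} 1≤y 1≤z x< _ cx cy (small h z<) e =
      zero-case (quotient h) 1≤q q≤b 1≤y x< (gap e h) ¬both cx cy
      where
      z≡ : z ≡ quotient h * a ^ 2
      z≡ = _∣_.equality h
      1≤q : 1 ≤ quotient h
      1≤q = n≢0⇒n>0 λ q≡0 → <-irrefl (sym (trans z≡ (cong (_* a ^ 2) q≡0))) 1≤z
      q≤b : quotient h ≤ b
      q≤b = s≤s⁻¹ (*-cancelʳ-< (a ^ 2) (quotient h) a (subst (_< a ^ 3) z≡ z<))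
      ¬both : ¬ (a ^ 2 ∣ x × a ^ 2 ∣ y)
      ¬both (hx , hy) = <⇒≱ z< (∣⇒≤ {{>-nonZero 1≤z}} (raise 2 hx hy e))
    -- Now q ≥ a, so x - y is at least a²b, and colour 2 has no such difference below the bound.
    no-sol {x} {y} {z} 1≤y 1≤z x< _ cx cy (big h z≥) e = go cx cy
      where
      q≥a : a ≤ quotient h
      q≥a = *-cancelʳ-≤ a (quotient h) (a ^ 2) (subst (a ^ 3 ≤_) (_∣_.equality h) z≥)
      x≥ : y + a * (a * b) ≤ x
      x≥ = ≤-trans (+-monoʳ-≤ y (*-monoˡ-≤ (a * b) q≥a)) (≤-reflexive (sym (gap e h)))
      go : Class x 2F → Class y 2F → ⊥
      go (big hx _) (mid ¬a∣y _ _) = ¬a∣y (gap-divides (quotient h) (gap e h) (a²∣⇒a∣ hx))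
      -- From y ≥ a³ the difference a²b ≥ b² leads out of the range.
      go _ (big _ y≥) = <⇒≱ x< (begin
        a ^ 3 + b * (b * 1) ≤⟨ +-mono-≤ y≥ (*-mono-≤ (n≤1+n b) (*-monoʳ-≤ b (s≤s {n = b} z≤n))) ⟩
        y + a * (b * a)     ≡⟨ cong (λ v → y + a * v) (*-comm b a) ⟩
        y + a * (a * b)     ≤⟨ x≥ ⟩
        x                   ∎)
      -- By a³ = ab + a²b + a the middle interval (ab , a³ - a] has exactly a²b elements, one too
      -- few for the difference a²b.
      go (mid _ _ x≤) (mid _ y> _) = <⇒≱ y> (+-cancelʳ-≤ (a * (a * b) + a) y (a * b) (begin
        y + (a * (a * b) + a)     ≡⟨ sym (+-assoc y _ a) ⟩
        y + a * (a * b) + a       ≤⟨ +-monoˡ-≤ a x≥ ⟩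
        x + a                     ≤⟨ x≤ ⟩
        a ^ 3                     ≡⟨ lem b ⟩
        a * b + (a * (a * b) + a) ∎))
        where
        lem : ∀ b → suc b * (suc b * (suc b * 1)) ≡ suc b * b + (suc b * (suc b * b) + suc b)
        lem = solve-∀

-- Lower bound for (1): block colourings

-- M is the 2-colour Rado number of x − y = kz: the colours 0 and 1 on [1 , M) are repeated on
-- S + [1 , M), and [M , S] gets colour 2.
module Blocks (t : ℕ) where

  k M S : ℕ
  k = suc t
  M = suc k * suc k + k
  S = k * ((2 + k) * (2 + k))

  -- This explains the choice of S: the least value of y + kz with y, z ≥ M is M + kM, so colour 2
  -- may fill the block from M to one less than that.
  1+S≡M+kM : suc S ≡ M + k * M
  1+S≡M+kM = lem t
    where
    lem : ∀ t → suc (suc t * ((3 + t) * (3 + t))) ≡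
                (2 + t) * (2 + t) + suc t + suc t * ((2 + t) * (2 + t) + suc t)
    lem = solve-∀

  M≤S : M ≤ S
  -- The difference S - M, expanded in t, has natural coefficients.
  M≤S = subst (M ≤_) (lem t) (m≤m+n M _)
    where
    lem : ∀ t → (2 + t) * (2 + t) + suc t + (t * t * t + 6 * (t * t) + 10 * t + 4) ≡
                suc t * ((3 + t) * (3 + t))
    lem = solve-∀

  -- The block construction one level down. The 1-colour number is k + 1; the block [1 , k] is
  -- repeated after k(k + 2) = (k + 1)² - 1, and the numbers between the two copies get colour 1.
  data Low (x : ℕ) : Fin 3 → Set where
    bottom : x ≤ k → Low x 0F
    middle : k < x → x < suc k * suc k → Low x 1F
    top    : suc k * suc k ≤ x → x < M → Low x 0F

  low<M : ∀ {x i} → Low x i → x < M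
  low<M (bottom x≤k)   = ≤-<-trans x≤k (m<n+m k {suc k * suc k} (s≤s z≤n))
  low<M (middle _ x<)  = <-≤-trans x< (m≤m+n _ k)
  low<M (top _ x<M)    = x<M

  -- `high` carries the offset x′, so that matching replaces an element of the upper copy by its
  -- counterpart in [1 , M). `beyond` makes the colouring total.
  data Class (x : ℕ) : Fin 3 → Set where
    low    : ∀ {i} → Low x i → Class x i
    mid    : M ≤ x → x ≤ S → Class x 2F
    high   : ∀ {i} x′ → x ≡ S + x′ → 1 ≤ x′ → Low x′ i → Class x i
    beyond : S + M ≤ x → Class x 0F

  classifyLow : ∀ x → x < M → ∃ (Low x)
  classifyLow x x<M with x ≤? k | x <? suc k * suc k
  ... | yes p | _     = 0F , bottom p
  ... | no p  | yes q = 1F , middle (≰⇒> p) q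
  ... | no p  | no q  = 0F , top (≮⇒≥ q) x<M

  classify : ∀ x → ∃ (Class x)
  classify x with x <? M | x ≤? S | x <? S + M
  ... | yes x<M | _       | _      = let i , l = classifyLow x x<M in i , low l
  ... | no x≮M  | yes x≤S | _      = 2F , mid (≮⇒≥ x≮M) x≤S
  ... | no _    | no x≰S  | no x≮  = 0F , beyond (≮⇒≥ x≮)
  ... | no _    | no x≰S  | yes x< with m≤n⇒∃[o]m+o≡n (≰⇒> x≰S)
  ...   | d , refl = let i , l = classifyLow (suc d) (+-cancelˡ-< S (suc d) M (subst (_< S + M) (sym (+-suc S d)) x<))
                     in i , high (suc d) (sym (+-suc S d)) (s≤s z≤n) l

  open ≤-Reasoning

  -- In colour 1, y + kz is at least (k + 1) + k(k + 1) = (k + 1)², beyond the middle block. In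
  -- colour 0, a top element in the place of y or z lifts the sum to M or more, while two bottom
  -- elements give a sum from k + 1 to k + k², which is in the middle block.
  no-low : ∀ {x y z i} → 1 ≤ y → 1 ≤ z → Low x i → Low y i → Low z i → x ≡ y + k * z → ⊥
  no-low {x} {y} {z} 1≤y 1≤z (middle _ x<) (middle k<y _) (middle k<z _) e = <⇒≱ x< (begin
    suc k + k * suc k ≤⟨ +-mono-≤ k<y (*-monoʳ-≤ k k<z) ⟩
    y + k * z         ≡⟨ sym e ⟩
    x                 ∎)
  no-low {x} {y} {z} 1≤y 1≤z lx ly (top z≥ _) e = <⇒≱ (low<M lx) (begin
    -- The polynomial in t is 1 + k(k + 1)² - M.
    M                             ≤⟨ m≤m+n M (t * t * t + 4 * (t * t) + 3 * t) ⟩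
    M + (t * t * t + 4 * (t * t) + 3 * t) ≡⟨ lem t ⟩
    1 + k * (suc k * suc k)       ≤⟨ +-mono-≤ 1≤y (*-monoʳ-≤ k z≥) ⟩
    y + k * z                     ≡⟨ sym e ⟩
    x                             ∎)
    where
    lem : ∀ t → (2 + t) * (2 + t) + suc t + (t * t * t + 4 * (t * t) + 3 * t) ≡
                1 + suc t * ((2 + t) * (2 + t))
    lem = solve-∀
  no-low {x} {y} {z} 1≤y 1≤z lx (top y≥ _) (bottom _) e = <⇒≱ (low<M lx) (begin
    suc k * suc k + k     ≡⟨ cong (λ v → suc k * suc k + v) (sym (*-identityʳ k)) ⟩
    suc k * suc k + k * 1 ≤⟨ +-mono-≤ y≥ (*-monoʳ-≤ k 1≤z) ⟩
    y + k * z             ≡⟨ sym e ⟩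
    x                     ∎)
  no-low {x} {y} {z} 1≤y 1≤z (bottom x≤k) (bottom _) (bottom _) e = <⇒≱ (s≤s x≤k) (begin
    1 + k     ≡⟨ cong suc (sym (*-identityʳ k)) ⟩
    1 + k * 1 ≤⟨ +-mono-≤ 1≤y (*-monoʳ-≤ k 1≤z) ⟩
    y + k * z ≡⟨ sym e ⟩
    x         ∎)
  no-low {x} {y} {z} 1≤y 1≤z (top x≥ _) (bottom y≤k) (bottom z≤k) e = <-irrefl refl (begin-strict
    x             ≡⟨ e ⟩
    y + k * z     ≤⟨ +-mono-≤ y≤k (*-monoʳ-≤ k z≤k) ⟩
    k + k * k     <⟨ s≤s (+-monoʳ-≤ k (*-monoʳ-≤ k (n≤1+n k))) ⟩
    suc k * suc k ≤⟨ x≥ ⟩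
    x             ∎)

  avoids : Avoids 1 k (S + M) Class
  avoids = record { classify = classify ; no-sol = λ {x} {y} {z} 1≤y 1≤z x< _ cx cy cz e →
                    go 1≤y 1≤z x< cx cy cz (trans (sym (*-identityˡ x)) (trans e (cong (_+ k * z) (*-identityˡ y)))) }
    where
    z≤kz : ∀ z → z ≤ k * z
    z≤kz z = m≤m+n z (t * z)

    high≥M : ∀ {x} x′ → x ≡ S + x′ → M ≤ x
    high≥M x′ refl = ≤-trans M≤S (m≤m+n S x′)

    below : ∀ {x i} → x < M → Class x i → Low x i
    below x<M (low l)          = l
    below x<M (mid M≤x _)      = contradiction M≤x (<⇒≱ x<M)
    below x<M (high x′ e _ _)  = contradiction (high≥M x′ e) (<⇒≱ x<M)
    below x<M (beyond x≥)      = contradiction (≤-trans (m≤n+m M S) x≥) (<⇒≱ x<M)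

    -- x and z lie in the upper copy.  For k = 1 the equation is symmetric in y and z.
    low-high : ∀ {x y z i} s → s ≡ t → 1 ≤ y → 1 ≤ z → Low x i → Low y i → Low z i →
               x ≡ y + (z + s * (S + z)) → ⊥
    low-high {x} {y} {z} zero refl 1≤y 1≤z lx ly lz e = no-low 1≤z 1≤y lx lz ly
      (trans e (trans (+-comm y _) (cong₂ _+_ (+-identityʳ z) (sym (*-identityˡ y)))))
    low-high {x} {y} {z} (suc s) refl 1≤y 1≤z lx ly lz e = <⇒≱ (low<M lx) (begin
      M                         ≤⟨ M≤S ⟩
      S                         ≤⟨ m≤m+n S (z + s * (S + z)) ⟩
      S + (z + s * (S + z))     ≡⟨ sym (+-assoc S z _) ⟩
      suc s * (S + z)           ≤⟨ m≤n+m _ z ⟩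
      z + suc s * (S + z)       ≤⟨ m≤n+m _ y ⟩
      y + (z + suc s * (S + z)) ≡⟨ sym e ⟩
      x                         ∎)

    -- The position of x decides. Below M, all three numbers are below M. In [M , S], the colour
    -- forces y and z to be at least M, and M + kM exceeds S. In the upper copy, y and z cannot both
    -- lie below M; subtracting S from x and from one of them leaves a solution of the 2-colour
    -- problem, or, for k ≥ 2, a sum that is too large.
    go : ∀ {x y z i} → 1 ≤ y → 1 ≤ z → x < S + M → Class x i → Class y i → Class z i →
         x ≡ y + k * z → ⊥
    go {x} {y} {z} 1≤y 1≤z x< (low lx) cy cz e =
      no-low 1≤y 1≤z lx (below (≤-<-trans y≤x x<M) cy) (below (≤-<-trans z≤x x<M) cz) e
      where
      x<M : x < M
      x<M = low<M lx
      y≤x : y ≤ x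
      y≤x = subst (y ≤_) (sym e) (m≤m+n y (k * z))
      z≤x : z ≤ x
      z≤x = subst (z ≤_) (sym e) (≤-trans (z≤kz z) (m≤n+m (k * z) y))
    go 1≤y 1≤z x< (beyond x≥) cy cz e = <⇒≱ x< x≥
    go {x} {y} {z} 1≤y 1≤z x< (mid _ x≤S) cy cz e = <⇒≱ (s≤s x≤S) (begin
      suc S     ≡⟨ 1+S≡M+kM ⟩
      M + k * M ≤⟨ +-mono-≤ (≥M cy) (*-monoʳ-≤ k (≥M cz)) ⟩
      y + k * z ≡⟨ sym e ⟩
      x         ∎)
      where
      ≥M : ∀ {v} → Class v 2F → M ≤ v
      ≥M (mid M≤v _)       = M≤v
      ≥M (high v′ e _ _)   = high≥M v′ e
    go 1≤y 1≤z x< (high x′ ex 1≤x′ lx) (beyond y≥) cz e = <⇒≱ x< (≤-trans y≥ (subst (_ ≤_) (sym e) (m≤m+n _ _)))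
    go {x} {y} {z} 1≤y 1≤z x< (high x′ ex 1≤x′ lx) (high y′ refl 1≤y′ ly) cz e =
      -- S cancels from x and y, and then z ≤ kz ≤ x′ < M puts z into the lower copy.
      no-low 1≤y′ 1≤z lx ly (below (≤-<-trans z≤x′ (low<M lx)) cz) x′≡
      where
      x′≡ : x′ ≡ y′ + k * z
      x′≡ = +-cancelˡ-≡ S x′ _ (trans (sym ex) (trans e (+-assoc S y′ (k * z))))
      z≤x′ : z ≤ x′
      z≤x′ = subst (z ≤_) (sym x′≡) (≤-trans (z≤kz z) (m≤n+m (k * z) y′))
    go {x} {y} {z} 1≤y 1≤z x< (high x′ ex 1≤x′ lx) (low ly) (low lz) e = <-irrefl refl (begin-strict
      S         <⟨ m<m+n S 1≤x′ ⟩
      S + x′    ≡⟨ sym ex ⟩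
      x         ≡⟨ e ⟩
      -- Here y + kz < M + kM = S + 1, so the sum does not reach the upper copy.
      y + k * z ≤⟨ s≤s⁻¹ (subst (y + k * z <_) (sym 1+S≡M+kM) (+-mono-<-≤ (low<M ly) (*-monoʳ-≤ k (<⇒≤ (low<M lz))))) ⟩
      S         ∎)
    -- One S cancels. For k = 1 this leaves x′ = y + z′; for k ≥ 2 another S stays on the right,
    -- although x′ < M ≤ S.
    go {x} {y} {z} 1≤y 1≤z x< (high x′ ex 1≤x′ lx) (low ly) (high z′ refl 1≤z′ lz) e =
      low-high t refl 1≤y 1≤z′ lx ly lz
        (+-cancelˡ-≡ S x′ _ (trans (sym ex) (trans e (lem y S z′ (t * (S + z′))))))
      where
      lem : ∀ y S z r → y + (S + z + r) ≡ S + (y + (z + r))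
      lem = solve-∀
    go 1≤y 1≤z x< (high _ _ _ ()) (mid _ _) cz e
    go {x} {y} {z} 1≤y 1≤z x< (high x′ ex 1≤x′ lx) (low ly) (beyond z≥) e =
      <⇒≱ x< (≤-trans z≥ (subst (z ≤_) (sym e) (≤-trans (z≤kz z) (m≤n+m (k * z) y))))

-- The three parts and the theorem

-- Each part proves `validᵇ C ≡ true` by `refl`, and this is where the checker is evaluated. The
-- other equations replace the values of the certificate's polynomials by the expressions in the
-- theorem.
upper : ∀ {n} (C : Certificate n) → validᵇ C ≡ true → ∀ ρ {a b N} →
        let open Certificate C renaming (N to bound) in
        ⟦ α ⟧ ρ ≡ a → ⟦ β ⟧ ρ ≡ b → ⟦ bound ⟧ ρ ≡ N → ∀ c → LinearSol a b N c
upper C valid ρ refl refl refl c = valid⇒Sol C ρ c (Equivalence.from T-≡ valid)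

part1 : ∀ t → IsRadoNumber (eqA (+ (1 + t))) 3 ((3 + t) ^ 3 ∸ (3 + t) ^ 2 ∸ (3 + t) ∸ 1)
part1 t = subst (IsRadoNumber (eqA (+ (1 + t))) 3) (sym bound≡)
  (isRado (eqA (+ (1 + t))) (eqA⁻ (1 + t)) (eqA⁺ (1 + t))
          (≤-trans (s≤s z≤n) (m≤n+m M S))
          (upper certificate1 refl (t ∷ []) (α≡ t) (β≡ t) (N≡ t)) avoids)
  where
  open Blocks t
  -- The left-hand sides here and below are the Horner forms to which `⟦_⟧` reduces on the
  -- certificate.
  α≡ : ∀ t → 1 + t * 0 ≡ 1
  α≡ = solve-∀
  β≡ : ∀ t → 1 + t * (1 + t * 0) ≡ 1 + t
  β≡ = solve-∀
  N≡ : ∀ t → 14 + t * (20 + t * (8 + t * (1 + t * 0))) ≡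
             suc t * ((3 + t) * (3 + t)) + ((2 + t) * (2 + t) + suc t)
  N≡ = solve-∀
  -- The right-hand side is nested in the order m², m, 1, so that each truncated subtraction removes
  -- the leading summand.
  cube : ∀ t → (3 + t) * ((3 + t) * ((3 + t) * 1)) ≡ (3 + t) * ((3 + t) * 1) +
               (3 + t + (1 + (suc t * ((3 + t) * (3 + t)) + ((2 + t) * (2 + t) + suc t))))
  cube = solve-∀
  bound≡ : (3 + t) ^ 3 ∸ (3 + t) ^ 2 ∸ (3 + t) ∸ 1 ≡ S + M
  bound≡ = begin
    (3 + t) ^ 3 ∸ (3 + t) ^ 2 ∸ (3 + t) ∸ 1
      ≡⟨ cong (λ v → v ∸ (3 + t) ^ 2 ∸ (3 + t) ∸ 1) (cube t) ⟩
    (3 + t) ^ 2 + (3 + t + (1 + (S + M))) ∸ (3 + t) ^ 2 ∸ (3 + t) ∸ 1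
      ≡⟨ cong (λ v → v ∸ (3 + t) ∸ 1) (m+n∸m≡n ((3 + t) ^ 2) (3 + t + (1 + (S + M)))) ⟩
    3 + t + (1 + (S + M)) ∸ (3 + t) ∸ 1
      ≡⟨ cong (_∸ 1) (m+n∸m≡n (3 + t) (1 + (S + M))) ⟩
    S + M ∎
    where open ≡-Reasoning

part2 : ∀ t → IsRadoNumber (eqB (+ (3 + t)) (+ (2 + t))) 3 ((3 + t) ^ 3 + (2 + t) ^ 2)
part2 t =
  isRado (eqB (+ (3 + t)) (+ (2 + t))) (eqB⁻ (3 + t) (2 + t)) (eqB⁺ (3 + t) (2 + t))
         (≤-trans (m^n>0 (3 + t) 3) (m≤m+n _ _))
         (upper certificate2 refl (t ∷ []) (α≡ t) (β≡ t) (N≡ t)) (Consecutive.avoids (2 + t))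
  where
  α≡ : ∀ t → 3 + t * (1 + t * 0) ≡ 3 + t
  α≡ = solve-∀
  β≡ : ∀ t → 2 + t * (1 + t * 0) ≡ 2 + t
  β≡ = solve-∀
  N≡ : ∀ t → 31 + t * (31 + t * (10 + t * (1 + t * 0))) ≡
             (3 + t) * ((3 + t) * ((3 + t) * 1)) + (2 + t) * ((2 + t) * 1)
  N≡ = solve-∀

part3 : ∀ b′ t → let b = 1 + b′; a = b + 2 + t in
        gcd a b ≡ 1 → IsRadoNumber (eqB (+ a) (+ b)) 3 (a ^ 3)
part3 b′ t gcd≡1 =
  isRado (eqB (+ a) (+ b)) (eqB⁻ a b) (eqB⁺ a b) (m^n>0 a 3)
         -- `cubic` has the powers of t outermost, hence t is the first argument.
         (upper certificate3 refl (t ∷ b′ ∷ []) (α≡ t b′) (β≡ t b′) (N≡ t b′))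
         (Valuation.avoids a b (gcd≡1⇒coprime gcd≡1))
  where
  b a : ℕ
  b = 1 + b′
  a = b + 2 + t
  α≡ : ∀ t b → 3 + b * (1 + b * 0) + t * (1 + b * 0 + t * 0) ≡ 1 + b + 2 + t
  α≡ = solve-∀
  β≡ : ∀ t b → 1 + b * (1 + b * 0) + t * 0 ≡ 1 + b
  β≡ = solve-∀
  N≡ : ∀ t b → 27 + b * (27 + b * (9 + b * (1 + b * 0))) +
               t * (27 + b * (18 + b * (3 + b * 0)) +
               t * (9 + b * (3 + b * 0) + t * (1 + b * 0 + t * 0))) ≡
               (1 + b + 2 + t) * ((1 + b + 2 + t) * ((1 + b + 2 + t) * 1))
  N≡ = solve-∀

theorem1 : ((m : ℕ) → 3 ≤ m → IsRadoNumber (eqA (+ (m ∸ 2))) 3 (m ^ 3 ∸ m ^ 2 ∸ m ∸ 1))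
    × ((a : ℕ) → 3 ≤ a → IsRadoNumber (eqB (+ a) (+ (a ∸ 1))) 3 (a ^ 3 + (a ∸ 1) ^ 2))
    × ((a b : ℕ) → 1 ≤ b → b + 2 ≤ a → gcd a b ≡ 1 → IsRadoNumber (eqB (+ a) (+ b)) 3 (a ^ 3))
theorem1 = first , second , third
  where
  first : ∀ m → 3 ≤ m → IsRadoNumber (eqA (+ (m ∸ 2))) 3 (m ^ 3 ∸ m ^ 2 ∸ m ∸ 1)
  -- Three matches on the inequality turn m into 3 + t, and then m ∸ 2 computes to 1 + t.
  first _ (s≤s (s≤s (s≤s {n = t} z≤n))) = part1 t
  second : ∀ a → 3 ≤ a → IsRadoNumber (eqB (+ a) (+ (a ∸ 1))) 3 (a ^ 3 + (a ∸ 1) ^ 2)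
  second _ (s≤s (s≤s (s≤s {n = t} z≤n))) = part2 t
  third : ∀ a b → 1 ≤ b → b + 2 ≤ a → gcd a b ≡ 1 → IsRadoNumber (eqB (+ a) (+ b)) 3 (a ^ 3)
  third a (suc b′) _ b+2≤a gcd≡1 with m≤n⇒∃[o]m+o≡n b+2≤a
  ... | t , refl = part3 b′ t gcd≡1
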